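{- Over the standard structure $\mathbb{N}$ of arithmetic, a relation $X\subseteq\mathbb{N}^k$ is definable by a formula of $\mathrm{BndSCL}$ (i.e., there is $\varphi(x_1,\dots,x_k)$ with $(m_1,\dots,m_k)\in X$ iff $\mathbb{N},[m_i/x_i]\models_\omega\varphi$) if and only if $X$ is a $\Sigma^0_{\omega+1}$-relation.
   Context: Fix a reasonable Gödel numbering $\ulcorner\cdot\urcorner$ of formulas of first-order arithmetic and let $T=\{\ulcorner\varphi\urcorner : \varphi$ a first-order sentence in prenex normal form with $\mathbb{N}\models\varphi\}$. A relation $X\subseteq\mathbb{N}^k$ is $\Sigma^0_{\omega+1}$ if there is a relation $R\subseteq\mathbb{N}^{k+\ell}$ computable by a Turing machine with oracle access to (the characteristic function of) $T$ such that $(x_1,\dots,x_k)\in X$ iff $\exists y_1\dots\exists y_\ell\,R(x_1,\dots,x_k,y_1,\dots,y_\ell)$. Syntax of $\mathrm{BndSCL}$. $\mathrm{FO}$ has equality and $\bot$ as primitives and $\neg,\wedge,\vee,\exists,\forall$. Fix label symbols $L_0,L_1,\dots$ and for each $L$ a claim symbol $C_L$. Formulas: $\mathrm{FO}$ formation rules plus: each $C_L$ is atomic (no free variables); if $\varphi$ is a formula, $L\varphi$ is a formula (same free variables). FO-atoms are atomic formulas of $\mathrm{FO}$. The reference formula of an occurrence of $C_L$ is the subformula occurrence $L\psi$ above it in the syntax tree with no occurrence of $L$ strictly between (if any). Semantics. $\mathcal{G}_n(\mathfrak{A},s,\varphi)$ has positions $(\psi,r,\#,m)$, $\#\in\{+,-\}$,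 clock $m$, starting at $(\varphi,s,+,n)$. FO-atom $\alpha$: if $\#=+$ Eloise wins iff $\mathfrak{A},r\models\alpha$, else Abelard; if $\#=-$ Abelard wins iff $\mathfrak{A},r\models\alpha$, else Eloise. $\neg$ flips the sign. $\wedge$: Abelard chooses if $+$, Eloise if $-$. $\vee$: Eloise if $+$, Abelard if $-$. $\forall x$: Abelard picks $a\in A$ if $+$, Eloise if $-$, assignment becomes $r[a/x]$. $\exists x$: Eloise if $+$, Abelard if $-$. $L\psi$: move to $\psi$. $C_L$: if $m>0$ move to its reference formula with clock $m-1$; if $m=0$ (or no reference formula) the play ends with no winner. $\mathcal{G}_\omega$: Abelard picks $n'$, Eloise picks $n\ge n'$, then $\mathcal{G}_n$. $\mathfrak{A},s\models_\omega\varphi$ iff Eloise has a winning strategy in $\mathcal{G}_\omega(\mathfrak{A},s,\varphi)$. -}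

module Defs where

open import Data.Nat using (ℕ; zero; suc; _+_; _*_; _∸_; _^_; _≤_; _<_; _<?_)
open import Data.Nat.Properties using (_≟_)
open import Data.Fin using (Fin; fromℕ<)
open import Data.Vec using (Vec; []; _∷_; lookup; _++_)
open import Data.List using (List; []; _∷_)
open import Data.Maybe using (Maybe; just; nothing)
open import Data.Product using (Σ; _×_; _,_)
open import Data.Sum using (_⊎_)
open import Data.Empty using (⊥)
open import Data.Unit using (⊤)
open import Relation.Nullary using (¬_; yes; no)
open import Relation.Binary.PropositionalEquality using (_≡_; _≢_)
open import Function.Bundles using (_⇔_)

data Tm : Set where
  var   : ℕ → Tm
  zeroᵗ : Tm
  sucᵗ  : Tm → Tm
  _+ᵗ_  : Tm → Tm → Tm
  _*ᵗ_  : Tm → Tm → Tm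

Assign : Set
Assign = ℕ → ℕ

⟦_⟧ᵗ : Tm → Assign → ℕ
⟦ var x ⟧ᵗ r = r x
⟦ zeroᵗ ⟧ᵗ r = 0
⟦ sucᵗ t ⟧ᵗ r = suc (⟦ t ⟧ᵗ r)
⟦ t +ᵗ u ⟧ᵗ r = ⟦ t ⟧ᵗ r + ⟦ u ⟧ᵗ r
⟦ t *ᵗ u ⟧ᵗ r = ⟦ t ⟧ᵗ r * ⟦ u ⟧ᵗ r

_[_≔_] : Assign → ℕ → ℕ → Assign
(r [ x ≔ a ]) y with y ≟ x
... | yes _ = a
... | no  _ = r y

FreeTm : ℕ → Tm → Set
FreeTm x (var y) = x ≡ y
FreeTm x zeroᵗ = ⊥
FreeTm x (sucᵗ t) = FreeTm x t
FreeTm x (t +ᵗ u) = FreeTm x t ⊎ FreeTm x u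
FreeTm x (t *ᵗ u) = FreeTm x t ⊎ FreeTm x u

data Form : Set where
  _≐_  : Tm → Tm → Form
  ⊥ᶠ   : Form
  ¬ᶠ_  : Form → Form
  _∧ᶠ_ : Form → Form → Form
  _∨ᶠ_ : Form → Form → Form
  ∃ᶠ   : ℕ → Form → Form
  ∀ᶠ   : ℕ → Form → Form

⟦_⟧ᶠ : Form → Assign → Set
⟦ t ≐ u ⟧ᶠ r = ⟦ t ⟧ᵗ r ≡ ⟦ u ⟧ᵗ r
⟦ ⊥ᶠ ⟧ᶠ r = ⊥
⟦ ¬ᶠ φ ⟧ᶠ r = ¬ ⟦ φ ⟧ᶠ r
⟦ φ ∧ᶠ ψ ⟧ᶠ r = ⟦ φ ⟧ᶠ r × ⟦ ψ ⟧ᶠ r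
⟦ φ ∨ᶠ ψ ⟧ᶠ r = ⟦ φ ⟧ᶠ r ⊎ ⟦ ψ ⟧ᶠ r
⟦ ∃ᶠ x φ ⟧ᶠ r = Σ ℕ λ a → ⟦ φ ⟧ᶠ (r [ x ≔ a ])
⟦ ∀ᶠ x φ ⟧ᶠ r = (a : ℕ) → ⟦ φ ⟧ᶠ (r [ x ≔ a ])

FreeF : ℕ → Form → Set
FreeF x (t ≐ u) = FreeTm x t ⊎ FreeTm x u
FreeF x ⊥ᶠ = ⊥
FreeF x (¬ᶠ φ) = FreeF x φ
FreeF x (φ ∧ᶠ ψ) = FreeF x φ ⊎ FreeF x ψ
FreeF x (φ ∨ᶠ ψ) = FreeF x φ ⊎ FreeF x ψ
FreeF x (∃ᶠ y φ) = x ≢ y × FreeF x φ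
FreeF x (∀ᶠ y φ) = x ≢ y × FreeF x φ

Sentence : Form → Set
Sentence φ = (x : ℕ) → ¬ FreeF x φ

data QuantFree : Form → Set where
  qf≐ : ∀ {t u} → QuantFree (t ≐ u)
  qf⊥ : QuantFree ⊥ᶠ
  qf¬ : ∀ {φ} → QuantFree φ → QuantFree (¬ᶠ φ)
  qf∧ : ∀ {φ ψ} → QuantFree φ → QuantFree ψ → QuantFree (φ ∧ᶠ ψ)
  qf∨ : ∀ {φ ψ} → QuantFree φ → QuantFree ψ → QuantFree (φ ∨ᶠ ψ)

data Prenex : Form → Set where
  matrix : ∀ {φ} → QuantFree φ → Prenex φ
  pre∃   : ∀ {x φ} → Prenex φ → Prenex (∃ᶠ x φ)
  pre∀   : ∀ {x φ} → Prenex φ → Prenex (∀ᶠ x φ)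

-- A fixed Gödel numbering, via the pairing bijection
-- ⟨a , b⟩ = 2^a * (2b+1) - 1  of ℕ × ℕ onto ℕ.

⟨_,_⟩ : ℕ → ℕ → ℕ
⟨ a , b ⟩ = (2 ^ a) * (2 * b + 1) ∸ 1

⌜_⌝ᵗ : Tm → ℕ
⌜ var x ⌝ᵗ = ⟨ 0 , x ⟩
⌜ zeroᵗ ⌝ᵗ = ⟨ 1 , 0 ⟩
⌜ sucᵗ t ⌝ᵗ = ⟨ 2 , ⌜ t ⌝ᵗ ⟩
⌜ t +ᵗ u ⌝ᵗ = ⟨ 3 , ⟨ ⌜ t ⌝ᵗ , ⌜ u ⌝ᵗ ⟩ ⟩
⌜ t *ᵗ u ⌝ᵗ = ⟨ 4 , ⟨ ⌜ t ⌝ᵗ , ⌜ u ⌝ᵗ ⟩ ⟩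

⌜_⌝ : Form → ℕ
⌜ t ≐ u ⌝ = ⟨ 0 , ⟨ ⌜ t ⌝ᵗ , ⌜ u ⌝ᵗ ⟩ ⟩
⌜ ⊥ᶠ ⌝ = ⟨ 1 , 0 ⟩
⌜ ¬ᶠ φ ⌝ = ⟨ 2 , ⌜ φ ⌝ ⟩
⌜ φ ∧ᶠ ψ ⌝ = ⟨ 3 , ⟨ ⌜ φ ⌝ , ⌜ ψ ⌝ ⟩ ⟩
⌜ φ ∨ᶠ ψ ⌝ = ⟨ 4 , ⟨ ⌜ φ ⌝ , ⌜ ψ ⌝ ⟩ ⟩
⌜ ∃ᶠ x φ ⌝ = ⟨ 5 , ⟨ x , ⌜ φ ⌝ ⟩ ⟩
⌜ ∀ᶠ x φ ⌝ = ⟨ 6 , ⟨ x , ⌜ φ ⌝ ⟩ ⟩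

T : ℕ → Set
T n = Σ Form λ φ → Prenex φ × Sentence φ × (⌜ φ ⌝ ≡ n) × ⟦ φ ⟧ᶠ (λ _ → 0)

-- Computability relative to an oracle O ⊆ ℕ: Kleene's partial
-- recursive functions with an extra basic function returning the
-- characteristic function of O.

data PR : ℕ → Set where
  zeroᶠ   : ∀ {n} → PR n
  succᶠ   : PR 1
  projᶠ   : ∀ {n} → Fin n → PR n
  oracleᶠ : PR 1
  compᶠ   : ∀ {n m} → PR n → Vec (PR m) n → PR m
  recᶠ    : ∀ {n} → PR n → PR (suc (suc n)) → PR (suc n)
  μᶠ      : ∀ {n} → PR (suc n) → PR n

module _ (O : ℕ → Set) where
  mutual
    data Eval : ∀ {n} → PR n → Vec ℕ n → ℕ → Set where
      ev-zero : ∀ {n} {xs : Vec ℕ n} → Eval zeroᶠ xs 0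
      ev-succ : ∀ {x} → Eval succᶠ (x ∷ []) (suc x)
      ev-proj : ∀ {n} {i : Fin n} {xs} → Eval (projᶠ i) xs (lookup xs i)
      ev-yes  : ∀ {q} → O q → Eval oracleᶠ (q ∷ []) 1
      ev-no   : ∀ {q} → ¬ O q → Eval oracleᶠ (q ∷ []) 0
      ev-comp : ∀ {n m} {f : PR n} {gs : Vec (PR m) n} {xs ys y} →
                EvalV gs xs ys → Eval f ys y → Eval (compᶠ f gs) xs y
      ev-rec0 : ∀ {n} {f : PR n} {g xs y} → Eval f xs y → Eval (recᶠ f g) (0 ∷ xs) y
      ev-recS : ∀ {n} {f : PR n} {g xs k y z} →
                Eval (recᶠ f g) (k ∷ xs) y → Eval g (k ∷ y ∷ xs) z →
                Eval (recᶠ f g) (suc k ∷ xs) z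
      ev-μ    : ∀ {n} {f : PR (suc n)} {xs y} →
                Eval f (y ∷ xs) 0 →
                ((z : ℕ) → z < y → Σ ℕ λ w → Eval f (z ∷ xs) (suc w)) →
                Eval (μᶠ f) xs y

    data EvalV : ∀ {n m} → Vec (PR m) n → Vec ℕ m → Vec ℕ n → Set where
      evV-[] : ∀ {m} {xs : Vec ℕ m} → EvalV [] xs []
      evV-∷  : ∀ {n m} {g : PR m} {gs : Vec (PR m) n} {xs y ys} →
               Eval g xs y → EvalV gs xs ys → EvalV (g ∷ gs) xs (y ∷ ys)

ComputableIn : (O : ℕ → Set) → ∀ {n} → (Vec ℕ n → Set) → Set
ComputableIn O {n} R =
  Σ (PR n) λ f → (v : Vec ℕ n) → (R v → Eval O f v 1) × (¬ R v → Eval O f v 0)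

Σ⁰ω+1 : (k : ℕ) → (Vec ℕ k → Set) → Set₁
Σ⁰ω+1 k X =
  Σ ℕ λ ℓ → Σ (Vec ℕ (k + ℓ) → Set) λ R →
    ComputableIn T R × ((x : Vec ℕ k) → X x ⇔ Σ (Vec ℕ ℓ) λ y → R (x ++ y))

data BFm : Set where
  _≐ᵇ_  : Tm → Tm → BFm
  ⊥ᵇ    : BFm
  ¬ᵇ_   : BFm → BFm
  _∧ᵇ_  : BFm → BFm → BFm
  _∨ᵇ_  : BFm → BFm → BFm
  ∃ᵇ    : ℕ → BFm → BFm
  ∀ᵇ    : ℕ → BFm → BFm
  claim : ℕ → BFm
  label : ℕ → BFm → BFm

FreeB : ℕ → BFm → Set
FreeB x (t ≐ᵇ u) = FreeTm x t ⊎ FreeTm x u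
FreeB x ⊥ᵇ = ⊥
FreeB x (¬ᵇ φ) = FreeB x φ
FreeB x (φ ∧ᵇ ψ) = FreeB x φ ⊎ FreeB x ψ
FreeB x (φ ∨ᵇ ψ) = FreeB x φ ⊎ FreeB x ψ
FreeB x (∃ᵇ y φ) = x ≢ y × FreeB x φ
FreeB x (∀ᵇ y φ) = x ≢ y × FreeB x φ
FreeB x (claim L) = ⊥
FreeB x (label L φ) = FreeB x φ

-- The position of a subformula occurrence in the syntax tree is
-- represented by the stack of enclosing labelled subformulas
-- (innermost first): an entry (L , ψ) stands for the occurrence L ψ.
Env : Set
Env = List (ℕ × BFm)

refOf : ℕ → Env → Maybe (BFm × Env)
refOf L [] = nothing
refOf L ((L' , ψ) ∷ E) with L ≟ L'
... | yes _ = just (ψ , E)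
... | no  _ = refOf L E

data Sign : Set where
  ⊕ ⊖ : Sign

-- Win m # φ E r : the type of winning strategies of Eloise in the game
-- G_n from position (φ , r , # , m) (the occurrence φ having enclosing
-- labels E).  The game is well-founded, so strategies are exactly the
-- inhabitants of this recursively defined type.
Win : ℕ → Sign → BFm → Env → Assign → Set
Win m ⊕ (t ≐ᵇ u) E r = ⟦ t ⟧ᵗ r ≡ ⟦ u ⟧ᵗ r
Win m ⊖ (t ≐ᵇ u) E r = ¬ (⟦ t ⟧ᵗ r ≡ ⟦ u ⟧ᵗ r)
Win m ⊕ ⊥ᵇ E r = ⊥
Win m ⊖ ⊥ᵇ E r = ⊤
Win m ⊕ (¬ᵇ φ) E r = Win m ⊖ φ E r
Win m ⊖ (¬ᵇ φ) E r = Win m ⊕ φ E r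
Win m ⊕ (φ ∧ᵇ ψ) E r = Win m ⊕ φ E r × Win m ⊕ ψ E r
Win m ⊖ (φ ∧ᵇ ψ) E r = Win m ⊖ φ E r ⊎ Win m ⊖ ψ E r
Win m ⊕ (φ ∨ᵇ ψ) E r = Win m ⊕ φ E r ⊎ Win m ⊕ ψ E r
Win m ⊖ (φ ∨ᵇ ψ) E r = Win m ⊖ φ E r × Win m ⊖ ψ E r
Win m ⊕ (∀ᵇ x φ) E r = (a : ℕ) → Win m ⊕ φ E (r [ x ≔ a ])
Win m ⊖ (∀ᵇ x φ) E r = Σ ℕ λ a → Win m ⊖ φ E (r [ x ≔ a ])
Win m ⊕ (∃ᵇ x φ) E r = Σ ℕ λ a → Win m ⊕ φ E (r [ x ≔ a ])
Win m ⊖ (∃ᵇ x φ) E r = (a : ℕ) → Win m ⊖ φ E (r [ x ≔ a ])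
Win m s (label L φ) E r = Win m s φ ((L , φ) ∷ E) r
Win zero s (claim L) E r = ⊥
Win (suc m) s (claim L) E r with refOf L E
... | nothing = ⊥
... | just (ψ , E') = Win m s (label L ψ) E' r

-- 𝔄 , s ⊨_ω φ  (Abelard picks n', Eloise picks n ≥ n', then G_n).
_⊨ω_ : Assign → BFm → Set
s ⊨ω φ = (n' : ℕ) → Σ ℕ λ n → n' ≤ n × Win n ⊕ φ [] s

-- The assignment [m_i / x_i] (variables x_1..x_k are 0..k-1; all other
-- variables are sent to 0, irrelevant since they are not free).
vecAssign : ∀ {k} → Vec ℕ k → Assign
vecAssign {k} v i with i <? k
... | yes p = lookup v (fromℕ< p)
... | no  _ = 0

BndSCL-definable : (k : ℕ) → (Vec ℕ k → Set) → Set
BndSCL-definable k X =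
  Σ BFm λ φ → ((x : ℕ) → FreeB x φ → x < k) ×
    ((v : Vec ℕ k) → X v ⇔ (vecAssign v ⊨ω φ))

{-# OPTIONS --safe #-}
-- Since a larger clock never hurts Eloise, ⊨ω means that she wins for some clock.
--
-- From formulas to relations: a play of n single steps is described by a prenex
-- sentence with one block ∃ (Eloise's choice) ∀ (Abelard's choice) ∃ (next state)
-- per step and a quantifier-free matrix saying that consecutive states are related
-- by a step of the game.  Each block has its own variables, so the sentence is
-- prenex from the start, its code is a primitive recursive function of n and the
-- parameters, and the oracle T tells whether Eloise wins.
--
-- From relations to formulas: claims are recursive calls, so a program is
-- translated clause by clause into a formula that Eloise wins, for some clock, iff
-- the program has the given value.  For the oracle it suffices to decide
-- T q by a formula in which, for each q, a single clock value is enough for one of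
-- the two players to win: the quantifiers of the sentence coded by q are played by
-- the players themselves, and the depth of the recursion depends on q only.
module Submission where

open import Defs
open import Axiom.ExcludedMiddle using (ExcludedMiddle)
open import Data.Empty using (⊥; ⊥-elim)
open import Data.Fin using (Fin; zero; suc; toℕ; fromℕ<; _↑ˡ_; _↑ʳ_)
open import Data.Fin.Properties using (toℕ<n; fromℕ<-toℕ)
open import Data.List using (List; []; _∷_) renaming (_++_ to _++ᴸ_)
open import Data.List.Membership.Propositional using (_∈_)
open import Data.List.Relation.Unary.All using ([]; _∷_) renaming (All to Allᴸ; lookup to lookupᴸ; tabulate to tabulateᴸ)
open import Data.List.Relation.Unary.All.Properties using (++⁺; ++⁻ˡ; ++⁻ʳ)
open import Data.List.Relation.Unary.Any using (here; there)
open import Data.Maybe using (just; nothing)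
open import Data.Nat using (ℕ; zero; suc; _+_; _*_; _∸_; _^_; _≤_; _<_; _⊔_; z≤n; s≤s; s≤s⁻¹)
open import Data.Nat.Properties using (*-assoc; *-mono-≤; +-cancelʳ-≡; +-cancelˡ-≡; +-comm; +-identityʳ; +-mono-≤; +-suc; 1+n≢n; <-cmp; <-irrefl; <-≤-trans; <⇒≢; <⇒≤; <⇒≱; >⇒≢; _<?_; _≟_; m+[n∸m]≡n; m<n⇒m<1+n; m≤m+n; m≤m⊔n; m≤n+m; m≤n⇒m<n∨m≡n; m≤n⊔m; n<1+n; suc-injective; ≤-<-trans; ≤-refl; ≤-reflexive; ≤-trans; ≮⇒≥)
open import Data.Nat.Solver using (module +-*-Solver)
open import Data.Product using (Σ; _×_; _,_; proj₁; proj₂)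
open import Data.Sum using (_⊎_; inj₁; inj₂)
open import Data.Unit using (⊤; tt)
open import Data.Vec using (Vec; []; _∷_; head; tail; lookup; map; _++_; replicate)
open import Data.Vec.Properties using (lookup-map; map-++; lookup-++ˡ; lookup-++ʳ)
open import Data.Vec.Relation.Unary.All as All using (All; []; _∷_)
open import Function.Base using (_∘_; id)
open import Function.Bundles using (_⇔_; mk⇔; Equivalence)
open import Level using (0ℓ)
open import Relation.Binary.Definitions using (tri<; tri≈; tri>)
open import Relation.Binary.PropositionalEquality using (_≡_; _≢_; refl; sym; trans; cong; cong₂; subst; subst₂)
open import Relation.Nullary using (¬_; yes; no; contradiction)

-- A play whose clock runs out has no winner, so a formula may be won by neither player, and a
-- negation or a universal quantifier can be trusted only where one clock settles all instances. In
-- the truth formula the players choose arbitrary numbers as values of variables, so no recursion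
-- there may be measured by these: each is measured by a code or by the length of the environment.
-- The environment contains the chosen values, hence a second, polynomial pairing that an atomic
-- formula can undo; the pairing of the Gödel numbering is exponential and is checked by a recursion
-- on the code itself.
--
-- The sentence for a play is possible because a position is a signed subformula occurrence with its
-- stack of labels, and claims only lead back to occurrences already present: a state is one of
-- finitely many indices together with the values of finitely many variables. The number of steps is
-- left as the one existential witness.

double-injective : ∀ m n → m + m ≡ n + n → m ≡ n
double-injective zero zero p = refl
double-injective (suc m) (suc n) p =
  cong suc (double-injective m n (suc-injective
    (trans (sym (+-suc m m)) (trans (suc-injective p) (+-suc n n)))))

even≢odd : ∀ m n → m + m ≢ suc (n + n)
even≢odd (suc m) zero p with trans (sym (+-suc m m)) (suc-injective p)
... | ()
even≢odd (suc m) (suc n) p =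
  even≢odd m n (suc-injective (trans (sym (+-suc m m)) (trans (suc-injective p) (cong suc (+-suc n n)))))

-- The pairing function: doubling laws, injectivity and size.

pair-zero : ∀ b → ⟨ 0 , b ⟩ ≡ b + b
pair-zero b = cong (_∸ 1) (solve 1 (λ b → con 1 :* (con 2 :* b :+ con 1) := con 1 :+ (b :+ b)) refl b)
  where open +-*-Solver

double-power : ∀ a b → suc ⟨ a , b ⟩ ≡ 2 ^ a * (2 * b + 1) →
  2 ^ suc a * (2 * b + 1) ≡ suc (suc (⟨ a , b ⟩ + ⟨ a , b ⟩))
double-power a b p = trans (*-assoc 2 (2 ^ a) (2 * b + 1)) (trans (cong (2 *_) (sym p))
  (solve 1 (λ p → con 2 :* (con 1 :+ p) := con 2 :+ (p :+ p)) refl ⟨ a , b ⟩))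
  where open +-*-Solver

suc-pair : ∀ a b → suc ⟨ a , b ⟩ ≡ 2 ^ a * (2 * b + 1)
suc-pair zero b = trans (cong suc (pair-zero b)) (solve 1 (λ b → con 1 :+ (b :+ b) := con 1 :* (con 2 :* b :+ con 1)) refl b)
  where open +-*-Solver
suc-pair (suc a) b = trans (cong (λ n → suc (n ∸ 1)) e) (sym e)
  where e = double-power a b (suc-pair a b)

pair-suc : ∀ a b → ⟨ suc a , b ⟩ ≡ suc (⟨ a , b ⟩ + ⟨ a , b ⟩)
pair-suc a b = cong (_∸ 1) (double-power a b (suc-pair a b))

pair-injective : ∀ a b c d → ⟨ a , b ⟩ ≡ ⟨ c , d ⟩ → a ≡ c × b ≡ d
pair-injective zero b zero d p =
  refl , double-injective b d (trans (sym (pair-zero b)) (trans p (pair-zero d)))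
pair-injective zero b (suc c) d p =
  ⊥-elim (even≢odd b ⟨ c , d ⟩ (trans (sym (pair-zero b)) (trans p (pair-suc c d))))
pair-injective (suc a) b zero d p =
  ⊥-elim (even≢odd d ⟨ a , b ⟩ (trans (sym (pair-zero d)) (trans (sym p) (pair-suc a b))))
pair-injective (suc a) b (suc c) d p
  with pair-injective a b c d (double-injective ⟨ a , b ⟩ ⟨ c , d ⟩ (suc-injective
         (trans (sym (pair-suc a b)) (trans p (pair-suc c d)))))
... | refl , b≡d = refl , b≡d

n≤pair : ∀ a b → b ≤ ⟨ a , b ⟩
n≤pair zero b = ≤-trans (m≤m+n b b) (≤-reflexive (sym (pair-zero b)))
n≤pair (suc a) b = ≤-trans (≤-trans (n≤pair a b) (≤-trans (m≤m+n ⟨ a , b ⟩ ⟨ a , b ⟩) (m≤n+m _ 1)))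
  (≤-reflexive (sym (pair-suc a b)))

m≤pair : ∀ a b → a ≤ ⟨ a , b ⟩
m≤pair zero b = z≤n
m≤pair (suc a) b = ≤-trans (s≤s (≤-trans (m≤pair a b) (m≤m+n ⟨ a , b ⟩ ⟨ a , b ⟩)))
  (≤-reflexive (sym (pair-suc a b)))

n<pair : ∀ a b → b < ⟨ suc a , b ⟩
n<pair a b = ≤-trans (s≤s (≤-trans (n≤pair a b) (m≤m+n ⟨ a , b ⟩ ⟨ a , b ⟩)))
  (≤-reflexive (sym (pair-suc a b)))

-- For a fixed tag the pairing is iterated doubling, hence a term: reading a constructor tag costs
-- no recursive call.
tagᵗ : ℕ → Tm → Tm
tagᵗ zero t = t +ᵗ t
tagᵗ (suc n) t = sucᵗ (tagᵗ n t +ᵗ tagᵗ n t)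

⟦tagᵗ⟧ : ∀ n t r → ⟦ tagᵗ n t ⟧ᵗ r ≡ ⟨ n , ⟦ t ⟧ᵗ r ⟩
⟦tagᵗ⟧ zero t r = sym (pair-zero (⟦ t ⟧ᵗ r))
⟦tagᵗ⟧ (suc n) t r = trans (cong₂ (λ x y → suc (x + y)) (⟦tagᵗ⟧ n t r) (⟦tagᵗ⟧ n t r)) (sym (pair-suc n (⟦ t ⟧ᵗ r)))

-- A polynomial injection, so that lists of values can be taken apart
-- without consuming clock.
pr : ℕ → ℕ → ℕ
pr a b = (a + b) * (a + b) + a

-- With s = a + b, the code s * s + a stays below (s + 1) * (s + 1), so pairs with different sums
-- have codes in disjoint intervals.
pr-<-mono : ∀ a b c d → a + b < c + d → pr a b < pr c d
pr-<-mono a b c d p = ≤-trans (s≤s le) (≤-trans (≤-trans (≤-reflexive (square (a + b))) (*-mono-≤ p p)) (m≤m+n _ c))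
  where
  le : pr a b ≤ (a + b) * (a + b) + ((a + b) + (a + b))
  le = +-mono-≤ ≤-refl (≤-trans (m≤m+n a b) (m≤m+n (a + b) (a + b)))
  square : ∀ n → suc (n * n + (n + n)) ≡ suc n * suc n
  square = solve 1 (λ n → con 1 :+ (n :* n :+ (n :+ n)) := (con 1 :+ n) :* (con 1 :+ n)) refl
    where open +-*-Solver

pr-injective : ∀ a b c d → pr a b ≡ pr c d → a ≡ c × b ≡ d
pr-injective a b c d p with <-cmp (a + b) (c + d)
... | tri< lt _ _ = ⊥-elim (<-irrefl p (pr-<-mono a b c d lt))
... | tri> _ _ gt = ⊥-elim (<-irrefl (sym p) (pr-<-mono c d a b gt))
... | tri≈ _ eq _ with +-cancelˡ-≡ ((a + b) * (a + b)) a c (trans p (cong (λ s → s * s + c) (sym eq)))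
... | refl = refl , +-cancelˡ-≡ a b d eq

-- The successor keeps the code 0 free for the empty list.
ext : ℕ → ℕ → ℕ → ℕ
ext x a e = suc (pr x (pr a e))

ext-injective : ∀ {x a e x' a' e'} → ext x a e ≡ ext x' a' e' → x ≡ x' × a ≡ a' × e ≡ e'
ext-injective {x} {a} {e} {x'} {a'} {e'} p with pr-injective x (pr a e) x' (pr a' e') (suc-injective p)
... | refl , q = refl , pr-injective a e a' e' q

-- Assignments, and the effect of the clock on a play.

update-same : ∀ r x a → (r [ x ≔ a ]) x ≡ a
update-same r x a with x ≟ x
... | yes _ = refl
... | no x≢x = contradiction refl x≢x

update-other : ∀ r {x y} a → y ≢ x → (r [ x ≔ a ]) y ≡ r y
update-other r {x} {y} a y≢x with y ≟ x
... | yes y≡x = contradiction y≡x y≢x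
... | no _ = refl

Win-mono : ∀ m s F E r {m'} → m ≤ m' → Win m s F E r → Win m' s F E r
Win-mono m ⊕ (t ≐ᵇ u) E r le w = w
Win-mono m ⊖ (t ≐ᵇ u) E r le w = w
Win-mono m ⊖ ⊥ᵇ E r le w = w
Win-mono m ⊕ (¬ᵇ F) E r le w = Win-mono m ⊖ F E r le w
Win-mono m ⊖ (¬ᵇ F) E r le w = Win-mono m ⊕ F E r le w
Win-mono m ⊕ (F ∧ᵇ G) E r le (w , w') = Win-mono m ⊕ F E r le w , Win-mono m ⊕ G E r le w'
Win-mono m ⊖ (F ∧ᵇ G) E r le (inj₁ w) = inj₁ (Win-mono m ⊖ F E r le w)
Win-mono m ⊖ (F ∧ᵇ G) E r le (inj₂ w) = inj₂ (Win-mono m ⊖ G E r le w)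
Win-mono m ⊕ (F ∨ᵇ G) E r le (inj₁ w) = inj₁ (Win-mono m ⊕ F E r le w)
Win-mono m ⊕ (F ∨ᵇ G) E r le (inj₂ w) = inj₂ (Win-mono m ⊕ G E r le w)
Win-mono m ⊖ (F ∨ᵇ G) E r le (w , w') = Win-mono m ⊖ F E r le w , Win-mono m ⊖ G E r le w'
Win-mono m ⊕ (∃ᵇ x F) E r le (a , w) = a , Win-mono m ⊕ F E _ le w
Win-mono m ⊖ (∃ᵇ x F) E r le w = λ a → Win-mono m ⊖ F E _ le (w a)
Win-mono m ⊕ (∀ᵇ x F) E r le w = λ a → Win-mono m ⊕ F E _ le (w a)
Win-mono m ⊖ (∀ᵇ x F) E r le (a , w) = a , Win-mono m ⊖ F E _ le w
Win-mono m ⊕ (label L F) E r le w = Win-mono m ⊕ F _ r le w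
Win-mono m ⊖ (label L F) E r le w = Win-mono m ⊖ F _ r le w
Win-mono zero ⊕ (claim L) E r le ()
Win-mono zero ⊖ (claim L) E r le ()
Win-mono (suc m) ⊕ (claim L) E r {suc m'} (s≤s le) w with refOf L E
... | just (ψ , E') = Win-mono m ⊕ (label L ψ) E' r le w
Win-mono (suc m) ⊖ (claim L) E r {suc m'} (s≤s le) w with refOf L E
... | just (ψ , E') = Win-mono m ⊖ (label L ψ) E' r le w

-- This cannot be strengthened to determinacy: at a claim with clock 0 neither player wins.
Win-consistent : ∀ m F E r → Win m ⊕ F E r → Win m ⊖ F E r → ⊥
Win-consistent m (t ≐ᵇ u) E r w v = v w
Win-consistent m (¬ᵇ F) E r w v = Win-consistent m F E r v w
Win-consistent m (F ∧ᵇ G) E r (w , _) (inj₁ v) = Win-consistent m F E r w v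
Win-consistent m (F ∧ᵇ G) E r (_ , w) (inj₂ v) = Win-consistent m G E r w v
Win-consistent m (F ∨ᵇ G) E r (inj₁ w) (v , _) = Win-consistent m F E r w v
Win-consistent m (F ∨ᵇ G) E r (inj₂ w) (_ , v) = Win-consistent m G E r w v
Win-consistent m (∃ᵇ x F) E r (a , w) v = Win-consistent m F E _ w (v a)
Win-consistent m (∀ᵇ x F) E r w (a , v) = Win-consistent m F E _ (w a) v
Win-consistent m (label L F) E r w v = Win-consistent m F _ r w v
Win-consistent (suc m) (claim L) E r w v with refOf L E
... | just (ψ , E') = Win-consistent m (label L ψ) E' r w v

-- Recursive procedures, and deciding them with one clock.

letᵇ : ℕ → ℕ → BFm → BFm
letᵇ x y F = ∃ᵇ x ((var x ≐ᵇ var y) ∧ᵇ F)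

-- Calling convention: arguments in 0, 1, 2, which a procedure first saves
-- in 3, 4, 5; its locals start at 6 and recursive calls are claims of label 0.
call : BFm → ℕ → ℕ → ℕ → BFm
call F x y z = letᵇ 0 (3 + x) (letᵇ 1 (3 + y) (letᵇ 2 (3 + z) F))

save : BFm → BFm
save F = letᵇ 3 0 (letᵇ 4 1 (letᵇ 5 2 F))

-- Label 0 serves all procedures: a claim refers to the nearest enclosing label, and a procedure
-- called inside another carries its own. Overwriting variables is harmless, since a call never
-- returns and the conjuncts of a formula are separate branches with separate assignments.
proc : BFm → BFm
proc F = label 0 (save F)

Rel : Set₁
Rel = ℕ → ℕ → ℕ → Set

args params : Rel → Assign → Set
args A r = A (r 0) (r 1) (r 2)
params A r = A (r 3) (r 4) (r 5)

module Classical (em : ExcludedMiddle 0ℓ) where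

  -- One clock value must serve all assignments in B: this is what survives
  -- an unbounded quantifier.
  record Decides (E : Env) (B : Assign → Set) (F : BFm) (R : Assign → Set) : Set where
    constructor decides
    field
      clock : ℕ
      win   : ∀ r → B r → R r → Win clock ⊕ F E r
      lose  : ∀ r → B r → ¬ R r → Win clock ⊖ F E r

  open Decides public

  -- If `R r` failed, the given win and the strategy of the other sign could be raised to a common
  -- clock, where they contradict each other.
  Decides-sound : ∀ {E B F R} → Decides E B F R → ∀ m r → B r → Win m ⊕ F E r → R r
  Decides-sound {E} {F = F} {R} d m r b w with em {R r}
  ... | yes p = p
  ... | no ¬p = ⊥-elim (Win-consistent (m ⊔ clock d) F E r
          (Win-mono m ⊕ F E r (m≤m⊔n m _) w)
          (Win-mono (clock d) ⊖ F E r (m≤n⊔m m _) (lose d r b ¬p)))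

  private variable
    E : Env
    B B' P Q : Assign → Set
    F G : BFm

  decides-atom : ∀ t u → Decides E B (t ≐ᵇ u) (λ r → ⟦ t ⟧ᵗ r ≡ ⟦ u ⟧ᵗ r)
  decides-atom t u = decides 0 (λ r _ p → p) (λ r _ p → p)

  decides-tag : ∀ x n t → Decides E B (var x ≐ᵇ tagᵗ n t) (λ r → r x ≡ ⟨ n , ⟦ t ⟧ᵗ r ⟩)
  decides-tag x n t = decides 0 (λ r _ p → trans p (sym (⟦tagᵗ⟧ n t r))) (λ r _ p q → p (trans q (⟦tagᵗ⟧ n t r)))

  decides-¬ : Decides E B F P → Decides E B (¬ᵇ F) (λ r → ¬ P r)
  decides-¬ {P = P} d = decides (clock d) (lose d) λ r b ¬¬p → win d r b (dne ¬¬p)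
    where
    dne : ∀ {r} → ¬ ¬ P r → P r
    dne {r} ¬¬p with em {P r}
    ... | yes p = p
    ... | no ¬p = ⊥-elim (¬¬p ¬p)

  -- The right conjunct has to be decided only where the left one holds, since otherwise the left
  -- one is refuted. Guards on the left thus supply the bounds that recursive calls on the right
  -- need.
  decides-∧ : Decides E B F P → Decides E (λ r → B r × P r) G Q →
              Decides E B (F ∧ᵇ G) (λ r → P r × Q r)
  decides-∧ {E} {B} {F} {P} {G} {Q} d d' = decides (clock d ⊔ clock d')
    (λ r b (p , q) → Win-mono _ ⊕ F E r (m≤m⊔n _ _) (win d r b p)
                   , Win-mono _ ⊕ G E r (m≤n⊔m _ _) (win d' r (b , p) q))
    loses
    where
    loses : ∀ r → B r → ¬ (P r × Q r) → Win (clock d ⊔ clock d') ⊖ (F ∧ᵇ G) E r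
    loses r b ¬pq with em {P r}
    ... | yes p = inj₂ (Win-mono _ ⊖ G E r (m≤n⊔m (clock d) _) (lose d' r (b , p) (λ q → ¬pq (p , q))))
    ... | no ¬p = inj₁ (Win-mono _ ⊖ F E r (m≤m⊔n _ (clock d')) (lose d r b ¬p))

  decides-∨ : Decides E B F P → Decides E B G Q → Decides E B (F ∨ᵇ G) (λ r → P r ⊎ Q r)
  decides-∨ {E} {B} {F} {P} {G} {Q} d d' = decides (clock d ⊔ clock d') wins
    (λ r b ¬pq → Win-mono _ ⊖ F E r (m≤m⊔n _ _) (lose d r b (¬pq ∘ inj₁))
               , Win-mono _ ⊖ G E r (m≤n⊔m _ _) (lose d' r b (¬pq ∘ inj₂)))
    where
    wins : ∀ r → B r → P r ⊎ Q r → Win (clock d ⊔ clock d') ⊕ (F ∨ᵇ G) E r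
    wins r b (inj₁ p) = inj₁ (Win-mono _ ⊕ F E r (m≤m⊔n _ (clock d')) (win d r b p))
    wins r b (inj₂ q) = inj₂ (Win-mono _ ⊕ G E r (m≤n⊔m (clock d) _) (win d' r b q))

  -- The new value is arbitrary: below a quantifier only what `B` says about the old assignment
  -- remains known.
  Updated : ℕ → (Assign → Set) → Assign → Set
  Updated x B r' = Σ Assign λ r → Σ ℕ λ a → B r × r' ≡ r [ x ≔ a ]

  decides-∃ : ∀ x → Decides E (Updated x B) F P → Decides E B (∃ᵇ x F) (λ r → Σ ℕ λ a → P (r [ x ≔ a ]))
  decides-∃ x d = decides (clock d)
    (λ r b (a , p) → a , win d _ (r , a , b , refl) p)
    (λ r b ¬p a → lose d _ (r , a , b , refl) (λ p → ¬p (a , p)))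

  decides-∀ : ∀ x → Decides E (Updated x B) F P → Decides E B (∀ᵇ x F) (λ r → (a : ℕ) → P (r [ x ≔ a ]))
  decides-∀ {E} {B} {F} {P} x d = decides (clock d)
    (λ r b p a → win d _ (r , a , b , refl) (p a))
    loses
    where
    loses : ∀ r → B r → ¬ ((a : ℕ) → P (r [ x ≔ a ])) → Win (clock d) ⊖ (∀ᵇ x F) E r
    loses r b ¬p with em {Σ ℕ λ a → ¬ P (r [ x ≔ a ])}
    ... | yes (a , ¬pa) = a , lose d _ (r , a , b , refl) ¬pa
    ... | no none = ⊥-elim (¬p all)
      where
      all : ∀ a → P (r [ x ≔ a ])
      all a with em {P (r [ x ≔ a ])}
      ... | yes p = p
      ... | no ¬pa = ⊥-elim (none (a , ¬pa))

  decides-⇔ : (∀ r → B r → P r → Q r) → (∀ r → B r → Q r → P r) → Decides E B F P → Decides E B F Q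
  decides-⇔ f g d = decides (clock d) (λ r b q → win d r b (g r b q)) (λ r b ¬q → lose d r b (¬q ∘ f r b))

  -- A value other than that of y is refuted by the equation, so only one value of x has to be
  -- decided.
  decides-let : ∀ x y → y ≢ x → (∀ r → B r → B' (r [ x ≔ r y ])) → Decides E B' F P →
                Decides E B (letᵇ x y F) (λ r → P (r [ x ≔ r y ]))
  decides-let {B} {B'} {E} {F} {P} x y y≢x f d = decides (clock d)
    (λ r b p → r y , trans (update-same r x _) (sym (update-other r _ y≢x)) , win d _ (f r b) p)
    loses
    where
    loses : ∀ r → B r → ¬ P (r [ x ≔ r y ]) → Win (clock d) ⊖ (letᵇ x y F) E r
    loses r b ¬p a with a ≟ r y
    ... | yes refl = inj₂ (lose d _ (f r b) ¬p)
    ... | no a≢ = inj₁ (λ e → a≢ (trans (sym (update-same r x a)) (trans e (update-other r a y≢x))))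

  decides-call : ∀ (A C : Rel) x y z → (∀ r → B r → C (r (3 + x)) (r (3 + y)) (r (3 + z))) →
    Decides E (args C) F (args A) →
    Decides E B (call F x y z) (λ r → A (r (3 + x)) (r (3 + y)) (r (3 + z)))
  decides-call {B} A C x y z f d =
    decides-let {B' = λ r → C (r 0) (r (3 + y)) (r (3 + z))} 0 (3 + x) (λ ()) f
      (decides-let {B' = λ r → C (r 0) (r 1) (r (3 + z))} 1 (3 + y) (λ ()) (λ _ b → b)
        (decides-let {B' = args C} 2 (3 + z) (λ ()) (λ _ b → b) d))

  decides-save : ∀ (A C : Rel) → Decides E (params C) F (params A) → Decides E (args C) (save F) (args A)
  decides-save A C d =
    decides-let {B' = λ r → C (r 3) (r 1) (r 2)} 3 0 (λ ()) (λ _ b → b)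
      (decides-let {B' = λ r → C (r 3) (r 4) (r 2)} 4 1 (λ ()) (λ _ b → b)
        (decides-let {B' = params C} 5 2 (λ ()) (λ _ b → b) d))

  decides-claim : ∀ {F} → Decides E B (label 0 F) P → Decides ((0 , F) ∷ E) B (claim 0) P
  decides-claim d = decides (suc (clock d)) (win d) (lose d)

  -- Induction on a rank, with `C n` the arguments of rank below n. The body sees the recursive
  -- claim as a relation already decided on `C n`, at the price of one clock unit; since `C 0` is
  -- empty, nothing has to be decided at the start.
  decides-proc : ∀ (A : Rel) (C : ℕ → Rel) → (∀ x y z → ¬ C 0 x y z) →
    (∀ n {E} → Decides E (args (C n)) (claim 0) (args A) → Decides E (params (C (suc n))) F (params A)) →
    ∀ n → Decides E (args (C n)) (proc F) (args A)
  decides-proc A C none step zero = decides 0 (λ r c → ⊥-elim (none _ _ _ c)) (λ r c → ⊥-elim (none _ _ _ c))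
  decides-proc A C none step (suc n) with decides-save A (C (suc n)) (step n (decides-claim (decides-proc A C none step n)))
  -- `Win` passes through a label unchanged, so clock and strategies are only retyped.
  ... | d = decides (clock d) (win d) (lose d)

-- Truth of coded prenex formulas

-- An environment e is an association list built by ext from the empty list 0.
-- Lk e x v: x has the value v in e; TV e c v and QV e c b: c codes a term with
-- value v, respectively a quantifier-free formula with truth value b, all of whose
-- variables occur in e; PV e c: c codes a true prenex formula.
data Lk : ℕ → ℕ → ℕ → Set where
  here  : ∀ x a e → Lk (ext x a e) x a
  there : ∀ x a {e y v} → x ≢ y → Lk e y v → Lk (ext x a e) y v

data TV (e : ℕ) : ℕ → ℕ → Set where
  tv-var  : ∀ {x v} → Lk e x v → TV e ⟨ 0 , x ⟩ v
  tv-zero : TV e ⟨ 1 , 0 ⟩ 0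
  tv-suc  : ∀ {c v} → TV e c v → TV e ⟨ 2 , c ⟩ (suc v)
  tv-+    : ∀ {c d v w} → TV e c v → TV e d w → TV e ⟨ 3 , ⟨ c , d ⟩ ⟩ (v + w)
  tv-*    : ∀ {c d v w} → TV e c v → TV e d w → TV e ⟨ 4 , ⟨ c , d ⟩ ⟩ (v * w)

data QV (e : ℕ) : ℕ → ℕ → Set where
  qv-≡ : ∀ {c d v} → TV e c v → TV e d v → QV e ⟨ 0 , ⟨ c , d ⟩ ⟩ 1
  qv-≢ : ∀ {c d v w} → TV e c v → TV e d w → v ≢ w → QV e ⟨ 0 , ⟨ c , d ⟩ ⟩ 0
  qv-⊥ : QV e ⟨ 1 , 0 ⟩ 0
  qv-¬ : ∀ {c a b} → QV e c a → b + a ≡ 1 → QV e ⟨ 2 , c ⟩ b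
  qv-∧ : ∀ {c d a a'} → QV e c a → QV e d a' → QV e ⟨ 3 , ⟨ c , d ⟩ ⟩ (a * a')
  qv-∨ : ∀ {c d a a' b} → QV e c a → QV e d a' → b + a * a' ≡ a + a' → QV e ⟨ 4 , ⟨ c , d ⟩ ⟩ b

data PV : ℕ → ℕ → Set where
  pv-qf : ∀ {e c} → QV e c 1 → PV e c
  pv-∃  : ∀ {e c} x a → PV (ext x a e) c → PV e ⟨ 5 , ⟨ x , c ⟩ ⟩
  pv-∀  : ∀ {e c} x → (∀ a → PV (ext x a e) c) → PV e ⟨ 6 , ⟨ x , c ⟩ ⟩

-- The size of an environment is unbounded because it contains values chosen by the players. Its
-- length is bounded, and a lookup descends at most that far.
data Len< : ℕ → ℕ → Set where
  len-0 : ∀ {m} → Len< (suc m) 0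
  len-s : ∀ {m} x a e → Len< m e → Len< (suc m) (ext x a e)

len-tail : ∀ {m e x a e'} → e ≡ ext x a e' → Len< (suc m) e → Len< m e'
len-tail {x = x} {a} {e'} p (len-s x' a' e'' l) =
  subst (Len< _) (proj₂ (proj₂ (ext-injective {x'} {a'} {e''} {x} {a} {e'} p))) l

len-mono : ∀ {m n e} → m ≤ n → Len< m e → Len< n e
len-mono (s≤s le) len-0 = len-0
len-mono (s≤s le) (len-s x a e l) = len-s x a e (len-mono le l)

-- Formulas that decide coded truth.

prᵗ : Tm → Tm → Tm
prᵗ t u = ((t +ᵗ u) *ᵗ (t +ᵗ u)) +ᵗ t

extᵗ : Tm → Tm → Tm → Tm
extᵗ t u w = sucᵗ (prᵗ t (prᵗ u w))

pairᵇ lkᵇ tvᵇ qvᵇ pvᵇ : BFm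

pairᵇ = proc
  (((var 3 ≐ᵇ zeroᵗ) ∧ᵇ (var 5 ≐ᵇ (var 4 +ᵗ var 4))) ∨ᵇ
   ∃ᵇ 6 (∃ᵇ 7 ((var 3 ≐ᵇ sucᵗ (var 6)) ∧ᵇ ((var 5 ≐ᵇ sucᵗ (var 7 +ᵗ var 7)) ∧ᵇ call (claim 0) 3 1 4))))

lkᵇ = proc
  (∃ᵇ 6 (∃ᵇ 7 (∃ᵇ 8 ((var 3 ≐ᵇ extᵗ (var 6) (var 7) (var 8)) ∧ᵇ
    (((var 6 ≐ᵇ var 4) ∧ᵇ (var 7 ≐ᵇ var 5)) ∨ᵇ
     ((¬ᵇ (var 6 ≐ᵇ var 4)) ∧ᵇ call (claim 0) 5 1 2))))))

-- Locals: 6 is the content under the tag, 7 and 8 are the component codes, 9 and 10 their values.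
-- `call` counts from 3, so `call F 0 4 6` passes 3, 7 and 9. Tag and pairing come before the calls
-- of `F` because they bound the components.
binaryᵇ : ℕ → BFm → BFm → BFm
binaryᵇ n F G = ∃ᵇ 6 (∃ᵇ 7 (∃ᵇ 8 (∃ᵇ 9 (∃ᵇ 10
  ((var 4 ≐ᵇ tagᵗ n (var 6)) ∧ᵇ (call pairᵇ 4 5 3 ∧ᵇ (call F 0 4 6 ∧ᵇ (call F 0 5 7 ∧ᵇ G))))))))

tvᵇ = proc
  (∃ᵇ 6 ((var 4 ≐ᵇ tagᵗ 0 (var 6)) ∧ᵇ call lkᵇ 0 3 2) ∨ᵇ
   (((var 4 ≐ᵇ tagᵗ 1 zeroᵗ) ∧ᵇ (var 5 ≐ᵇ zeroᵗ)) ∨ᵇ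
   (∃ᵇ 6 (∃ᵇ 7 ((var 4 ≐ᵇ tagᵗ 2 (var 6)) ∧ᵇ ((var 5 ≐ᵇ sucᵗ (var 7)) ∧ᵇ call (claim 0) 0 3 4))) ∨ᵇ
   (binaryᵇ 3 (claim 0) (var 5 ≐ᵇ (var 9 +ᵗ var 10)) ∨ᵇ
    binaryᵇ 4 (claim 0) (var 5 ≐ᵇ (var 9 *ᵗ var 10))))))

oneᵗ : Tm
oneᵗ = sucᵗ zeroᵗ

qvᵇ = proc
  (binaryᵇ 0 tvᵇ (((var 9 ≐ᵇ var 10) ∧ᵇ (var 5 ≐ᵇ oneᵗ)) ∨ᵇ ((¬ᵇ (var 9 ≐ᵇ var 10)) ∧ᵇ (var 5 ≐ᵇ zeroᵗ))) ∨ᵇ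
   (((var 4 ≐ᵇ tagᵗ 1 zeroᵗ) ∧ᵇ (var 5 ≐ᵇ zeroᵗ)) ∨ᵇ
   (∃ᵇ 6 (∃ᵇ 7 ((var 4 ≐ᵇ tagᵗ 2 (var 6)) ∧ᵇ (((var 5 +ᵗ var 7) ≐ᵇ oneᵗ) ∧ᵇ call (claim 0) 0 3 4))) ∨ᵇ
   (binaryᵇ 3 (claim 0) (var 5 ≐ᵇ (var 9 *ᵗ var 10)) ∨ᵇ
    binaryᵇ 4 (claim 0) ((var 5 +ᵗ (var 9 *ᵗ var 10)) ≐ᵇ (var 9 +ᵗ var 10))))))

-- Variable 9 is the value chosen for the coded variable by the owner of the quantifier `Q`, and 10
-- is the environment extended by it. The last argument of the claim is a filler: the calling
-- convention has three arguments, `PV` only two.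
quantᵇ : ℕ → (BFm → BFm) → BFm
quantᵇ n Q = ∃ᵇ 6 (∃ᵇ 7 (∃ᵇ 8 ((var 4 ≐ᵇ tagᵗ n (var 6)) ∧ᵇ (call pairᵇ 4 5 3 ∧ᵇ
  Q (∃ᵇ 10 ((var 10 ≐ᵇ extᵗ (var 7) (var 9) (var 3)) ∧ᵇ call (claim 0) 7 5 2))))))

pvᵇ = proc
  (∃ᵇ 6 ((var 6 ≐ᵇ oneᵗ) ∧ᵇ call qvᵇ 0 1 3) ∨ᵇ
   (quantᵇ 5 (∃ᵇ 9) ∨ᵇ quantᵇ 6 (∀ᵇ 9)))

module Truth (em : ExcludedMiddle 0ℓ) where
  open Classical em

  private variable
    E : Env
    F G : BFm
    B Q : Assign → Set

  -- The rank is the code c, not the exponent a: the components are guessed without bound, while c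
  -- is halved at each call.
  decides-pair : ∀ n → Decides E (args (λ a b c → c < n)) pairᵇ (args (λ a b c → c ≡ ⟨ a , b ⟩))
  decides-pair = decides-proc A (λ n a b c → c < n) (λ _ _ _ ()) λ n rec →
    decides-⇔ (λ r _ → to r) (λ r _ → from r)
      (decides-∨ (decides-∧ (decides-atom _ _) (decides-atom _ _))
        (decides-∃ 6 (decides-∃ 7 (decides-∧ (decides-atom _ _) (decides-∧ (decides-atom _ _)
          (decides-call A (λ a b c → c < n) 3 1 4
            (λ { _ (((_ , c , (r , a , b , refl) , refl) , _) , p) →
                 ≤-trans (s≤s (m≤m+n c c)) (s≤s⁻¹ (subst (_< suc n) p b)) })
            rec))))))
    where
    A : Rel
    A a b c = c ≡ ⟨ a , b ⟩
    Body : ℕ → ℕ → ℕ → Set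
    Body a b c = (a ≡ 0 × c ≡ b + b) ⊎ (Σ ℕ λ a' → Σ ℕ λ c' → a ≡ suc a' × c ≡ suc (c' + c') × c' ≡ ⟨ a' , b ⟩)
    to : ∀ r → Body (r 3) (r 4) (r 5) → r 5 ≡ ⟨ r 3 , r 4 ⟩
    to r (inj₁ (p , q)) = trans q (trans (sym (pair-zero (r 4))) (cong (λ a → ⟨ a , r 4 ⟩) (sym p)))
    to r (inj₂ (a' , c' , p , q , s)) =
      trans q (trans (cong (λ c → suc (c + c)) s) (trans (sym (pair-suc a' (r 4))) (cong (λ a → ⟨ a , r 4 ⟩) (sym p))))
    from' : ∀ a b c → c ≡ ⟨ a , b ⟩ → Body a b c
    from' zero b c p = inj₁ (refl , trans p (pair-zero b))
    from' (suc a) b c p = inj₂ (a , ⟨ a , b ⟩ , refl , trans p (pair-suc a b) , refl)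
    from : ∀ r → r 5 ≡ ⟨ r 3 , r 4 ⟩ → Body (r 3) (r 4) (r 5)
    from r = from' (r 3) (r 4) (r 5)

  decides-lk : ∀ n → Decides E (args (λ e y v → Len< n e)) lkᵇ (args Lk)
  decides-lk = decides-proc Lk (λ n e y v → Len< n e) (λ _ _ _ ()) λ n rec →
    decides-⇔ (λ r _ → to (r 3) (r 4) (r 5)) (λ r _ → from (r 3) (r 4) (r 5))
      (decides-∃ 6 (decides-∃ 7 (decides-∃ 8 (decides-∧ (decides-atom _ _)
        (decides-∨ (decides-∧ (decides-atom _ _) (decides-atom _ _))
          (decides-∧ (decides-¬ (decides-atom _ _))
            (decides-call Lk (λ e y v → Len< n e) 5 1 2
              (λ { _ (((_ , e' , (_ , a , (r , x , l , refl) , refl) , refl) , p) , _) → len-tail {x = x} {a} p l })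
              rec)))))))
    where
    Body : ℕ → ℕ → ℕ → Set
    Body e y v = Σ ℕ λ x → Σ ℕ λ a → Σ ℕ λ e' → e ≡ ext x a e' ×
      ((x ≡ y × a ≡ v) ⊎ (¬ x ≡ y × Lk e' y v))
    to : ∀ e y v → Body e y v → Lk e y v
    to e y v (x , a , e' , refl , inj₁ (refl , refl)) = here x a e'
    to e y v (x , a , e' , refl , inj₂ (x≢y , l)) = there x a x≢y l
    from : ∀ e y v → Lk e y v → Body e y v
    from _ _ _ (here x a e) = x , a , e , refl , inj₁ (refl , refl)
    from _ _ _ (there x a {e} x≢y l) = x , a , e , refl , inj₂ (x≢y , l)

  Binary : ℕ → Rel → (Assign → Set) → Assign → Set
  Binary n A Q r = Σ ℕ λ p → Σ ℕ λ c → Σ ℕ λ d → Σ ℕ λ v → Σ ℕ λ w →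
    r 4 ≡ ⟨ n , p ⟩ × p ≡ ⟨ c , d ⟩ × A (r 3) c v × A (r 3) d w ×
    Q (((((r [ 6 ≔ p ]) [ 7 ≔ c ]) [ 8 ≔ d ]) [ 9 ≔ v ]) [ 10 ≔ w ])

  -- `N` bounds the code, so that one clock suffices to check the pairing; `sub` reads off from the
  -- shape of the code that both components lie where `F` is decided.
  decides-binary : ∀ n A C N → (∀ r → B r → r 4 < N) →
    (∀ r c d → B r → r 4 ≡ ⟨ n , ⟨ c , d ⟩ ⟩ → ∀ v → C (r 3) c v × C (r 3) d v) →
    Decides E (args C) F (args A) → (∀ {B} → Decides E B G Q) →
    Decides E B (binaryᵇ n F G) (Binary n A Q)
  decides-binary n A C N bound sub dF dG =
    decides-∃ 6 (decides-∃ 7 (decides-∃ 8 (decides-∃ 9 (decides-∃ 10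
      (decides-∧ (decides-tag 4 n (var 6))
        (decides-∧
          (decides-call (λ a b c → c ≡ ⟨ a , b ⟩) (λ a b c → c < N) 4 5 3
            (λ { _ ((_ , w , (_ , v , (_ , d , (_ , c , (r , p , b , refl) , refl) , refl) , refl) , refl) , eq) →
                 ≤-<-trans (≤-trans (n≤pair n p) (≤-reflexive (sym eq))) (bound r b) })
            (decides-pair N))
          (decides-∧
            (decides-call A C 0 4 6
              (λ { _ (((_ , w , (_ , v , (_ , d , (_ , c , (r , p , b , refl) , refl) , refl) , refl) , refl) , eq) , eq') →
                   proj₁ (sub r c d b (trans eq (cong ⟨ n ,_⟩ eq')) v) })
              dF)
            (decides-∧
              (decides-call A C 0 5 7
                (λ { _ ((((_ , w , (_ , v , (_ , d , (_ , c , (r , p , b , refl) , refl) , refl) , refl) , refl) , eq) , eq') , _)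
                     →
                     proj₂ (sub r c d b (trans eq (cong ⟨ n ,_⟩ eq')) w) })
                dF)
              dG))))))))

  -- Only a positive tag makes the content strictly smaller, since ⟨ 0 , 0 ⟩ is 0. Tag 0 belongs to
  -- variables and equations, which hand over to another procedure and need no smaller rank.
  shrink : ∀ {c n} t p → c < suc n → c ≡ ⟨ suc t , p ⟩ → p < n
  shrink t p lt eq = <-≤-trans (n<pair t p) (≤-trans (≤-reflexive (sym eq)) (s≤s⁻¹ lt))

  shrink₂ : ∀ {c n} t p q → c < suc n → c ≡ ⟨ suc t , ⟨ p , q ⟩ ⟩ → p < n × q < n
  shrink₂ t p q lt eq = ≤-<-trans (m≤pair p q) s , ≤-<-trans (n≤pair p q) s
    where s = shrink t ⟨ p , q ⟩ lt eq

  -- In the recursions on terms and quantifier-free formulas only the bound n on the code decreases;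
  -- m stays fixed, since only quantifiers extend the environment.
  Bounded : ℕ → ℕ → Rel
  Bounded m n e c v = Len< m e × c < n

  bounded-components : ∀ {m n} t (r : Assign) c d → params (Bounded m (suc n)) r → r 4 ≡ ⟨ suc t , ⟨ c , d ⟩ ⟩ →
    ∀ v → Bounded m n (r 3) c v × Bounded m n (r 3) d v
  bounded-components t r c d (l , lt) eq _ =
    (l , proj₁ (shrink₂ t c d lt eq)) , (l , proj₂ (shrink₂ t c d lt eq))

  decides-tv : ∀ m n → Decides E (args (Bounded m n)) tvᵇ (args TV)
  decides-tv m = decides-proc TV (Bounded m) (λ { _ _ _ (_ , ()) }) λ n rec →
    decides-⇔ (λ r _ → to r) (λ r _ → from r)
      (decides-∨
        (decides-∃ 6 (decides-∧ (decides-tag 4 0 (var 6))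
          (decides-call Lk (λ e y v → Len< m e) 0 3 2 (λ { _ ((r , x , (l , _) , refl) , _) → l }) (decides-lk m))))
        (decides-∨ (decides-∧ (decides-tag 4 1 zeroᵗ) (decides-atom _ _))
        (decides-∨
          (decides-∃ 6 (decides-∃ 7 (decides-∧ (decides-tag 4 2 (var 6)) (decides-∧ (decides-atom _ _)
            (decides-call TV (Bounded m n) 0 3 4
              (λ { _ (((_ , v , (r , c , (l , lt) , refl) , refl) , eq) , _) → l , shrink 1 c lt eq })
              rec)))))
        (decides-∨
          (decides-binary 3 TV (Bounded m n) (suc n) (λ r → proj₂) (bounded-components 2) rec (decides-atom _ _))
          (decides-binary 4 TV (Bounded m n) (suc n) (λ r → proj₂) (bounded-components 3) rec (decides-atom _ _))))))
    where
    Body : Assign → Set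
    Body r = (Σ ℕ λ x → r 4 ≡ ⟨ 0 , x ⟩ × Lk (r 3) x (r 5)) ⊎ (r 4 ≡ ⟨ 1 , 0 ⟩ × r 5 ≡ 0) ⊎
      (Σ ℕ λ c → Σ ℕ λ v → r 4 ≡ ⟨ 2 , c ⟩ × r 5 ≡ suc v × TV (r 3) c v) ⊎
      Binary 3 TV (λ r → r 5 ≡ r 9 + r 10) r ⊎ Binary 4 TV (λ r → r 5 ≡ r 9 * r 10) r
    tv : ∀ r {c v} → r 4 ≡ c → r 5 ≡ v → TV (r 3) c v → TV (r 3) (r 4) (r 5)
    tv r refl refl t = t
    to : ∀ r → Body r → TV (r 3) (r 4) (r 5)
    to r (inj₁ (x , p , l)) = tv r p refl (tv-var l)
    to r (inj₂ (inj₁ (p , q))) = tv r p q tv-zero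
    to r (inj₂ (inj₂ (inj₁ (c , v , p , q , t)))) = tv r p q (tv-suc t)
    to r (inj₂ (inj₂ (inj₂ (inj₁ (_ , c , d , v , w , p , refl , t , u , q))))) = tv r p q (tv-+ t u)
    to r (inj₂ (inj₂ (inj₂ (inj₂ (_ , c , d , v , w , p , refl , t , u , q))))) = tv r p q (tv-* t u)
    from' : ∀ r {c v} → r 4 ≡ c → r 5 ≡ v → TV (r 3) c v → Body r
    from' r p q (tv-var {x} l) = inj₁ (x , p , subst (Lk (r 3) x) (sym q) l)
    from' r p q tv-zero = inj₂ (inj₁ (p , q))
    from' r p q (tv-suc {c} {v} t) = inj₂ (inj₂ (inj₁ (c , v , p , q , t)))
    from' r p q (tv-+ {c} {d} {v} {w} t u) = inj₂ (inj₂ (inj₂ (inj₁ (_ , c , d , v , w , p , refl , t , u , q))))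
    from' r p q (tv-* {c} {d} {v} {w} t u) = inj₂ (inj₂ (inj₂ (inj₂ (_ , c , d , v , w , p , refl , t , u , q))))
    from : ∀ r → TV (r 3) (r 4) (r 5) → Body r
    from r = from' r refl refl

  decides-qv : ∀ m n → Decides E (args (Bounded m n)) qvᵇ (args QV)
  decides-qv m = decides-proc QV (Bounded m) (λ { _ _ _ (_ , ()) }) λ n rec →
    decides-⇔ (λ r _ → to r) (λ r _ → from r)
      (decides-∨
        (decides-binary 0 TV (Bounded m (suc n)) (suc n) (λ r → proj₂) (sub₀ n) (decides-tv m (suc n))
          (decides-∨ (decides-∧ (decides-atom _ _) (decides-atom _ _))
            (decides-∧ (decides-¬ (decides-atom _ _)) (decides-atom _ _))))
        (decides-∨ (decides-∧ (decides-tag 4 1 zeroᵗ) (decides-atom _ _))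
        (decides-∨
          (decides-∃ 6 (decides-∃ 7 (decides-∧ (decides-tag 4 2 (var 6)) (decides-∧ (decides-atom _ _)
            (decides-call QV (Bounded m n) 0 3 4
              (λ { _ (((_ , v , (r , c , (l , lt) , refl) , refl) , eq) , _) → l , shrink 1 c lt eq })
              rec)))))
        (decides-∨
          (decides-binary 3 QV (Bounded m n) (suc n) (λ r → proj₂) (bounded-components 2) rec (decides-atom _ _))
          (decides-binary 4 QV (Bounded m n) (suc n) (λ r → proj₂) (bounded-components 3) rec (decides-atom _ _))))))
    where
    sub₀ : ∀ n (r : Assign) c d → params (Bounded m (suc n)) r → r 4 ≡ ⟨ 0 , ⟨ c , d ⟩ ⟩ →
           ∀ v → Bounded m (suc n) (r 3) c v × Bounded m (suc n) (r 3) d v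
    sub₀ n r c d (l , lt) eq _ = (l , ≤-<-trans (m≤pair c d) s) , (l , ≤-<-trans (n≤pair c d) s)
      where s = ≤-<-trans (≤-trans (n≤pair 0 ⟨ c , d ⟩) (≤-reflexive (sym eq))) lt
    Body : Assign → Set
    Body r = Binary 0 TV (λ r → (r 9 ≡ r 10 × r 5 ≡ 1) ⊎ (¬ r 9 ≡ r 10 × r 5 ≡ 0)) r ⊎
      (r 4 ≡ ⟨ 1 , 0 ⟩ × r 5 ≡ 0) ⊎
      (Σ ℕ λ c → Σ ℕ λ v → r 4 ≡ ⟨ 2 , c ⟩ × r 5 + v ≡ 1 × QV (r 3) c v) ⊎
      Binary 3 QV (λ r → r 5 ≡ r 9 * r 10) r ⊎ Binary 4 QV (λ r → r 5 + r 9 * r 10 ≡ r 9 + r 10) r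
    qv : ∀ r {c v} → r 4 ≡ c → r 5 ≡ v → QV (r 3) c v → QV (r 3) (r 4) (r 5)
    qv r refl refl t = t
    to : ∀ r → Body r → QV (r 3) (r 4) (r 5)
    to r (inj₁ (_ , c , d , v , w , p , refl , t , u , inj₁ (refl , q))) = qv r p q (qv-≡ t u)
    to r (inj₁ (_ , c , d , v , w , p , refl , t , u , inj₂ (v≢w , q))) = qv r p q (qv-≢ t u v≢w)
    to r (inj₂ (inj₁ (p , q))) = qv r p q qv-⊥
    to r (inj₂ (inj₂ (inj₁ (c , v , p , q , t)))) = qv r p refl (qv-¬ t q)
    to r (inj₂ (inj₂ (inj₂ (inj₁ (_ , c , d , v , w , p , refl , t , u , q))))) = qv r p q (qv-∧ t u)
    to r (inj₂ (inj₂ (inj₂ (inj₂ (_ , c , d , v , w , p , refl , t , u , q))))) = qv r p refl (qv-∨ t u q)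
    from' : ∀ r {c v} → r 4 ≡ c → r 5 ≡ v → QV (r 3) c v → Body r
    from' r p q (qv-≡ {c} {d} {v} t u) = inj₁ (_ , c , d , v , v , p , refl , t , u , inj₁ (refl , q))
    from' r p q (qv-≢ {c} {d} {v} {w} t u v≢w) = inj₁ (_ , c , d , v , w , p , refl , t , u , inj₂ (v≢w , q))
    from' r p q qv-⊥ = inj₂ (inj₁ (p , q))
    from' r p q (qv-¬ {c} {v} t e) = inj₂ (inj₂ (inj₁ (c , v , p , trans (cong (_+ v) q) e , t)))
    from' r p q (qv-∧ {c} {d} {v} {w} t u) = inj₂ (inj₂ (inj₂ (inj₁ (_ , c , d , v , w , p , refl , t , u , q))))
    from' r p q (qv-∨ {c} {d} {v} {w} t u e) =
      inj₂ (inj₂ (inj₂ (inj₂ (_ , c , d , v , w , p , refl , t , u , trans (cong (_+ v * w) q) e))))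
    from : ∀ r → QV (r 3) (r 4) (r 5) → Body r
    from r = from' r refl refl

  Quantified : ℕ → ((ℕ → Set) → Set) → Assign → Set
  Quantified n Q r = Σ ℕ λ p → Σ ℕ λ x → Σ ℕ λ c → r 4 ≡ ⟨ n , p ⟩ × p ≡ ⟨ x , c ⟩ ×
    Q (λ a → Σ ℕ λ e → e ≡ ext x a (r 3) × PV e c)

  -- Every quantifier lengthens e by one and shortens c.
  decides-pv : ∀ m n → Decides E (args (λ e c _ → (Σ ℕ λ l → l + n ≤ m × Len< l e) × c < n)) pvᵇ (args (λ e c _ → PV e c))
  decides-pv m = decides-proc A C (λ { _ _ _ (_ , ()) }) λ n rec →
    decides-⇔ (λ r _ → to r) (λ r _ → from r)
      (decides-∨
        (decides-∃ 6 (decides-∧ (decides-atom _ _)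
          (decides-call QV (Bounded m (suc n)) 0 1 3
            -- Length and code rank have a bounded sum, so every environment that reaches a matrix
            -- is shorter than the fixed m.
            (λ { _ ((r , _ , ((l , le , len) , lt) , refl) , _) → len-mono (≤-trans (m≤m+n l (suc n)) le) len , lt })
            (decides-qv m (suc n)))))
        (decides-∨
          (quantified n 4 (λ Q → Σ ℕ Q) (∃ᵇ 9) (decides-∃ 9) rec)
          (quantified n 5 (λ Q → (a : ℕ) → Q a) (∀ᵇ 9) (decides-∀ 9) rec)))
    where
    A : Rel
    A e c _ = PV e c
    C : ℕ → Rel
    C n e c _ = (Σ ℕ λ l → l + n ≤ m × Len< l e) × c < n
    quantified : ∀ {E} n t (Q : (ℕ → Set) → Set) (Qᵇ : BFm → BFm) →
      (∀ {E B F P} → Decides E (Updated 9 B) F P → Decides E B (Qᵇ F) (λ r → Q (λ a → P (r [ 9 ≔ a ])))) →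
      Decides E (args (C n)) (claim 0) (args A) →
      Decides E (params (C (suc n))) (quantᵇ (suc t) Qᵇ) (Quantified (suc t) Q)
    quantified n t Q Qᵇ dQ rec =
      decides-∃ 6 (decides-∃ 7 (decides-∃ 8 (decides-∧ (decides-tag 4 (suc t) (var 6))
        (decides-∧
          (decides-call (λ a b c → c ≡ ⟨ a , b ⟩) (λ a b c → c < suc n) 4 5 3
            (λ { _ ((_ , c , (_ , x , (r , p , (_ , lt) , refl) , refl) , refl) , eq) →
                 ≤-<-trans (≤-trans (n≤pair (suc t) p) (≤-reflexive (sym eq))) lt })
            (decides-pair (suc n)))
          (dQ (decides-∃ 10 (decides-∧ (decides-atom _ _)
            (decides-call A (C n) 7 5 2
              (λ { _ ((_ , e , (_ , a ,
                       (((_ , c , (_ , x , (r , p , ((l , le , len) , lt) , refl) , refl) , refl) , eq) , eq') , refl) , refl) , eqe) →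
                   (suc l , subst (_≤ m) (+-suc l n) le , subst (Len< (suc l)) (sym eqe) (len-s x a (r 3) len))
                   , proj₂ (shrink₂ t x c lt (trans eq (cong ⟨ suc t ,_⟩ eq'))) })
              rec))))))))
    Body : Assign → Set
    Body r = (Σ ℕ λ b → b ≡ 1 × QV (r 3) (r 4) b) ⊎
      Quantified 5 (λ Q → Σ ℕ Q) r ⊎ Quantified 6 (λ Q → (a : ℕ) → Q a) r
    pv : ∀ r {c} → r 4 ≡ c → PV (r 3) c → PV (r 3) (r 4)
    pv r refl t = t
    to : ∀ r → Body r → PV (r 3) (r 4)
    to r (inj₁ (_ , refl , q)) = pv-qf q
    to r (inj₂ (inj₁ (_ , x , c , p , refl , a , _ , refl , t))) = pv r p (pv-∃ {c = c} x a t)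
    to r (inj₂ (inj₂ (_ , x , c , p , refl , f))) =
      pv r p (pv-∀ {c = c} x λ a → let (_ , eq , t) = f a in subst (λ e → PV e c) eq t)
    from' : ∀ r {e c} → r 3 ≡ e → r 4 ≡ c → PV e c → Body r
    from' r p q (pv-qf t) = inj₁ (1 , refl , subst₂ (λ e c → QV e c 1) (sym p) (sym q) t)
    from' r q p (pv-∃ {c = c} x a t) =
      inj₂ (inj₁ (_ , x , c , p , refl , a , _ , refl , subst (λ e → PV (ext x a e) c) (sym q) t))
    from' r q p (pv-∀ {c = c} x f) =
      inj₂ (inj₂ (_ , x , c , p , refl , λ a → _ , refl , subst (λ e → PV (ext x a e) c) (sym q) (f a)))
    from : ∀ r → PV (r 3) (r 4) → Body r
    from r = from' r refl refl

-- Injectivity of the Gödel numbering.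

tagᵗ-of contentᵗ : Tm → ℕ
tagᵗ-of (var x) = 0
tagᵗ-of zeroᵗ = 1
tagᵗ-of (sucᵗ t) = 2
tagᵗ-of (t +ᵗ u) = 3
tagᵗ-of (t *ᵗ u) = 4
contentᵗ (var x) = x
contentᵗ zeroᵗ = 0
contentᵗ (sucᵗ t) = ⌜ t ⌝ᵗ
contentᵗ (t +ᵗ u) = ⟨ ⌜ t ⌝ᵗ , ⌜ u ⌝ᵗ ⟩
contentᵗ (t *ᵗ u) = ⟨ ⌜ t ⌝ᵗ , ⌜ u ⌝ᵗ ⟩

⌜⌝ᵗ-split : ∀ t → ⌜ t ⌝ᵗ ≡ ⟨ tagᵗ-of t , contentᵗ t ⟩
⌜⌝ᵗ-split (var x) = refl
⌜⌝ᵗ-split zeroᵗ = refl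
⌜⌝ᵗ-split (sucᵗ t) = refl
⌜⌝ᵗ-split (t +ᵗ u) = refl
⌜⌝ᵗ-split (t *ᵗ u) = refl

mutual
  ⌜⌝ᵗ-injective : ∀ t u → ⌜ t ⌝ᵗ ≡ ⌜ u ⌝ᵗ → t ≡ u
  ⌜⌝ᵗ-injective t u p with pair-injective (tagᵗ-of t) (contentᵗ t) (tagᵗ-of u) (contentᵗ u)
                             (trans (sym (⌜⌝ᵗ-split t)) (trans p (⌜⌝ᵗ-split u)))
  ... | q , q' = split-injectiveᵗ t u q q'

  -- With the tags compared first, mixed constructors are absurd and one case per constructor
  -- remains.
  split-injectiveᵗ : ∀ t u → tagᵗ-of t ≡ tagᵗ-of u → contentᵗ t ≡ contentᵗ u → t ≡ u
  split-injectiveᵗ (var x) (var y) _ q = cong var q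
  split-injectiveᵗ zeroᵗ zeroᵗ _ q = refl
  split-injectiveᵗ (sucᵗ t) (sucᵗ u) _ q = cong sucᵗ (⌜⌝ᵗ-injective t u q)
  split-injectiveᵗ (t +ᵗ t') (u +ᵗ u') _ q with pair-injective ⌜ t ⌝ᵗ ⌜ t' ⌝ᵗ ⌜ u ⌝ᵗ ⌜ u' ⌝ᵗ q
  ... | p , p' = cong₂ _+ᵗ_ (⌜⌝ᵗ-injective t u p) (⌜⌝ᵗ-injective t' u' p')
  split-injectiveᵗ (t *ᵗ t') (u *ᵗ u') _ q with pair-injective ⌜ t ⌝ᵗ ⌜ t' ⌝ᵗ ⌜ u ⌝ᵗ ⌜ u' ⌝ᵗ q
  ... | p , p' = cong₂ _*ᵗ_ (⌜⌝ᵗ-injective t u p) (⌜⌝ᵗ-injective t' u' p')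

tag-of content : Form → ℕ
tag-of (t ≐ u) = 0
tag-of ⊥ᶠ = 1
tag-of (¬ᶠ φ) = 2
tag-of (φ ∧ᶠ ψ) = 3
tag-of (φ ∨ᶠ ψ) = 4
tag-of (∃ᶠ x φ) = 5
tag-of (∀ᶠ x φ) = 6
content (t ≐ u) = ⟨ ⌜ t ⌝ᵗ , ⌜ u ⌝ᵗ ⟩
content ⊥ᶠ = 0
content (¬ᶠ φ) = ⌜ φ ⌝
content (φ ∧ᶠ ψ) = ⟨ ⌜ φ ⌝ , ⌜ ψ ⌝ ⟩
content (φ ∨ᶠ ψ) = ⟨ ⌜ φ ⌝ , ⌜ ψ ⌝ ⟩
content (∃ᶠ x φ) = ⟨ x , ⌜ φ ⌝ ⟩
content (∀ᶠ x φ) = ⟨ x , ⌜ φ ⌝ ⟩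

⌜⌝-split : ∀ φ → ⌜ φ ⌝ ≡ ⟨ tag-of φ , content φ ⟩
⌜⌝-split (t ≐ u) = refl
⌜⌝-split ⊥ᶠ = refl
⌜⌝-split (¬ᶠ φ) = refl
⌜⌝-split (φ ∧ᶠ ψ) = refl
⌜⌝-split (φ ∨ᶠ ψ) = refl
⌜⌝-split (∃ᶠ x φ) = refl
⌜⌝-split (∀ᶠ x φ) = refl

mutual
  ⌜⌝-injective : ∀ φ ψ → ⌜ φ ⌝ ≡ ⌜ ψ ⌝ → φ ≡ ψ
  ⌜⌝-injective φ ψ p with pair-injective (tag-of φ) (content φ) (tag-of ψ) (content ψ)
                            (trans (sym (⌜⌝-split φ)) (trans p (⌜⌝-split ψ)))
  ... | q , q' = split-injective φ ψ q q'

  split-injective : ∀ φ ψ → tag-of φ ≡ tag-of ψ → content φ ≡ content ψ → φ ≡ ψ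
  split-injective (t ≐ t') (u ≐ u') _ q with pair-injective ⌜ t ⌝ᵗ ⌜ t' ⌝ᵗ ⌜ u ⌝ᵗ ⌜ u' ⌝ᵗ q
  ... | p , p' = cong₂ _≐_ (⌜⌝ᵗ-injective t u p) (⌜⌝ᵗ-injective t' u' p')
  split-injective ⊥ᶠ ⊥ᶠ _ q = refl
  split-injective (¬ᶠ φ) (¬ᶠ ψ) _ q = cong ¬ᶠ_ (⌜⌝-injective φ ψ q)
  split-injective (φ ∧ᶠ φ') (ψ ∧ᶠ ψ') _ q with pair-injective ⌜ φ ⌝ ⌜ φ' ⌝ ⌜ ψ ⌝ ⌜ ψ' ⌝ q
  ... | p , p' = cong₂ _∧ᶠ_ (⌜⌝-injective φ ψ p) (⌜⌝-injective φ' ψ' p')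
  split-injective (φ ∨ᶠ φ') (ψ ∨ᶠ ψ') _ q with pair-injective ⌜ φ ⌝ ⌜ φ' ⌝ ⌜ ψ ⌝ ⌜ ψ' ⌝ q
  ... | p , p' = cong₂ _∨ᶠ_ (⌜⌝-injective φ ψ p) (⌜⌝-injective φ' ψ' p')
  split-injective (∃ᶠ x φ) (∃ᶠ y ψ) _ q with pair-injective x ⌜ φ ⌝ y ⌜ ψ ⌝ q
  ... | p , p' = cong₂ ∃ᶠ p (⌜⌝-injective φ ψ p')
  split-injective (∀ᶠ x φ) (∀ᶠ y ψ) _ q with pair-injective x ⌜ φ ⌝ y ⌜ ψ ⌝ q
  ... | p , p' = cong₂ ∀ᶠ p (⌜⌝-injective φ ψ p')

-- Coded truth is truth.

Agree : ℕ → Assign → Set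
Agree e ρ = ∀ {x v} → Lk e x v → ρ x ≡ v

Coveredᵗ : ℕ → Tm → Set
Coveredᵗ e t = ∀ x → FreeTm x t → Σ ℕ (Lk e x)

-- The environment also records which variables may occur free. For the empty environment this is
-- closedness, which membership in `T` demands.
Covered : ℕ → Form → Set
Covered e φ = ∀ x → FreeF x φ → Σ ℕ (Lk e x)

Lk-ext : ∀ {e' y v} x a e → e' ≡ ext x a e → Lk e' y v → (x ≡ y × a ≡ v) ⊎ (x ≢ y × Lk e y v)
Lk-ext x a e p (here x' a' e') with ext-injective {x'} {a'} {e'} {x} {a} {e} p
... | refl , refl , refl = inj₁ (refl , refl)
Lk-ext x a e p (there x' a' {e'} x'≢y l) with ext-injective {x'} {a'} {e'} {x} {a} {e} p
... | refl , refl , refl = inj₂ (x'≢y , l)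

Agree-ext : ∀ {e ρ} x a → Agree e ρ → Agree (ext x a e) (ρ [ x ≔ a ])
Agree-ext {e} {ρ} x a agree l with Lk-ext x a e refl l
... | inj₁ (refl , refl) = update-same ρ x a
... | inj₂ (x≢y , l') = trans (update-other ρ a (λ p → x≢y (sym p))) (agree l')

Covered-ext : ∀ {e} x a φ → Covered (ext x a e) φ → ∀ y → y ≢ x × FreeF y φ → Σ ℕ (Lk e y)
Covered-ext {e} x a φ cov y (y≢x , free) with cov y free
... | v , l with Lk-ext x a e refl l
... | inj₁ (x≡y , _) = contradiction (sym x≡y) y≢x
... | inj₂ (_ , l') = v , l'

Covered-body : ∀ {e} x a φ → (∀ y → y ≢ x × FreeF y φ → Σ ℕ (Lk e y)) → Covered (ext x a e) φ
Covered-body {e} x a φ cov y free with y ≟ x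
... | yes refl = a , here y a e
... | no y≢x = let v , l = cov y (y≢x , free) in v , there x a (λ p → y≢x (sym p)) l

TV-sound : ∀ {e c v} → TV e c v →
  Σ Tm λ t → ⌜ t ⌝ᵗ ≡ c × Coveredᵗ e t × (∀ ρ → Agree e ρ → ⟦ t ⟧ᵗ ρ ≡ v)
TV-sound (tv-var {x} l) = var x , refl , (λ { _ refl → _ , l }) , λ ρ agree → agree l
TV-sound tv-zero = zeroᵗ , refl , (λ _ ()) , λ ρ agree → refl
TV-sound (tv-suc d) with TV-sound d
... | t , refl , cov , val = sucᵗ t , refl , cov , λ ρ agree → cong suc (val ρ agree)
TV-sound (tv-+ d d') with TV-sound d | TV-sound d'
... | t , refl , cov , val | t' , refl , cov' , val' =
  t +ᵗ t' , refl , (λ { x (inj₁ f) → cov x f ; x (inj₂ f) → cov' x f }) ,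
  λ ρ agree → cong₂ _+_ (val ρ agree) (val' ρ agree)
TV-sound (tv-* d d') with TV-sound d | TV-sound d'
... | t , refl , cov , val | t' , refl , cov' , val' =
  t *ᵗ t' , refl , (λ { x (inj₁ f) → cov x f ; x (inj₂ f) → cov' x f }) ,
  λ ρ agree → cong₂ _*_ (val ρ agree) (val' ρ agree)

TV-complete : ∀ {e ρ} t → Coveredᵗ e t → Agree e ρ → TV e ⌜ t ⌝ᵗ (⟦ t ⟧ᵗ ρ)
TV-complete {e} (var x) cov agree with cov x refl
... | v , l = tv-var (subst (Lk e x) (sym (agree l)) l)
TV-complete zeroᵗ cov agree = tv-zero
TV-complete (sucᵗ t) cov agree = tv-suc (TV-complete t cov agree)
TV-complete (t +ᵗ u) cov agree =
  tv-+ (TV-complete t (λ x → cov x ∘ inj₁) agree) (TV-complete u (λ x → cov x ∘ inj₂) agree)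
TV-complete (t *ᵗ u) cov agree =
  tv-* (TV-complete t (λ x → cov x ∘ inj₁) agree) (TV-complete u (λ x → cov x ∘ inj₂) agree)

-- Falsity is the value 0 and not the absence of the value 1: the latter also holds of numbers that
-- code no formula, so negation has to act on values.
HasValue : Set → ℕ → Set
HasValue P b = (b ≡ 1 × P) ⊎ (b ≡ 0 × ¬ P)

value-¬ : ∀ {P a b} → HasValue P a → b + a ≡ 1 → HasValue (¬ P) b
value-¬ {b = b} (inj₁ (refl , p)) q = inj₂ (+-cancelʳ-≡ 1 b 0 q , λ ¬p → ¬p p)
value-¬ {b = b} (inj₂ (refl , ¬p)) q = inj₁ (+-cancelʳ-≡ 0 b 1 q , ¬p)

value-∧ : ∀ {P Q a b} → HasValue P a → HasValue Q b → HasValue (P × Q) (a * b)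
value-∧ (inj₁ (refl , p)) (inj₁ (refl , q)) = inj₁ (refl , p , q)
value-∧ (inj₁ (refl , p)) (inj₂ (refl , ¬q)) = inj₂ (refl , λ (_ , q) → ¬q q)
value-∧ (inj₂ (refl , ¬p)) _ = inj₂ (refl , λ (p , _) → ¬p p)

-- The equation is inclusion-exclusion for the values 0 and 1, written without subtraction.
value-∨ : ∀ {P Q a b c} → HasValue P a → HasValue Q b → c + a * b ≡ a + b → HasValue (P ⊎ Q) c
value-∨ {c = c} (inj₁ (refl , p)) (inj₁ (refl , q)) e = inj₁ (+-cancelʳ-≡ 1 c 1 e , inj₁ p)
value-∨ {c = c} (inj₁ (refl , p)) (inj₂ (refl , ¬q)) e = inj₁ (+-cancelʳ-≡ 0 c 1 e , inj₁ p)
value-∨ {c = c} (inj₂ (refl , ¬p)) (inj₁ (refl , q)) e = inj₁ (+-cancelʳ-≡ 0 c 1 e , inj₂ q)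
value-∨ {c = c} (inj₂ (refl , ¬p)) (inj₂ (refl , ¬q)) e =
  inj₂ (+-cancelʳ-≡ 0 c 0 e , λ { (inj₁ p) → ¬p p ; (inj₂ q) → ¬q q })

∨-value : ∀ {P Q a b} → HasValue P a → HasValue Q b → Σ ℕ λ c → c + a * b ≡ a + b
∨-value (inj₁ (refl , _)) (inj₁ (refl , _)) = 1 , refl
∨-value (inj₁ (refl , _)) (inj₂ (refl , _)) = 1 , refl
∨-value (inj₂ (refl , _)) (inj₁ (refl , _)) = 1 , refl
∨-value (inj₂ (refl , _)) (inj₂ (refl , _)) = 0 , refl

¬-value : ∀ {P a} → HasValue P a → Σ ℕ λ b → b + a ≡ 1
¬-value (inj₁ (refl , _)) = 0 , refl
¬-value (inj₂ (refl , _)) = 1 , refl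

QV-sound : ∀ {e c b} → QV e c b →
  Σ Form λ φ → QuantFree φ × ⌜ φ ⌝ ≡ c × Covered e φ × (∀ ρ → Agree e ρ → HasValue (⟦ φ ⟧ᶠ ρ) b)
QV-sound (qv-≡ d d') with TV-sound d | TV-sound d'
... | t , refl , cov , val | t' , refl , cov' , val' =
  t ≐ t' , qf≐ , refl , (λ { x (inj₁ f) → cov x f ; x (inj₂ f) → cov' x f }) ,
  λ ρ agree → inj₁ (refl , trans (val ρ agree) (sym (val' ρ agree)))
QV-sound (qv-≢ d d' v≢w) with TV-sound d | TV-sound d'
... | t , refl , cov , val | t' , refl , cov' , val' =
  t ≐ t' , qf≐ , refl , (λ { x (inj₁ f) → cov x f ; x (inj₂ f) → cov' x f }) ,
  λ ρ agree → inj₂ (refl , λ p → v≢w (trans (sym (val ρ agree)) (trans p (val' ρ agree))))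
QV-sound qv-⊥ = ⊥ᶠ , qf⊥ , refl , (λ _ ()) , λ ρ agree → inj₂ (refl , id)
QV-sound (qv-¬ d e) with QV-sound d
... | φ , qf , refl , cov , val = ¬ᶠ φ , qf¬ qf , refl , cov , λ ρ agree → value-¬ (val ρ agree) e
QV-sound (qv-∧ d d') with QV-sound d | QV-sound d'
... | φ , qf , refl , cov , val | φ' , qf' , refl , cov' , val' =
  φ ∧ᶠ φ' , qf∧ qf qf' , refl , (λ { x (inj₁ f) → cov x f ; x (inj₂ f) → cov' x f }) ,
  λ ρ agree → value-∧ (val ρ agree) (val' ρ agree)
QV-sound (qv-∨ d d' e) with QV-sound d | QV-sound d'
... | φ , qf , refl , cov , val | φ' , qf' , refl , cov' , val' =
  φ ∨ᶠ φ' , qf∨ qf qf' , refl , (λ { x (inj₁ f) → cov x f ; x (inj₂ f) → cov' x f }) ,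
  λ ρ agree → value-∨ (val ρ agree) (val' ρ agree) e

QV-complete : ∀ {e ρ φ} → QuantFree φ → Covered e φ → Agree e ρ →
  Σ ℕ λ b → QV e ⌜ φ ⌝ b × HasValue (⟦ φ ⟧ᶠ ρ) b
QV-complete {e} {ρ} (qf≐ {t} {u}) cov agree with ⟦ t ⟧ᵗ ρ ≟ ⟦ u ⟧ᵗ ρ
... | yes p = 1 , qv-≡ (subst (TV e ⌜ t ⌝ᵗ) p (TV-complete t (λ x → cov x ∘ inj₁) agree))
                       (TV-complete u (λ x → cov x ∘ inj₂) agree) , inj₁ (refl , p)
... | no ¬p = 0 , qv-≢ (TV-complete t (λ x → cov x ∘ inj₁) agree)
                       (TV-complete u (λ x → cov x ∘ inj₂) agree) ¬p , inj₂ (refl , ¬p)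
QV-complete qf⊥ cov agree = 0 , qv-⊥ , inj₂ (refl , id)
QV-complete (qf¬ qf) cov agree with QV-complete qf cov agree
... | a , d , val with ¬-value val
... | b , e = b , qv-¬ d e , value-¬ val e
QV-complete (qf∧ qf qf') cov agree
  with QV-complete qf (λ x → cov x ∘ inj₁) agree | QV-complete qf' (λ x → cov x ∘ inj₂) agree
... | a , d , val | a' , d' , val' = a * a' , qv-∧ d d' , value-∧ val val'
QV-complete (qf∨ qf qf') cov agree
  with QV-complete qf (λ x → cov x ∘ inj₁) agree | QV-complete qf' (λ x → cov x ∘ inj₂) agree
... | a , d , val | a' , d' , val' with ∨-value val val'
... | b , e = b , qv-∨ d d' e , value-∨ val val' e

PV-sound : ∀ {e c} → PV e c →
  Σ Form λ φ → Prenex φ × ⌜ φ ⌝ ≡ c × Covered e φ × (∀ ρ → Agree e ρ → ⟦ φ ⟧ᶠ ρ)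
PV-sound (pv-qf d) with QV-sound d
... | φ , qf , p , cov , val = φ , matrix qf , p , cov , λ ρ agree → holds (val ρ agree)
  where
  holds : ∀ {P} → HasValue P 1 → P
  holds (inj₁ (_ , p)) = p
PV-sound (pv-∃ x a d) with PV-sound d
... | φ , pre , refl , cov , val =
  ∃ᶠ x φ , pre∃ pre , refl , Covered-ext x a φ cov , λ ρ agree → a , val _ (Agree-ext x a agree)
-- Each instance yields a formula of its own. The one at 0 is taken as the body, and injectivity of
-- the numbering identifies the others with it.
PV-sound {e} (pv-∀ {c = c} x d) with PV-sound (d 0)
... | φ , pre , p , cov , _ =
  ∀ᶠ x φ , pre∀ pre , cong (λ c → ⟨ 6 , ⟨ x , c ⟩ ⟩) p , Covered-ext x 0 φ cov ,
  λ ρ agree a → instance-holds ρ agree a (PV-sound (d a))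
  where
  instance-holds : ∀ ρ → Agree e ρ → ∀ a →
    (Σ Form λ ψ → Prenex ψ × ⌜ ψ ⌝ ≡ c × Covered (ext x a e) ψ × (∀ ρ → Agree (ext x a e) ρ → ⟦ ψ ⟧ᶠ ρ)) →
    ⟦ φ ⟧ᶠ (ρ [ x ≔ a ])
  instance-holds ρ agree a (ψ , _ , q , _ , val) =
    subst (λ χ → ⟦ χ ⟧ᶠ (ρ [ x ≔ a ])) (⌜⌝-injective ψ φ (trans q (sym p))) (val _ (Agree-ext x a agree))

PV-complete : ∀ {e ρ φ} → Prenex φ → Covered e φ → Agree e ρ → ⟦ φ ⟧ᶠ ρ → PV e ⌜ φ ⌝
PV-complete {e} {φ = φ} (matrix qf) cov agree h with QV-complete qf cov agree
... | _ , d , inj₁ (p , _) = pv-qf (subst (QV e ⌜ φ ⌝) p d)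
... | _ , d , inj₂ (_ , ¬h) = contradiction h ¬h
PV-complete {e} (pre∃ {x} {φ} pre) cov agree (a , h) =
  pv-∃ x a (PV-complete pre (Covered-body x a φ cov) (Agree-ext x a agree) h)
PV-complete {e} (pre∀ {x} {φ} pre) cov agree h =
  pv-∀ x λ a → PV-complete pre (Covered-body x a φ cov) (Agree-ext x a agree) (h a)

PV⇒T : ∀ {n} → PV 0 n → T n
PV⇒T d with PV-sound d
... | φ , pre , p , cov , val = φ , pre , (λ x f → no-entry (cov x f)) , p , val _ (λ ())
  where
  no-entry : ∀ {x} → ¬ Σ ℕ (Lk 0 x)
  no-entry (_ , ())

T⇒PV : ∀ {n} → T n → PV 0 n
T⇒PV (φ , pre , closed , refl , h) = PV-complete pre (λ x f → ⊥-elim (closed x f)) (λ ()) h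

-- Oracle programs have at most one value.

module _ {O : ℕ → Set} where
  mutual
    Eval-functional : ∀ {n} {f : PR n} {xs y z} → Eval O f xs y → Eval O f xs z → y ≡ z
    Eval-functional ev-zero ev-zero = refl
    Eval-functional ev-succ ev-succ = refl
    Eval-functional ev-proj ev-proj = refl
    Eval-functional (ev-yes _) (ev-yes _) = refl
    Eval-functional (ev-yes p) (ev-no ¬p) = contradiction p ¬p
    Eval-functional (ev-no ¬p) (ev-yes p) = contradiction p ¬p
    Eval-functional (ev-no _) (ev-no _) = refl
    Eval-functional (ev-comp ds d) (ev-comp ds' d') with EvalV-functional ds ds'
    ... | refl = Eval-functional d d'
    Eval-functional (ev-rec0 d) (ev-rec0 d') = Eval-functional d d'
    Eval-functional (ev-recS d e) (ev-recS d' e') with Eval-functional d d'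
    ... | refl = Eval-functional e e'
    Eval-functional {y = y} {z} (ev-μ d below) (ev-μ d' below') with <-cmp y z
    ... | tri≈ _ y≡z _ = y≡z
    ... | tri< y<z _ _ with Eval-functional d (proj₂ (below' y y<z))
    ...   | ()
    Eval-functional {y = y} {z} (ev-μ d below) (ev-μ d' below') | tri> _ _ z<y
      with Eval-functional d' (proj₂ (below z z<y))
    ...   | ()

    EvalV-functional : ∀ {n m} {gs : Vec (PR m) n} {xs ys zs} → EvalV O gs xs ys → EvalV O gs xs zs → ys ≡ zs
    EvalV-functional evV-[] evV-[] = refl
    EvalV-functional (evV-∷ d ds) (evV-∷ d' ds') = cong₂ _∷_ (Eval-functional d d') (EvalV-functional ds ds')

-- Runs of consecutive variables.

update-below : ∀ r {x y} a → y < x → (r [ x ≔ a ]) y ≡ r y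
update-below r a y<x = update-other r a (<⇒≢ y<x)

update-above : ∀ r {x y} a → x < y → (r [ x ≔ a ]) y ≡ r y
update-above r a x<y = update-other r a (>⇒≢ x<y)

map-update : ∀ {n} {xs : Vec ℕ n} r {f y} a → All (_< f) xs → f ≤ y → map (r [ y ≔ a ]) xs ≡ map r xs
map-update r a [] le = refl
map-update r a (x<f ∷ xs<f) le = cong₂ _∷_ (update-below r a (<-≤-trans x<f le)) (map-update r a xs<f le)

∃⋯ : ℕ → ℕ → BFm → BFm
∃⋯ f zero F = F
∃⋯ f (suc n) F = ∃ᵇ f (∃⋯ (suc f) n F)

_[_≔⋯_] : Assign → ℕ → ∀ {n} → Vec ℕ n → Assign
r [ f ≔⋯ [] ] = r
r [ f ≔⋯ v ∷ vs ] = (r [ f ≔ v ]) [ suc f ≔⋯ vs ]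

range : ℕ → (n : ℕ) → Vec ℕ n
range f zero = []
range f (suc n) = f ∷ range (suc f) n

updates-below : ∀ r f {n} (vs : Vec ℕ n) {x} → x < f → (r [ f ≔⋯ vs ]) x ≡ r x
updates-below r f [] lt = refl
updates-below r f (v ∷ vs) lt = trans (updates-below _ (suc f) vs (m<n⇒m<1+n lt)) (update-below r v lt)

map-updates-below : ∀ {n k} {xs : Vec ℕ k} r f (vs : Vec ℕ n) → All (_< f) xs → map (r [ f ≔⋯ vs ]) xs ≡ map r xs
map-updates-below r f vs [] = refl
map-updates-below r f vs (lt ∷ lts) = cong₂ _∷_ (updates-below r f vs lt) (map-updates-below r f vs lts)

map-updates-range : ∀ r f {n} (vs : Vec ℕ n) → map (r [ f ≔⋯ vs ]) (range f n) ≡ vs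
map-updates-range r f [] = refl
map-updates-range r f (v ∷ vs) =
  cong₂ _∷_ (trans (updates-below _ (suc f) vs (n<1+n f)) (update-same r f v)) (map-updates-range _ (suc f) vs)

range-< : ∀ f n → All (_< n + f) (range f n)
range-< f zero = []
range-< f (suc n) = s≤s (m≤n+m f n) ∷ subst (λ k → All (_< k) (range (suc f) n)) (+-suc n f) (range-< (suc f) n)

∃⋯-intro : ∀ {m E F} r f {n} (vs : Vec ℕ n) → Win m ⊕ F E (r [ f ≔⋯ vs ]) → Win m ⊕ (∃⋯ f n F) E r
∃⋯-intro r f [] w = w
∃⋯-intro r f (v ∷ vs) w = v , ∃⋯-intro _ (suc f) vs w

∃⋯-elim : ∀ {m E F} r f n → Win m ⊕ (∃⋯ f n F) E r → Σ (Vec ℕ n) λ vs → Win m ⊕ F E (r [ f ≔⋯ vs ])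
∃⋯-elim r f zero w = [] , w
∃⋯-elim r f (suc n) (v , w) = let vs , w' = ∃⋯-elim _ (suc f) n w in v ∷ vs , w'

let-intro : ∀ m E F r x y → y ≢ x → Win m ⊕ F E (r [ x ≔ r y ]) → Win m ⊕ (letᵇ x y F) E r
let-intro m E F r x y y≢x w = r y , trans (update-same r x _) (sym (update-other r _ y≢x)) , w

let-elim : ∀ m E F r x y → y ≢ x → Win m ⊕ (letᵇ x y F) E r → Win m ⊕ F E (r [ x ≔ r y ])
let-elim m E F r x y y≢x (a , p , w) =
  subst (λ b → Win m ⊕ F E (r [ x ≔ b ])) (trans (sym (update-same r x a)) (trans p (update-other r a y≢x))) w

-- Finitely many instances have a largest clock. The universal quantifier of a minimisation needs
-- this below the value found; from there on no clock is spent.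
common-clock : (W : ℕ → ℕ → Set) → (∀ {m m' z} → m ≤ m' → W m z → W m' z) →
  ∀ y → (∀ z → z < y → Σ ℕ λ m → W m z) → Σ ℕ λ m → ∀ z → z < y → W m z
common-clock W mono zero h = 0 , λ _ ()
common-clock W mono (suc y) h with common-clock W mono y (λ z lt → h z (m<n⇒m<1+n lt)) | h y (n<1+n y)
... | m , ws | m' , w = m ⊔ m' , wins
  where
  wins : ∀ z → z < suc y → W (m ⊔ m') z
  wins z (s≤s le) with m≤n⇒m<n∨m≡n le
  ... | inj₁ z<y = mono (m≤m⊔n m m') (ws z z<y)
  ... | inj₂ refl = mono (m≤n⊔m m m') w

-- `call` passes only variables from 3 on, hence the copy of the queried number in 3 + k and the
-- empty environment in 4 + k. The callee overwrites variables from 0 on, perhaps those of the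
-- program, but no other branch sees this.
truthᵇ : ℕ → ℕ → BFm
truthᵇ x k = letᵇ (3 + k) x (∃ᵇ (4 + k) ((var (4 + k) ≐ᵇ zeroᵗ) ∧ᵇ call pvᵇ (1 + k) k k))

-- From programs to formulas

-- tr f xs o k: program f maps the values of the variables xs to that of o;
-- the variables from k on are free for use.
mutual
  tr : ∀ {n} → PR n → Vec ℕ n → ℕ → ℕ → BFm
  tr zeroᶠ xs o k = var o ≐ᵇ zeroᵗ
  tr succᶠ (x ∷ []) o k = var o ≐ᵇ sucᵗ (var x)
  tr (projᶠ i) xs o k = var o ≐ᵇ var (lookup xs i)
  tr oracleᶠ (x ∷ []) o k =
    ((var o ≐ᵇ oneᵗ) ∧ᵇ truthᵇ x k) ∨ᵇ ((var o ≐ᵇ zeroᵗ) ∧ᵇ (¬ᵇ truthᵇ x k))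
  tr (compᶠ {n} g hs) xs o k = ∃⋯ k n (trV hs xs k (n + k) ∧ᵇ tr g (range k n) o (n + k))
  tr (recᶠ g h) (x ∷ xs) o k = letᵇ k x (letᵇ (1 + k) o (label 0 (loop g h xs k)))
  tr (μᶠ g) xs o k =
    ∃ᵇ k ((var k ≐ᵇ zeroᵗ) ∧ᵇ tr g (o ∷ xs) k (1 + k)) ∧ᵇ
    -- The comparison with the result is by a witness for the difference and positivity by a
    -- predecessor, so minimality is expressed without negation.
    ∀ᵇ k (∃ᵇ (1 + k) (var k ≐ᵇ (var o +ᵗ var (1 + k))) ∨ᵇ
          positiveᵇ g xs k)

  positiveᵇ : ∀ {n} → PR (suc n) → Vec ℕ n → ℕ → BFm
  positiveᵇ g xs k = ∃ᵇ (1 + k) (∃ᵇ (2 + k) ((var (1 + k) ≐ᵇ sucᵗ (var (2 + k))) ∧ᵇ tr g (k ∷ xs) (1 + k) (3 + k)))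

  trV : ∀ {n m} → Vec (PR m) n → Vec ℕ m → ℕ → ℕ → BFm
  trV [] xs o k = zeroᵗ ≐ᵇ zeroᵗ
  trV (h ∷ hs) xs o k = tr h xs o k ∧ᵇ trV hs xs (suc o) k

  -- A claim restarts the same formula, so data pass only through fixed variables: k is the counter,
  -- 1 + k the claimed value, 2 + k and 3 + k the guessed predecessor and its value. The recursion
  -- is checked from the last stage downwards.
  loop : ∀ {n} → PR n → PR (suc (suc n)) → Vec ℕ n → ℕ → BFm
  loop g h xs k =
    ((var k ≐ᵇ zeroᵗ) ∧ᵇ tr g xs (1 + k) (4 + k)) ∨ᵇ
    ∃ᵇ (2 + k) (∃ᵇ (3 + k) ((var k ≐ᵇ sucᵗ (var (2 + k))) ∧ᵇ
      (tr h ((2 + k) ∷ (3 + k) ∷ xs) (1 + k) (4 + k) ∧ᵇ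
       letᵇ k (2 + k) (letᵇ (1 + k) (3 + k) (claim 0)))))

enter : Assign → ℕ → ℕ → ℕ → Assign
enter r k x o = let s = r [ k ≔ r x ] in s [ 1 + k ≔ s o ]

enter-0 : ∀ r {k} x o → x < k → enter r k x o k ≡ r x
enter-0 r {k} x o x<k = trans (update-below (r [ k ≔ r x ]) _ (n<1+n k)) (update-same r k _)

enter-1 : ∀ r {k} x o → o < k → enter r k x o (1 + k) ≡ r o
enter-1 r {k} x o o<k = trans (update-same (r [ k ≔ r x ]) (1 + k) _) (update-below r _ o<k)

enter-xs : ∀ r {k} x o {n} {xs : Vec ℕ n} → All (_< k) xs → map (enter r k x o) xs ≡ map r xs
enter-xs r {k} x o lts = trans (map-update (r [ k ≔ r x ]) _ lts (m≤n+m k 1)) (map-update r _ lts ≤-refl)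

μ-guess : Assign → ℕ → ℕ → ℕ → ℕ → Assign
μ-guess r k z b b' = ((r [ k ≔ z ]) [ 1 + k ≔ b ]) [ 2 + k ≔ b' ]

μ-guess-0 : ∀ r k z b b' → μ-guess r k z b b' k ≡ z
μ-guess-0 r k z b b' = trans (update-below ((r [ k ≔ z ]) [ 1 + k ≔ b ]) b' (s≤s (m≤n+m k 1)))
  (trans (update-below (r [ k ≔ z ]) b (n<1+n k)) (update-same r k z))

μ-guess-1 : ∀ r k z b b' → μ-guess r k z b b' (1 + k) ≡ b
μ-guess-1 r k z b b' = trans (update-below ((r [ k ≔ z ]) [ 1 + k ≔ b ]) b' (n<1+n (1 + k)))
  (update-same (r [ k ≔ z ]) (1 + k) b)

μ-guess-xs : ∀ r k z b b' {n} {xs : Vec ℕ n} → All (_< k) xs → map (μ-guess r k z b b') xs ≡ map r xs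
μ-guess-xs r k z b b' lts = trans (map-update ((r [ k ≔ z ]) [ 1 + k ≔ b ]) b' lts (m≤n+m k 2))
  (trans (map-update (r [ k ≔ z ]) b lts (m≤n+m k 1)) (map-update r z lts ≤-refl))

difference : ∀ r {k o} z d → o < k → let s = (r [ k ≔ z ]) [ 1 + k ≔ d ] in
  s k ≡ z × s o + s (1 + k) ≡ r o + d
difference r {k} {o} z d o<k =
  trans (update-below (r [ k ≔ z ]) d (n<1+n k)) (update-same r k z) ,
  cong₂ _+_ (trans (update-below (r [ k ≔ z ]) d (m<n⇒m<1+n o<k)) (update-below r z o<k))
            (update-same (r [ k ≔ z ]) (1 + k) d)

≥-witness : ∀ r {k o} → o < k → ∀ z d → let s = (r [ k ≔ z ]) [ 1 + k ≔ d ] in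
  s k ≡ s o + s (1 + k) → z ≡ r o + d
≥-witness r lt z d e = let p , q = difference r z d lt in trans (sym p) (trans e q)

≥-holds : ∀ r {k o} → o < k → ∀ z → r o ≤ z → let s = (r [ k ≔ z ]) [ 1 + k ≔ z ∸ r o ] in s k ≡ s o + s (1 + k)
≥-holds r {o = o} lt z le = let p , q = difference r z (z ∸ r o) lt in trans p (trans (sym (m+[n∸m]≡n le)) (sym q))

-- Correctness of the translation of programs.

module Translation (em : ExcludedMiddle 0ℓ) where
  open Classical em
  open Truth em

  -- Only wins of Eloise are controlled, and the clock may depend on the assignment: a diverging
  -- program need not be refutable. The oracle is the one place where a compound formula is negated,
  -- and there `Decides` is available.
  Sound Complete : ∀ {n} → PR n → Set
  Sound f = ∀ {xs o k} → All (_< k) xs → o < k → ∀ m E r {vs v} → map r xs ≡ vs → r o ≡ v →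
    Win m ⊕ (tr f xs o k) E r → Eval T f vs v
  Complete f = ∀ {xs o k} → All (_< k) xs → o < k → ∀ E r {vs v} → map r xs ≡ vs → r o ≡ v →
    Eval T f vs v → Σ ℕ λ m → Win m ⊕ (tr f xs o k) E r

  decides-truth : ∀ {E x k} → x < k → ∀ n → Decides E (λ r → r x < n) (truthᵇ x k) (λ r → T (r x))
  decides-truth {E} {x} {k} x<k n =
    decides-⇔ {P = λ r → Body (r [ 3 + k ≔ r x ])} (λ r _ → to r) (λ r _ → from r)
      (decides-let {B' = λ r → r (3 + k) < n} (3 + k) x (<⇒≢ (≤-trans x<k (m≤n+m k 3)))
        (λ r lt → subst (_< n) (sym (update-same r (3 + k) _)) lt)
        (decides-∃ (4 + k) (decides-∧ (decides-atom _ _)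
          (decides-call A C (1 + k) k k
            (λ { _ ((r , e , lt , refl) , p) →
                 -- The empty environment has length below 1, so the bounded sum of length and rank
                 -- starts at 1 + n.
                 (1 , ≤-refl , subst (Len< 1) (sym p) len-0) ,
                 subst (_< n) (sym (update-below r e (n<1+n (3 + k)))) lt })
            (decides-pv (1 + n) n)))))
    where
    A C : Rel
    A e c _ = PV e c
    C e c _ = (Σ ℕ λ l → l + n ≤ 1 + n × Len< l e) × c < n
    Body : Assign → Set
    Body r = Σ ℕ λ e → (r [ 4 + k ≔ e ]) (4 + k) ≡ 0 × PV ((r [ 4 + k ≔ e ]) (4 + k)) ((r [ 4 + k ≔ e ]) (3 + k))
    code : ∀ r e → ((r [ 3 + k ≔ r x ]) [ 4 + k ≔ e ]) (3 + k) ≡ r x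
    code r e = trans (update-below (r [ 3 + k ≔ r x ]) e (n<1+n (3 + k))) (update-same r (3 + k) _)
    to : ∀ r → Body (r [ 3 + k ≔ r x ]) → T (r x)
    to r (e , p , d) = PV⇒T (subst₂ PV p (code r e) d)
    from : ∀ r → T (r x) → Body (r [ 3 + k ≔ r x ])
    from r t = 0 , zero-env , subst₂ PV (sym zero-env) (sym (code r 0)) (T⇒PV t)
      where
      zero-env = update-same (r [ 3 + k ≔ r x ]) (4 + k) 0

  module Loop {n} (g : PR n) (h : PR (suc (suc n))) {xs : Vec ℕ n} {k} (lts : All (_< k) xs) (E : Env) where

    lts₄ : All (_< 4 + k) xs
    lts₄ = All.map (λ lt → ≤-trans lt (m≤n+m k 4)) lts

    guess : Assign → ℕ → ℕ → Assign
    guess r i y = (r [ 2 + k ≔ i ]) [ 3 + k ≔ y ]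

    next : Assign → ℕ → ℕ → Assign
    next r i y = let s = guess r i y ; s' = s [ k ≔ s (2 + k) ] in s' [ 1 + k ≔ s' (3 + k) ]

    guess-xs : ∀ r i y → map (guess r i y) xs ≡ map r xs
    guess-xs r i y = trans (map-update (r [ 2 + k ≔ i ]) y lts (m≤n+m k 3)) (map-update r i lts (m≤n+m k 2))

    guess-0 : ∀ r i y → guess r i y k ≡ r k
    guess-0 r i y = trans (update-below (r [ 2 + k ≔ i ]) y (s≤s (m≤n+m k 2))) (update-below r i (s≤s (m≤n+m k 1)))

    guess-1 : ∀ r i y → guess r i y (1 + k) ≡ r (1 + k)
    guess-1 r i y = trans (update-below (r [ 2 + k ≔ i ]) y (s≤s (m≤n+m (1 + k) 1))) (update-below r i (n<1+n (1 + k)))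

    guess-2 : ∀ r i y → guess r i y (2 + k) ≡ i
    guess-2 r i y = trans (update-below (r [ 2 + k ≔ i ]) y (n<1+n (2 + k))) (update-same r (2 + k) i)

    guess-3 : ∀ r i y → guess r i y (3 + k) ≡ y
    guess-3 r i y = update-same (r [ 2 + k ≔ i ]) (3 + k) y

    next-xs : ∀ r i y → map (next r i y) xs ≡ map r xs
    next-xs r i y = trans (map-update _ _ lts (m≤n+m k 1)) (trans (map-update (guess r i y) _ lts ≤-refl) (guess-xs r i y))

    next-0 : ∀ r i y → next r i y k ≡ i
    next-0 r i y = trans (update-below (guess r i y [ k ≔ guess r i y (2 + k) ]) _ (n<1+n k))
      (trans (update-same (guess r i y) k _) (guess-2 r i y))

    next-1 : ∀ r i y → next r i y (1 + k) ≡ y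
    next-1 r i y = trans (update-same (guess r i y [ k ≔ guess r i y (2 + k) ]) (1 + k) _)
      (trans (update-above (guess r i y) _ (m≤n+m (suc k) 2)) (guess-3 r i y))

    lts' : All (_< 4 + k) ((2 + k) ∷ (3 + k) ∷ xs)
    lts' = m≤n+m (3 + k) 1 ∷ n<1+n (3 + k) ∷ lts₄

    lets-elim : ∀ m E r i y → Win m ⊕ (letᵇ k (2 + k) (letᵇ (1 + k) (3 + k) (claim 0))) E (guess r i y) →
      Win m ⊕ (claim 0) E (next r i y)
    lets-elim m E r i y w =
      let-elim m E (claim 0) (guess r i y [ k ≔ guess r i y (2 + k) ]) (1 + k) (3 + k) (>⇒≢ (m≤n+m (2 + k) 1))
        (let-elim m E (letᵇ (1 + k) (3 + k) (claim 0)) (guess r i y) k (2 + k) (>⇒≢ (m≤n+m (1 + k) 1)) w)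

    -- Induction on the clock: the recursive branch ends in a claim, which takes a unit and cannot
    -- be won with clock 0.
    loop-sound : Sound g → Sound h → ∀ m r {i vs v} → r k ≡ i → map r xs ≡ vs → r (1 + k) ≡ v →
      Win m ⊕ (label 0 (loop g h xs k)) E r → Eval T (recᶠ g h) (i ∷ vs) v
    loop-sound sg sh m r refl refl refl (inj₁ (p , w)) =
      subst (λ i → Eval T (recᶠ g h) (i ∷ map r xs) (r (1 + k))) (sym p)
        (ev-rec0 (sg lts₄ (m≤n+m (2 + k) 2) m _ r refl refl w))
    loop-sound sg sh zero r refl refl refl (inj₂ (i , y , p , w , w')) =
      ⊥-elim (lets-elim zero ((0 , loop g h xs k) ∷ E) r i y w')
    loop-sound sg sh (suc m) r refl refl refl (inj₂ (i , y , p , w , w')) =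
      subst (λ i → Eval T (recᶠ g h) (i ∷ map r xs) (r (1 + k)))
        (sym (trans (sym (guess-0 r i y)) (trans p (cong suc (guess-2 r i y)))))
        (ev-recS
          (loop-sound sg sh m (next r i y) (next-0 r i y) (next-xs r i y) (next-1 r i y)
            (lets-elim (suc m) ((0 , loop g h xs k) ∷ E) r i y w'))
          (sh lts' (m≤n+m (2 + k) 2) (suc m) _ (guess r i y)
            (cong₂ _∷_ (guess-2 r i y) (cong₂ _∷_ (guess-3 r i y) (guess-xs r i y))) (guess-1 r i y) w))

    loop-complete : Complete g → Complete h → ∀ r {i vs v} → r k ≡ i → map r xs ≡ vs → r (1 + k) ≡ v →
      Eval T (recᶠ g h) (i ∷ vs) v → Σ ℕ λ m → Win m ⊕ (label 0 (loop g h xs k)) E r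
    loop-complete cg ch r p q s (ev-rec0 d) =
      let m , w = cg lts₄ (m≤n+m (2 + k) 2) _ r q s d in m , inj₁ (p , w)
    loop-complete cg ch r p q s (ev-recS {k = i} {y} d d')
      with loop-complete cg ch (next r i y) (next-0 r i y) (trans (next-xs r i y) q) (next-1 r i y) d
         | ch lts' (m≤n+m (2 + k) 2) ((0 , loop g h xs k) ∷ E) (guess r i y)
             (cong₂ _∷_ (guess-2 r i y) (cong₂ _∷_ (guess-3 r i y) (trans (guess-xs r i y) q)))
             (trans (guess-1 r i y) s) d'
    ... | m , w | m' , w' = suc m ⊔ m' , inj₂ (i , y
      , trans (guess-0 r i y) (trans p (cong suc (sym (guess-2 r i y))))
      , Win-mono m' ⊕ (tr h _ (1 + k) (4 + k)) _ (guess r i y) (m≤n⊔m (suc m) m') w'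
      , let-intro (suc m ⊔ m') ((0 , loop g h xs k) ∷ E) (letᵇ (1 + k) (3 + k) (claim 0))
          (guess r i y) k (2 + k) (>⇒≢ (m≤n+m (1 + k) 1))
          (let-intro (suc m ⊔ m') ((0 , loop g h xs k) ∷ E) (claim 0)
            (guess r i y [ k ≔ guess r i y (2 + k) ]) (1 + k) (3 + k) (>⇒≢ (m≤n+m (2 + k) 1))
            (Win-mono (suc m) ⊕ (claim 0) ((0 , loop g h xs k) ∷ E) (next r i y) (m≤m⊔n (suc m) m') w)))

  mutual
    tr-sound : ∀ {n} (f : PR n) → Sound f
    tr-sound zeroᶠ lts lt m E r refl refl w = subst (Eval T zeroᶠ _) (sym w) ev-zero
    tr-sound succᶠ (_ ∷ []) lt m E r refl refl w = subst (Eval T succᶠ _) (sym w) ev-succ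
    tr-sound (projᶠ i) {xs} lts lt m E r refl refl w =
      subst (Eval T (projᶠ i) _) (trans (lookup-map i r xs) (sym w)) ev-proj
    tr-sound oracleᶠ {x ∷ []} (x<k ∷ []) lt m E r refl refl (inj₁ (p , w)) =
      subst (Eval T oracleᶠ _) (sym p)
        -- The query is known here, so its successor can serve as the bound.
        (ev-yes (Decides-sound (decides-truth x<k (suc (r x))) m r (n<1+n _) w))
    tr-sound oracleᶠ {x ∷ []} (x<k ∷ []) lt m E r refl refl (inj₂ (p , w)) =
      subst (Eval T oracleᶠ _) (sym p)
        (ev-no (Decides-sound (decides-¬ (decides-truth x<k (suc (r x)))) m r (n<1+n _) w))
    tr-sound (compᶠ {n} g hs) {xs} {o} {k} lts lt m E r refl refl w with ∃⋯-elim r k n w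
    ... | vs , ws , w' = ev-comp
      (trV-sound hs (All.map (λ l → ≤-trans l (m≤n+m k n)) lts) ≤-refl m E (r [ k ≔⋯ vs ])
        (map-updates-below r k vs lts) (map-updates-range r k vs) ws)
      (tr-sound g (range-< k n) (≤-trans lt (m≤n+m k n)) m E (r [ k ≔⋯ vs ])
        (map-updates-range r k vs) (updates-below r k vs lt) w')
    tr-sound (recᶠ g h) {x ∷ xs} {o} {k} (x<k ∷ lts) lt m E r refl refl w =
      Loop.loop-sound g h lts E (tr-sound g) (tr-sound h) m _
        (enter-0 r x o x<k) (enter-xs r x o lts) (enter-1 r x o lt)
        (let-elim m E (label 0 (loop g h xs k)) (r [ k ≔ r x ]) (1 + k) o (<⇒≢ (m<n⇒m<1+n lt))
          (let-elim m E (letᵇ (1 + k) o (label 0 (loop g h xs k))) r k x (<⇒≢ x<k) w))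
    tr-sound (μᶠ g) {xs} {o} {k} lts lt m E r refl refl ((a , p , w) , ws) = ev-μ
      (tr-sound g (m<n⇒m<1+n lt ∷ All.map m<n⇒m<1+n lts) (n<1+n k) m E (r [ k ≔ a ])
        (cong₂ _∷_ (update-below r a lt) (map-update r a lts ≤-refl)) p w)
      below
      where
      below : ∀ z → z < r o → Σ ℕ λ w → Eval T g (z ∷ map r xs) (suc w)
      below z z<y with ws z
      ... | inj₁ (d , e) = contradiction
              (≤-trans (m≤m+n (r o) d) (≤-reflexive (sym (≥-witness r lt z d e))))
              (<⇒≱ z<y)
      ... | inj₂ (b , b' , e , w) = b' , tr-sound g
              (m≤n+m (1 + k) 2 ∷ All.map (λ l → ≤-trans l (m≤n+m k 3)) lts) (m≤n+m (2 + k) 1) m E (μ-guess r k z b b')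
              (cong₂ _∷_ (μ-guess-0 r k z b b') (μ-guess-xs r k z b b' lts))
              (trans e (cong suc (update-same ((r [ k ≔ z ]) [ 1 + k ≔ b ]) (2 + k) b'))) w

    trV-sound : ∀ {n k} (hs : Vec (PR k) n) {xs o f} → All (_< f) xs → n + o ≤ f → ∀ m E r {vs ws} →
      map r xs ≡ vs → map r (range o n) ≡ ws → Win m ⊕ (trV hs xs o f) E r → EvalV T hs vs ws
    trV-sound [] lts le m E r refl refl w = evV-[]
    trV-sound {suc n} (h ∷ hs) {o = o} lts le m E r refl refl (w , ws) = evV-∷
      (tr-sound h lts (≤-trans (s≤s (m≤n+m o n)) le) m E r refl refl w)
      (trV-sound hs lts (≤-trans (≤-reflexive (+-suc n o)) le) m E r refl refl ws)

  mutual
    tr-complete : ∀ {n} (f : PR n) → Complete f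
    tr-complete zeroᶠ lts lt E r refl q ev-zero = 0 , q
    tr-complete succᶠ {_ ∷ []} lts lt E r refl q ev-succ = 0 , q
    tr-complete (projᶠ i) {xs} lts lt E r refl q ev-proj = 0 , trans q (lookup-map i r xs)
    tr-complete oracleᶠ {x ∷ []} (x<k ∷ []) lt E r refl q (ev-yes t) =
      clock d , inj₁ (q , win d r (n<1+n _) t)
      where d = decides-truth {E} x<k (suc (r x))
    tr-complete oracleᶠ {x ∷ []} (x<k ∷ []) lt E r refl q (ev-no ¬t) =
      clock d , inj₂ (q , win d r (n<1+n _) ¬t)
      where d = decides-¬ (decides-truth {E} x<k (suc (r x)))
    tr-complete (compᶠ {n} g hs) {xs} {o} {k} lts lt E r refl q (ev-comp {ys = vs} ds d)
      with trV-complete hs (All.map (λ l → ≤-trans l (m≤n+m k n)) lts) ≤-refl E (r [ k ≔⋯ vs ])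
             (map-updates-below r k vs lts) (map-updates-range r k vs) ds
         | tr-complete g (range-< k n) (≤-trans lt (m≤n+m k n)) E (r [ k ≔⋯ vs ])
             (map-updates-range r k vs) (trans (updates-below r k vs lt) q) d
    ... | m , w | m' , w' = m ⊔ m' , ∃⋯-intro r k vs
      ( Win-mono m ⊕ (trV hs xs k (n + k)) E _ (m≤m⊔n m m') w
      , Win-mono m' ⊕ (tr g (range k n) o (n + k)) E _ (m≤n⊔m m m') w')
    tr-complete (recᶠ g h) {x ∷ xs} {o} {k} (x<k ∷ lts) lt E r refl q d
      with Loop.loop-complete g h lts E (tr-complete g) (tr-complete h) _
             (enter-0 r x o x<k) (enter-xs r x o lts) (trans (enter-1 r x o lt) q) d
    ... | m , w = m , let-intro m E (letᵇ (1 + k) o (label 0 (loop g h xs k))) r k x (<⇒≢ x<k)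
          (let-intro m E (label 0 (loop g h xs k)) (r [ k ≔ r x ]) (1 + k) o (<⇒≢ (m<n⇒m<1+n lt)) w)
    tr-complete (μᶠ g) {xs} {o} {k} lts lt E r refl refl (ev-μ d below)
      with tr-complete g (m<n⇒m<1+n lt ∷ All.map m<n⇒m<1+n lts) (n<1+n k) E (r [ k ≔ 0 ])
             (cong₂ _∷_ (update-below r 0 lt) (map-update r 0 lts ≤-refl)) (update-same r k 0) d
         | common-clock (λ m z → Win m ⊕ (positiveᵇ g xs k) E (r [ k ≔ z ])) (λ le → Win-mono _ ⊕ (positiveᵇ g xs k) E _ le)
             (r o) (λ z z<y → step z (below z z<y))
      where
      step : ∀ z → (Σ ℕ λ w → Eval T g (z ∷ map r xs) (suc w)) → Σ ℕ λ m → Win m ⊕ (positiveᵇ g xs k) E (r [ k ≔ z ])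
      step z (w , d) with tr-complete g
              (m≤n+m (1 + k) 2 ∷ All.map (λ l → ≤-trans l (m≤n+m k 3)) lts) (m≤n+m (2 + k) 1) E (μ-guess r k z (suc w) w)
              (cong₂ _∷_ (μ-guess-0 r k z (suc w) w) (μ-guess-xs r k z (suc w) w lts))
              (μ-guess-1 r k z (suc w) w) d
      ... | m , win = m , suc w , w , trans (μ-guess-1 r k z (suc w) w) (cong suc (sym (update-same _ (2 + k) w))) , win
    ... | m , w | m' , ws = m ⊔ m' ,
      (0 , update-same r k 0 , Win-mono m ⊕ (tr g (o ∷ xs) k (1 + k)) E _ (m≤m⊔n m m') w) , all
      where
      all : ∀ z → Win (m ⊔ m') ⊕ (∃ᵇ (1 + k) (var k ≐ᵇ (var o +ᵗ var (1 + k))) ∨ᵇ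
          positiveᵇ g xs k) E (r [ k ≔ z ])
      all z with z <? r o
      ... | yes z<y = inj₂ (Win-mono m' ⊕ (positiveᵇ g xs k) E (r [ k ≔ z ]) (m≤n⊔m m m') (ws z z<y))
      ... | no z≮y = inj₁ (z ∸ r o , ≥-holds r lt z (≮⇒≥ z≮y))

    trV-complete : ∀ {n k} (hs : Vec (PR k) n) {xs o f} → All (_< f) xs → n + o ≤ f → ∀ E r {vs ws} →
      map r xs ≡ vs → map r (range o n) ≡ ws → EvalV T hs vs ws → Σ ℕ λ m → Win m ⊕ (trV hs xs o f) E r
    trV-complete [] lts le E r p q evV-[] = 0 , refl
    trV-complete {suc n} (h ∷ hs) {xs} {o} {f} lts le E r refl refl (evV-∷ d ds)
      with tr-complete h lts (≤-trans (s≤s (m≤n+m o n)) le) E r refl refl d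
         | trV-complete hs lts (≤-trans (≤-reflexive (+-suc n o)) le) E r refl refl ds
    ... | m , w | m' , w' = m ⊔ m'
      , Win-mono m ⊕ (tr h xs o f) E r (m≤m⊔n m m') w
      , Win-mono m' ⊕ (trV hs xs (suc o) f) E r (m≤n⊔m m m') w'

-- From oracle relations to defining formulas.

⊨ω⇒Win : ∀ {s φ} → s ⊨ω φ → Σ ℕ λ m → Win m ⊕ φ [] s
⊨ω⇒Win h = let m , _ , w = h 0 in m , w

Win⇒⊨ω : ∀ {s φ m} → Win m ⊕ φ [] s → s ⊨ω φ
Win⇒⊨ω {s} {φ} {m} w n = n ⊔ m , m≤m⊔n n m , Win-mono m ⊕ φ [] s (m≤n⊔m n m) w

vecAssign-toℕ : ∀ {k} (v : Vec ℕ k) i → vecAssign v (toℕ i) ≡ lookup v i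
vecAssign-toℕ {k} v i with toℕ i <? k
... | yes p = cong (lookup v) (fromℕ<-toℕ i p)
... | no ¬p = contradiction (toℕ<n i) ¬p

map-range : ∀ {n} r f (v : Vec ℕ n) → (∀ i → r (f + toℕ i) ≡ lookup v i) → map r (range f n) ≡ v
map-range r f [] h = refl
map-range r f (x ∷ v) h = cong₂ _∷_ (trans (cong r (sym (+-identityʳ f))) (h zero))
  (map-range r (suc f) v (λ i → trans (cong r (sym (+-suc f (toℕ i)))) (h (suc i))))

range-+ : ∀ f m n → range f (m + n) ≡ range f m ++ range (m + f) n
range-+ f zero n = refl
range-+ f (suc m) n = cong (f ∷_) (trans (range-+ (suc f) m n) (cong (λ g → range (suc f) m ++ range g n) (+-suc m f)))

boundᵗ : Tm → ℕ
boundᵗ (var x) = suc x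
boundᵗ zeroᵗ = 0
boundᵗ (sucᵗ t) = boundᵗ t
boundᵗ (t +ᵗ u) = boundᵗ t ⊔ boundᵗ u
boundᵗ (t *ᵗ u) = boundᵗ t ⊔ boundᵗ u

free<boundᵗ : ∀ {x} t → FreeTm x t → x < boundᵗ t
free<boundᵗ (var x) refl = n<1+n x
free<boundᵗ (sucᵗ t) f = free<boundᵗ t f
free<boundᵗ (t +ᵗ u) (inj₁ f) = ≤-trans (free<boundᵗ t f) (m≤m⊔n _ _)
free<boundᵗ (t +ᵗ u) (inj₂ f) = ≤-trans (free<boundᵗ u f) (m≤n⊔m _ _)
free<boundᵗ (t *ᵗ u) (inj₁ f) = ≤-trans (free<boundᵗ t f) (m≤m⊔n _ _)
free<boundᵗ (t *ᵗ u) (inj₂ f) = ≤-trans (free<boundᵗ u f) (m≤n⊔m _ _)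

boundᵇ : BFm → ℕ
boundᵇ (t ≐ᵇ u) = boundᵗ t ⊔ boundᵗ u
boundᵇ ⊥ᵇ = 0
boundᵇ (¬ᵇ F) = boundᵇ F
boundᵇ (F ∧ᵇ G) = boundᵇ F ⊔ boundᵇ G
boundᵇ (F ∨ᵇ G) = boundᵇ F ⊔ boundᵇ G
boundᵇ (∃ᵇ x F) = suc x ⊔ boundᵇ F
boundᵇ (∀ᵇ x F) = suc x ⊔ boundᵇ F
boundᵇ (claim L) = 0
boundᵇ (label L F) = boundᵇ F

free<boundᵇ : ∀ {x} F → FreeB x F → x < boundᵇ F
free<boundᵇ (t ≐ᵇ u) (inj₁ f) = ≤-trans (free<boundᵗ t f) (m≤m⊔n _ _)
free<boundᵇ (t ≐ᵇ u) (inj₂ f) = ≤-trans (free<boundᵗ u f) (m≤n⊔m _ _)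
free<boundᵇ (¬ᵇ F) f = free<boundᵇ F f
free<boundᵇ (F ∧ᵇ G) (inj₁ f) = ≤-trans (free<boundᵇ F f) (m≤m⊔n _ _)
free<boundᵇ (F ∧ᵇ G) (inj₂ f) = ≤-trans (free<boundᵇ G f) (m≤n⊔m _ _)
free<boundᵇ (F ∨ᵇ G) (inj₁ f) = ≤-trans (free<boundᵇ F f) (m≤m⊔n _ _)
free<boundᵇ (F ∨ᵇ G) (inj₂ f) = ≤-trans (free<boundᵇ G f) (m≤n⊔m _ _)
free<boundᵇ (∃ᵇ y F) (_ , f) = ≤-trans (free<boundᵇ F f) (m≤n⊔m (suc y) _)
free<boundᵇ (∀ᵇ y F) (_ , f) = ≤-trans (free<boundᵇ F f) (m≤n⊔m (suc y) _)
free<boundᵇ (label L F) f = free<boundᵇ F f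

∃⋯-free : ∀ {x} f n F → FreeB x (∃⋯ f n F) → FreeB x F × (x < f ⊎ n + f ≤ x)
∃⋯-free {x} f zero F free with x <? f
... | yes x<f = free , inj₁ x<f
... | no x≮f = free , inj₂ (≮⇒≥ x≮f)
∃⋯-free {x} f (suc n) F (x≢f , free) with ∃⋯-free (suc f) n F free
... | free' , inj₂ le = free' , inj₂ (≤-trans (≤-reflexive (sym (+-suc n f))) le)
... | free' , inj₁ (s≤s le) with m≤n⇒m<n∨m≡n le
...   | inj₁ x<f = free' , inj₁ x<f
...   | inj₂ x≡f = contradiction x≡f x≢f

module FromΣ (em : ExcludedMiddle 0ℓ) where
  open Translation em

  Σ⁰ω+1⇒definable : ∀ k (X : Vec ℕ k → Set) → Σ⁰ω+1 k X → BndSCL-definable k X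
  Σ⁰ω+1⇒definable k X (ℓ , R , (f , computes) , X⇔∃R) = φ , free<k , λ v → mk⇔ (to v) (from v)
    where
    n : ℕ
    n = ℓ + k

    xs : Vec ℕ (k + ℓ)
    xs = range 0 k ++ range k ℓ

    xs<n : All (_< n) xs
    xs<n = subst₂ (λ m ys → All (_< m) ys) (trans (+-identityʳ (k + ℓ)) (+-comm k ℓ))
      (trans (range-+ 0 k ℓ) (cong (λ m → range 0 k ++ range m ℓ) (+-identityʳ k))) (range-< 0 (k + ℓ))

    G : BFm
    G = (var n ≐ᵇ oneᵗ) ∧ᵇ tr f xs n (suc n)

    -- Besides the witnesses and the output n, all scratch variables are quantified.
    φ : BFm
    φ = ∃⋯ k ℓ (∃⋯ n (suc (boundᵇ G)) G)

    free<k : ∀ x → FreeB x φ → x < k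
    free<k x free with ∃⋯-free k ℓ (∃⋯ n (suc (boundᵇ G)) G) free
    ... | _ , inj₁ x<k = x<k
    ... | free' , inj₂ n≤x with ∃⋯-free n (suc (boundᵇ G)) G free'
    ...   | _ , inj₁ x<n = contradiction n≤x (<⇒≱ x<n)
    ...   | free'' , inj₂ le = contradiction (≤-trans (m≤m+n (boundᵇ G) n) (<⇒≤ le)) (<⇒≱ (free<boundᵇ G free''))

    xs-value : ∀ (v : Vec ℕ k) s → (∀ x → x < k → s x ≡ vecAssign v x) → map s xs ≡ v ++ map s (range k ℓ)
    xs-value v s agree = trans (map-++ s (range 0 k) (range k ℓ))
      (cong (_++ map s (range k ℓ)) (map-range s 0 v λ i → trans (agree (toℕ i) (toℕ<n i)) (vecAssign-toℕ v i)))

    -- Were `R v` false, the program would also have the value 0.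
    R-holds : ∀ v → Eval T f v 1 → R v
    R-holds v d with em {R v}
    ... | yes p = p
    ... | no ¬p with Eval-functional d (proj₂ (computes v) ¬p)
    ...   | ()

    to : ∀ v → X v → vecAssign v ⊨ω φ
    to v x with Equivalence.to (X⇔∃R v) x
    ... | y , p = Win⇒⊨ω {φ = φ} (∃⋯-intro (vecAssign v) k y
            -- The first entry is the output 1. The zeros for the scratch variables are arbitrary,
            -- as `tr-complete` holds for every assignment.
            (∃⋯-intro {F = G} s n (1 ∷ replicate (boundᵇ G) 0) (out , proj₂ wins)))
      where
      s s' : Assign
      s = vecAssign v [ k ≔⋯ y ]
      s' = s [ n ≔⋯ 1 ∷ replicate (boundᵇ G) 0 ]
      out : s' n ≡ 1
      out = trans (updates-below _ (suc n) (replicate (boundᵇ G) 0) (n<1+n n)) (update-same s n 1)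
      ys : map s' (range k ℓ) ≡ y
      ys = trans (map-updates-below s n (1 ∷ replicate (boundᵇ G) 0) (range-< k ℓ)) (map-updates-range (vecAssign v) k y)
      wins : Σ ℕ λ m → Win m ⊕ (tr f xs n (suc n)) [] s'
      wins = tr-complete f (All.map m<n⇒m<1+n xs<n) (n<1+n n) [] s'
        (trans (xs-value v s' λ x x<k →
            trans (updates-below s n (1 ∷ replicate (boundᵇ G) 0) (≤-trans x<k (m≤n+m k ℓ))) (updates-below _ k y x<k))
          (cong (v ++_) ys))
        out (proj₁ (computes (v ++ y)) p)

    from : ∀ v → vecAssign v ⊨ω φ → X v
    from v h with ⊨ω⇒Win {φ = φ} h
    ... | m , w with ∃⋯-elim (vecAssign v) k ℓ w
    ... | y , w' with ∃⋯-elim {F = G} (vecAssign v [ k ≔⋯ y ]) n (suc (boundᵇ G)) w'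
    ... | z , out , w'' = Equivalence.from (X⇔∃R v) (map s (range k ℓ) , R-holds _
            (tr-sound f (All.map m<n⇒m<1+n xs<n) (n<1+n n) m [] s
              (xs-value v s λ x x<k → trans (updates-below _ n z (≤-trans x<k (m≤n+m k ℓ))) (updates-below _ k y x<k))
              out w''))
      where
      s : Assign
      s = (vecAssign v [ k ≔⋯ y ]) [ n ≔⋯ z ]

-- Programs for total functions

module _ {O : ℕ → Set} where

  Computes : ∀ {n} → PR n → (Vec ℕ n → ℕ) → Set
  Computes f F = ∀ v → Eval O f v (F v)

  Computable : ∀ {n} → (Vec ℕ n → ℕ) → Set
  Computable {n} F = Σ (PR n) λ f → Computes f F

  c-const : ∀ {n} c → Computable {n} (λ _ → c)
  c-const zero = zeroᶠ , λ v → ev-zero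
  c-const (suc c) = let f , p = c-const c in
    compᶠ succᶠ (f ∷ []) , λ v → ev-comp (evV-∷ (p v) evV-[]) ev-succ

  c-proj : ∀ {n} (i : Fin n) → Computable (λ v → lookup v i)
  c-proj i = projᶠ i , λ v → ev-proj

  c-suc : ∀ {n} {F : Vec ℕ n → ℕ} → Computable F → Computable (λ v → suc (F v))
  c-suc (f , p) = compᶠ succᶠ (f ∷ []) , λ v → ev-comp (evV-∷ (p v) evV-[]) ev-succ

  c-app₁ : ∀ {n} {H : Vec ℕ 1 → ℕ} {F : Vec ℕ n → ℕ} → Computable H → Computable F →
    Computable (λ v → H (F v ∷ []))
  c-app₁ (h , q) (f , p) = compᶠ h (f ∷ []) , λ v → ev-comp (evV-∷ (p v) evV-[]) (q _)

  c-app₂ : ∀ {n} {H : Vec ℕ 2 → ℕ} {F G : Vec ℕ n → ℕ} → Computable H → Computable F → Computable G →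
    Computable (λ v → H (F v ∷ G v ∷ []))
  c-app₂ (h , q) (f , p) (g , p') = compᶠ h (f ∷ g ∷ []) ,
    λ v → ev-comp (evV-∷ (p v) (evV-∷ (p' v) evV-[])) (q _)

  -- The recursion equations are hypotheses, so that functions given elsewhere, such as codes of
  -- formulas, can be certified as they stand.
  c-rec : ∀ {n} {G : Vec ℕ n → ℕ} {H} (F : ℕ → Vec ℕ n → ℕ) →
    (∀ v → F 0 v ≡ G v) → (∀ k v → F (suc k) v ≡ H (k ∷ F k v ∷ v)) →
    Computable G → Computable H → Computable (λ v → F (head v) (tail v))
  c-rec F base step (g , p) (h , q) = recᶠ g h , λ { (k ∷ v) → evaluates k v }
    where
    evaluates : ∀ k v → Eval O (recᶠ g h) (k ∷ v) (F k v)
    evaluates zero v = ev-rec0 (subst (Eval O g v) (sym (base v)) (p v))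
    evaluates (suc k) v = ev-recS (evaluates k v) (subst (Eval O h _) (sym (step k v)) (q _))

  c-+ : ∀ {n} {F G : Vec ℕ n → ℕ} → Computable F → Computable G → Computable (λ v → F v + G v)
  c-+ = c-app₂ (c-rec {H = λ v → suc (lookup v (suc zero))} (λ k v → k + head v)
    (λ { (_ ∷ []) → refl }) (λ k v → refl) (c-proj zero) (c-suc (c-proj (suc zero))))

  -- By the doubling law this is a recursion on the exponent, with no program for powers.
  c-pair : ∀ {n} {F G : Vec ℕ n → ℕ} → Computable F → Computable G → Computable (λ v → ⟨ F v , G v ⟩)
  c-pair = c-app₂ (c-rec {G = λ v → lookup v zero + lookup v zero}
    {H = λ v → suc (lookup v (suc zero) + lookup v (suc zero))} (λ k v → ⟨ k , head v ⟩)
    (λ { (b ∷ []) → pair-zero b }) (λ { k (b ∷ []) → pair-suc k b })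
    (c-+ (c-proj zero) (c-proj zero)) (c-suc (c-+ (c-proj (suc zero)) (c-proj (suc zero)))))

  c-tag : ∀ {n} {F : Vec ℕ n → ℕ} t → Computable F → Computable (λ v → ⟨ t , F v ⟩)
  c-tag t = c-pair (c-const t)

  c-tag₂ : ∀ {n} {F G : Vec ℕ n → ℕ} t → Computable F → Computable G → Computable (λ v → ⟨ t , ⟨ F v , G v ⟩ ⟩)
  c-tag₂ t f g = c-tag t (c-pair f g)

num : ℕ → Tm
num zero = zeroᵗ
num (suc n) = sucᵗ (num n)

⟦num⟧ : ∀ n r → ⟦ num n ⟧ᵗ r ≡ n
⟦num⟧ zero r = refl
⟦num⟧ (suc n) r = cong suc (⟦num⟧ n r)

num-closed : ∀ n {x} → ¬ FreeTm x (num n)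
num-closed (suc n) = num-closed n

-- The game one step at a time

data Chooser : Set where
  Eloise Abelard : Chooser

Pos : Set
Pos = Sign × BFm × Env

-- Signs are absorbed here: a step depends only on who chooses and between what. A refuted falsum
-- becomes the true leaf 0 = 0.
data Node : Set where
  leaf   : Sign → Tm → Tm → Node
  dead   : Node
  move   : Pos → Node
  choose : Chooser → Pos → Pos → Node
  pick   : Chooser → ℕ → Pos → Node

view : Pos → Node
view (s , t ≐ᵇ u , E) = leaf s t u
view (⊕ , ⊥ᵇ , E) = dead
view (⊖ , ⊥ᵇ , E) = leaf ⊕ zeroᵗ zeroᵗ
view (⊕ , ¬ᵇ F , E) = move (⊖ , F , E)
view (⊖ , ¬ᵇ F , E) = move (⊕ , F , E)
view (⊕ , F ∧ᵇ G , E) = choose Abelard (⊕ , F , E) (⊕ , G , E)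
view (⊖ , F ∧ᵇ G , E) = choose Eloise (⊖ , F , E) (⊖ , G , E)
view (⊕ , F ∨ᵇ G , E) = choose Eloise (⊕ , F , E) (⊕ , G , E)
view (⊖ , F ∨ᵇ G , E) = choose Abelard (⊖ , F , E) (⊖ , G , E)
view (⊕ , ∃ᵇ x F , E) = pick Eloise x (⊕ , F , E)
view (⊖ , ∃ᵇ x F , E) = pick Abelard x (⊖ , F , E)
view (⊕ , ∀ᵇ x F , E) = pick Abelard x (⊕ , F , E)
view (⊖ , ∀ᵇ x F , E) = pick Eloise x (⊖ , F , E)
view (s , claim L , E) with refOf L E
... | nothing = dead
... | just (F , E') = move (s , label L F , E')
view (s , label L F , E) = move (s , F , (L , F) ∷ E)

literal : Sign → Tm → Tm → Form
literal ⊕ t u = t ≐ u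
literal ⊖ t u = ¬ᶠ (t ≐ u)

-- The budget counts all moves and not only claims. Hence a state contains no clock and all steps
-- have the same form.
Play : ℕ → Node → Assign → Set
Play n (leaf s t u) r = ⟦ literal s t u ⟧ᶠ r
Play n dead r = ⊥
Play zero (move p) r = ⊥
Play zero (choose c p q) r = ⊥
Play zero (pick c x p) r = ⊥
Play (suc n) (move p) r = Play n (view p) r
Play (suc n) (choose Eloise p q) r = Play n (view p) r ⊎ Play n (view q) r
Play (suc n) (choose Abelard p q) r = Play n (view p) r × Play n (view q) r
Play (suc n) (pick Eloise x p) r = Σ ℕ λ a → Play n (view p) (r [ x ≔ a ])
Play (suc n) (pick Abelard x p) r = (a : ℕ) → Play n (view p) (r [ x ≔ a ])

Play-mono : ∀ {n n'} N {r} → n ≤ n' → Play n N r → Play n' N r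
Play-mono (leaf s t u) le h = h
Play-mono {suc n} (move p) (s≤s le) h = Play-mono (view p) le h
Play-mono {suc n} (choose Eloise p q) (s≤s le) (inj₁ h) = inj₁ (Play-mono (view p) le h)
Play-mono {suc n} (choose Eloise p q) (s≤s le) (inj₂ h) = inj₂ (Play-mono (view q) le h)
Play-mono {suc n} (choose Abelard p q) (s≤s le) (h , h') = Play-mono (view p) le h , Play-mono (view q) le h'
Play-mono {suc n} (pick Eloise x p) (s≤s le) (a , h) = a , Play-mono (view p) le h
Play-mono {suc n} (pick Abelard x p) (s≤s le) h = λ a → Play-mono (view p) le (h a)

-- Bounds the length of a play with clock m whatever is chosen: between two claims a play only
-- descends in the formula.
rounds : ℕ → BFm → Env → ℕ
rounds m (t ≐ᵇ u) E = 0
rounds m ⊥ᵇ E = 0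
rounds m (¬ᵇ F) E = suc (rounds m F E)
rounds m (F ∧ᵇ G) E = suc (rounds m F E ⊔ rounds m G E)
rounds m (F ∨ᵇ G) E = suc (rounds m F E ⊔ rounds m G E)
rounds m (∃ᵇ x F) E = suc (rounds m F E)
rounds m (∀ᵇ x F) E = suc (rounds m F E)
rounds m (label L F) E = suc (rounds m F ((L , F) ∷ E))
rounds zero (claim L) E = 0
rounds (suc m) (claim L) E with refOf L E
... | nothing = 0
... | just (F , E') = suc (rounds m (label L F) E')

Win⇒Play : ∀ m s F E r → Win m s F E r → Play (rounds m F E) (view (s , F , E)) r
Win⇒Play m ⊕ (t ≐ᵇ u) E r w = w
Win⇒Play m ⊖ (t ≐ᵇ u) E r w = w
Win⇒Play m ⊖ ⊥ᵇ E r w = refl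
Win⇒Play m ⊕ (¬ᵇ F) E r w = Win⇒Play m ⊖ F E r w
Win⇒Play m ⊖ (¬ᵇ F) E r w = Win⇒Play m ⊕ F E r w
Win⇒Play m ⊕ (F ∧ᵇ G) E r (w , w') =
  Play-mono (view (⊕ , F , E)) (m≤m⊔n _ _) (Win⇒Play m ⊕ F E r w) ,
  Play-mono (view (⊕ , G , E)) (m≤n⊔m (rounds m F E) _) (Win⇒Play m ⊕ G E r w')
Win⇒Play m ⊖ (F ∧ᵇ G) E r (inj₁ w) =
  inj₁ (Play-mono (view (⊖ , F , E)) (m≤m⊔n _ _) (Win⇒Play m ⊖ F E r w))
Win⇒Play m ⊖ (F ∧ᵇ G) E r (inj₂ w) =
  inj₂ (Play-mono (view (⊖ , G , E)) (m≤n⊔m (rounds m F E) _) (Win⇒Play m ⊖ G E r w))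
Win⇒Play m ⊕ (F ∨ᵇ G) E r (inj₁ w) =
  inj₁ (Play-mono (view (⊕ , F , E)) (m≤m⊔n _ _) (Win⇒Play m ⊕ F E r w))
Win⇒Play m ⊕ (F ∨ᵇ G) E r (inj₂ w) =
  inj₂ (Play-mono (view (⊕ , G , E)) (m≤n⊔m (rounds m F E) _) (Win⇒Play m ⊕ G E r w))
Win⇒Play m ⊖ (F ∨ᵇ G) E r (w , w') =
  Play-mono (view (⊖ , F , E)) (m≤m⊔n _ _) (Win⇒Play m ⊖ F E r w) ,
  Play-mono (view (⊖ , G , E)) (m≤n⊔m (rounds m F E) _) (Win⇒Play m ⊖ G E r w')
Win⇒Play m ⊕ (∃ᵇ x F) E r (a , w) = a , Win⇒Play m ⊕ F E _ w
Win⇒Play m ⊖ (∃ᵇ x F) E r w = λ a → Win⇒Play m ⊖ F E _ (w a)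
Win⇒Play m ⊕ (∀ᵇ x F) E r w = λ a → Win⇒Play m ⊕ F E _ (w a)
Win⇒Play m ⊖ (∀ᵇ x F) E r (a , w) = a , Win⇒Play m ⊖ F E _ w
Win⇒Play m ⊕ (label L F) E r w = Win⇒Play m ⊕ F _ r w
Win⇒Play m ⊖ (label L F) E r w = Win⇒Play m ⊖ F _ r w
Win⇒Play zero ⊕ (claim L) E r ()
Win⇒Play zero ⊖ (claim L) E r ()
Win⇒Play (suc m) ⊕ (claim L) E r w with refOf L E
... | just (F , E') = Win⇒Play m ⊕ (label L F) E' r w
Win⇒Play (suc m) ⊖ (claim L) E r w with refOf L E
... | just (F , E') = Win⇒Play m ⊖ (label L F) E' r w

-- Among n moves there are at most n claims, so n is enough as a clock.
Play⇒Win : ∀ n s F E r → Play n (view (s , F , E)) r → Win n s F E r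
Play⇒Win n ⊕ (t ≐ᵇ u) E r h = h
Play⇒Win n ⊖ (t ≐ᵇ u) E r h = h
Play⇒Win n ⊖ ⊥ᵇ E r h = tt
Play⇒Win (suc n) ⊕ (¬ᵇ F) E r h = Win-mono n ⊖ F E r (m≤n+m n 1) (Play⇒Win n ⊖ F E r h)
Play⇒Win (suc n) ⊖ (¬ᵇ F) E r h = Win-mono n ⊕ F E r (m≤n+m n 1) (Play⇒Win n ⊕ F E r h)
Play⇒Win (suc n) ⊕ (F ∧ᵇ G) E r (h , h') =
  Win-mono n ⊕ F E r (m≤n+m n 1) (Play⇒Win n ⊕ F E r h) , Win-mono n ⊕ G E r (m≤n+m n 1) (Play⇒Win n ⊕ G E r h')
Play⇒Win (suc n) ⊖ (F ∧ᵇ G) E r (inj₁ h) = inj₁ (Win-mono n ⊖ F E r (m≤n+m n 1) (Play⇒Win n ⊖ F E r h))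
Play⇒Win (suc n) ⊖ (F ∧ᵇ G) E r (inj₂ h) = inj₂ (Win-mono n ⊖ G E r (m≤n+m n 1) (Play⇒Win n ⊖ G E r h))
Play⇒Win (suc n) ⊕ (F ∨ᵇ G) E r (inj₁ h) = inj₁ (Win-mono n ⊕ F E r (m≤n+m n 1) (Play⇒Win n ⊕ F E r h))
Play⇒Win (suc n) ⊕ (F ∨ᵇ G) E r (inj₂ h) = inj₂ (Win-mono n ⊕ G E r (m≤n+m n 1) (Play⇒Win n ⊕ G E r h))
Play⇒Win (suc n) ⊖ (F ∨ᵇ G) E r (h , h') =
  Win-mono n ⊖ F E r (m≤n+m n 1) (Play⇒Win n ⊖ F E r h) , Win-mono n ⊖ G E r (m≤n+m n 1) (Play⇒Win n ⊖ G E r h')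
Play⇒Win (suc n) ⊕ (∃ᵇ x F) E r (a , h) = a , Win-mono n ⊕ F E _ (m≤n+m n 1) (Play⇒Win n ⊕ F E _ h)
Play⇒Win (suc n) ⊖ (∃ᵇ x F) E r h = λ a → Win-mono n ⊖ F E _ (m≤n+m n 1) (Play⇒Win n ⊖ F E _ (h a))
Play⇒Win (suc n) ⊕ (∀ᵇ x F) E r h = λ a → Win-mono n ⊕ F E _ (m≤n+m n 1) (Play⇒Win n ⊕ F E _ (h a))
Play⇒Win (suc n) ⊖ (∀ᵇ x F) E r (a , h) = a , Win-mono n ⊖ F E _ (m≤n+m n 1) (Play⇒Win n ⊖ F E _ h)
Play⇒Win (suc n) ⊕ (label L F) E r h = Win-mono n ⊕ F _ r (m≤n+m n 1) (Play⇒Win n ⊕ F _ r h)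
Play⇒Win (suc n) ⊖ (label L F) E r h = Win-mono n ⊖ F _ r (m≤n+m n 1) (Play⇒Win n ⊖ F _ r h)
Play⇒Win zero ⊕ (claim L) E r h with refOf L E
Play⇒Win zero ⊕ (claim L) E r () | nothing
Play⇒Win zero ⊕ (claim L) E r () | just _
Play⇒Win zero ⊖ (claim L) E r h with refOf L E
Play⇒Win zero ⊖ (claim L) E r () | nothing
Play⇒Win zero ⊖ (claim L) E r () | just _
Play⇒Win (suc n) ⊕ (claim L) E r h with refOf L E
... | just (F , E') = Play⇒Win n ⊕ (label L F) E' r h
Play⇒Win (suc n) ⊖ (claim L) E r h with refOf L E
... | just (F , E') = Play⇒Win n ⊖ (label L F) E' r h

-- The prenex sentence of an n-step play

⟦⟧ᵗ-cong : ∀ t {r r'} → (∀ x → FreeTm x t → r x ≡ r' x) → ⟦ t ⟧ᵗ r ≡ ⟦ t ⟧ᵗ r'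
⟦⟧ᵗ-cong (var x) h = h x refl
⟦⟧ᵗ-cong zeroᵗ h = refl
⟦⟧ᵗ-cong (sucᵗ t) h = cong suc (⟦⟧ᵗ-cong t h)
⟦⟧ᵗ-cong (t +ᵗ u) h = cong₂ _+_ (⟦⟧ᵗ-cong t (λ x → h x ∘ inj₁)) (⟦⟧ᵗ-cong u (λ x → h x ∘ inj₂))
⟦⟧ᵗ-cong (t *ᵗ u) h = cong₂ _*_ (⟦⟧ᵗ-cong t (λ x → h x ∘ inj₁)) (⟦⟧ᵗ-cong u (λ x → h x ∘ inj₂))

update-agree : ∀ {φ r r' x a} → (∀ y → y ≢ x × FreeF y φ → r y ≡ r' y) →
  ∀ y → FreeF y φ → (r [ x ≔ a ]) y ≡ (r' [ x ≔ a ]) y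
update-agree {x = x} h y f with y ≟ x
... | yes _ = refl
... | no y≢x = h y (y≢x , f)

⟦⟧ᶠ-cong : ∀ φ {r r'} → (∀ x → FreeF x φ → r x ≡ r' x) → ⟦ φ ⟧ᶠ r → ⟦ φ ⟧ᶠ r'
⟦⟧ᶠ-cong (t ≐ u) h p =
  trans (sym (⟦⟧ᵗ-cong t (λ x → h x ∘ inj₁))) (trans p (⟦⟧ᵗ-cong u (λ x → h x ∘ inj₂)))
⟦⟧ᶠ-cong (¬ᶠ φ) h p q = p (⟦⟧ᶠ-cong φ (λ x f → sym (h x f)) q)
⟦⟧ᶠ-cong (φ ∧ᶠ ψ) h (p , q) = ⟦⟧ᶠ-cong φ (λ x → h x ∘ inj₁) p , ⟦⟧ᶠ-cong ψ (λ x → h x ∘ inj₂) q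
⟦⟧ᶠ-cong (φ ∨ᶠ ψ) h (inj₁ p) = inj₁ (⟦⟧ᶠ-cong φ (λ x → h x ∘ inj₁) p)
⟦⟧ᶠ-cong (φ ∨ᶠ ψ) h (inj₂ p) = inj₂ (⟦⟧ᶠ-cong ψ (λ x → h x ∘ inj₂) p)
⟦⟧ᶠ-cong (∃ᶠ x φ) h (a , p) = a , ⟦⟧ᶠ-cong φ (update-agree {φ} h) p
⟦⟧ᶠ-cong (∀ᶠ x φ) h p a = ⟦⟧ᶠ-cong φ (update-agree {φ} h) (p a)

update-fresh : ∀ φ {x} r a → ¬ FreeF x φ → ⟦ φ ⟧ᶠ r → ⟦ φ ⟧ᶠ (r [ x ≔ a ])
update-fresh φ r a fresh = ⟦⟧ᶠ-cong φ λ y f → sym (update-other r a λ { refl → fresh f })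

fresh-update : ∀ φ {x} r a → ¬ FreeF x φ → ⟦ φ ⟧ᶠ (r [ x ≔ a ]) → ⟦ φ ⟧ᶠ r
fresh-update φ r a fresh = ⟦⟧ᶠ-cong φ λ y f → update-other r a λ { refl → fresh f }

-- The finite list of positions and its closure under moves.

positions : BFm → Env → List Pos
subpositions : BFm → Env → List Pos
positions F E = (⊕ , F , E) ∷ (⊖ , F , E) ∷ subpositions F E
subpositions (t ≐ᵇ u) E = []
subpositions ⊥ᵇ E = []
subpositions (¬ᵇ F) E = positions F E
subpositions (F ∧ᵇ G) E = positions F E ++ᴸ positions G E
subpositions (F ∨ᵇ G) E = positions F E ++ᴸ positions G E
subpositions (∃ᵇ x F) E = positions F E
subpositions (∀ᵇ x F) E = positions F E
subpositions (claim L) E = []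
subpositions (label L F) E = positions F ((L , F) ∷ E)

Successors : (Pos → Set) → Node → Set
Successors S (leaf s t u) = ⊤
Successors S dead = ⊤
Successors S (move p) = S p
Successors S (choose c p q) = S p × S q
Successors S (pick c x p) = S p

-- A claim leads to a labelled occurrence on the stack, taken with the labels above it, so the
-- condition runs over all suffixes of the stack.
References : (Pos → Set) → Env → Set
References S [] = ⊤
References S ((L , F) ∷ E) = (∀ s → S (s , label L F , E)) × References S E

claim-successor : ∀ S s L E → References S E → Successors S (view (s , claim L , E))
claim-successor S s L [] refs = tt
claim-successor S s L ((L' , F) ∷ E) (ref , refs) with L ≟ L'
... | yes refl = ref s
... | no _ = claim-successor S s L E refs

root : ∀ {S : Pos → Set} F E → Allᴸ S (positions F E) → ∀ s → S (s , F , E)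
root F E (p ∷ q ∷ _) ⊕ = p
root F E (p ∷ q ∷ _) ⊖ = q

-- S stays arbitrary because the recursion descends into a part of the list while claims may lead
-- outside that part.
positions-closed : ∀ (S : Pos → Set) F E → Allᴸ S (positions F E) → References S E →
  Allᴸ (Successors S ∘ view) (positions F E)
positions-closed S (t ≐ᵇ u) E all refs = tt ∷ tt ∷ []
positions-closed S ⊥ᵇ E all refs = tt ∷ tt ∷ []
positions-closed S (¬ᵇ F) E (_ ∷ _ ∷ all) refs =
  root F E all ⊖ ∷ root F E all ⊕ ∷ positions-closed S F E all refs
positions-closed S (F ∧ᵇ G) E (_ ∷ _ ∷ all) refs =
  (root F E l ⊕ , root G E r ⊕) ∷ (root F E l ⊖ , root G E r ⊖) ∷
  ++⁺ (positions-closed S F E l refs) (positions-closed S G E r refs)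
  where l = ++⁻ˡ (positions F E) all ; r = ++⁻ʳ (positions F E) all
positions-closed S (F ∨ᵇ G) E (_ ∷ _ ∷ all) refs =
  (root F E l ⊕ , root G E r ⊕) ∷ (root F E l ⊖ , root G E r ⊖) ∷
  ++⁺ (positions-closed S F E l refs) (positions-closed S G E r refs)
  where l = ++⁻ˡ (positions F E) all ; r = ++⁻ʳ (positions F E) all
positions-closed S (∃ᵇ x F) E (_ ∷ _ ∷ all) refs =
  root F E all ⊕ ∷ root F E all ⊖ ∷ positions-closed S F E all refs
positions-closed S (∀ᵇ x F) E (_ ∷ _ ∷ all) refs =
  root F E all ⊕ ∷ root F E all ⊖ ∷ positions-closed S F E all refs
positions-closed S (claim L) E all refs = claim-successor S ⊕ L E refs ∷ claim-successor S ⊖ L E refs ∷ []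
positions-closed S (label L F) E (p ∷ q ∷ all) refs =
  root F _ all ⊕ ∷ root F _ all ⊖ ∷ positions-closed S F _ all ((λ { ⊕ → p ; ⊖ → q }) , refs)

LeafBound : ℕ → Node → Set
LeafBound K (leaf s t u) = boundᵗ t ≤ K × boundᵗ u ≤ K
LeafBound K _ = ⊤

claim-bound : ∀ K s L E → LeafBound K (view (s , claim L , E))
claim-bound K s L E with refOf L E
... | nothing = tt
... | just _ = tt

positions-bounded : ∀ K F E → boundᵇ F ≤ K → Allᴸ (LeafBound K ∘ view) (positions F E)
positions-bounded K (t ≐ᵇ u) E le = both ∷ both ∷ []
  where both = ≤-trans (m≤m⊔n _ (boundᵗ u)) le , ≤-trans (m≤n⊔m (boundᵗ t) _) le
positions-bounded K ⊥ᵇ E le = tt ∷ (z≤n , z≤n) ∷ []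
positions-bounded K (¬ᵇ F) E le = tt ∷ tt ∷ positions-bounded K F E le
positions-bounded K (F ∧ᵇ G) E le = tt ∷ tt ∷
  ++⁺ (positions-bounded K F E (≤-trans (m≤m⊔n _ (boundᵇ G)) le)) (positions-bounded K G E (≤-trans (m≤n⊔m (boundᵇ F) _) le))
positions-bounded K (F ∨ᵇ G) E le = tt ∷ tt ∷
  ++⁺ (positions-bounded K F E (≤-trans (m≤m⊔n _ (boundᵇ G)) le)) (positions-bounded K G E (≤-trans (m≤n⊔m (boundᵇ F) _) le))
positions-bounded K (∃ᵇ x F) E le = tt ∷ tt ∷ positions-bounded K F E (≤-trans (m≤n⊔m (suc x) _) le)
positions-bounded K (∀ᵇ x F) E le = tt ∷ tt ∷ positions-bounded K F E (≤-trans (m≤n⊔m (suc x) _) le)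
positions-bounded K (claim L) E le = claim-bound K ⊕ L E ∷ claim-bound K ⊖ L E ∷ []
positions-bounded K (label L F) E le = tt ∷ tt ∷ positions-bounded K F _ le

module Indexing (em : ExcludedMiddle 0ℓ) {A : Set} where

  -- Equality is decided classically. This is harmless because the indices enter sentences and
  -- programs only as finitely many constants.
  index : List A → A → ℕ
  index [] p = 0
  index (q ∷ S) p with em {p ≡ q}
  ... | yes _ = 0
  ... | no _ = suc (index S p)

  index-injective : ∀ S {p q} → p ∈ S → index S p ≡ index S q → p ≡ q
  index-injective (s ∷ S) {p} {q} p∈ eq with em {p ≡ s} | em {q ≡ s}
  ... | yes p≡s | yes q≡s = trans p≡s (sym q≡s)
  index-injective (s ∷ S) (here p≡s) eq | no p≢s | no _ = contradiction p≡s p≢s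
  index-injective (s ∷ S) (there p∈) eq | no _ | no _ = index-injective S p∈ (suc-injective eq)

-- Quantifier blocks, one per level.

pair-≢₁ : ∀ a b c d → a ≢ c → ⟨ a , b ⟩ ≢ ⟨ c , d ⟩
pair-≢₁ a b c d a≢c p = a≢c (proj₁ (pair-injective a b c d p))

pair-≢₂ : ∀ a b c d → b ≢ d → ⟨ a , b ⟩ ≢ ⟨ c , d ⟩
pair-≢₂ a b c d b≢d p = b≢d (proj₂ (pair-injective a b c d p))

-- Variables of level j: the position, the two players' choices, the values.
posⱽ : ℕ → ℕ
posⱽ j = ⟨ 0 , j ⟩

choiceⱽ : Chooser → ℕ → ℕ
choiceⱽ Eloise j = ⟨ 1 , j ⟩
choiceⱽ Abelard j = ⟨ 2 , j ⟩

valueⱽ : ℕ → ℕ → ℕ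
valueⱽ y j = ⟨ 3 + y , j ⟩

SameExcept : ℕ → Assign → Assign → Set
SameExcept j r r' = ∀ c i → i ≢ j → r' ⟨ c , i ⟩ ≡ r ⟨ c , i ⟩

quantify : ℕ → List (Chooser × ℕ) → Form → Form
quantify j [] φ = φ
quantify j ((Eloise , c) ∷ cs) φ = ∃ᶠ ⟨ c , j ⟩ (quantify j cs φ)
quantify j ((Abelard , c) ∷ cs) φ = ∀ᶠ ⟨ c , j ⟩ (quantify j cs φ)

quantify-map : ∀ {φ ψ} j cs → (∀ r → ⟦ φ ⟧ᶠ r → ⟦ ψ ⟧ᶠ r) → ∀ r → ⟦ quantify j cs φ ⟧ᶠ r → ⟦ quantify j cs ψ ⟧ᶠ r
quantify-map j [] h r p = h r p
quantify-map j ((Eloise , c) ∷ cs) h r (a , p) = a , quantify-map j cs h _ p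
quantify-map j ((Abelard , c) ∷ cs) h r p a = quantify-map j cs h _ (p a)

-- A conjunct without variables of the block may leave it. Under a universal quantifier it is read
-- off at 0, where any number would do.
quantify-push : ∀ {φ ψ} j cs → (∀ c → ¬ FreeF ⟨ c , j ⟩ φ) → ∀ r →
  ⟦ quantify j cs (φ ∧ᶠ ψ) ⟧ᶠ r → ⟦ φ ⟧ᶠ r × ⟦ quantify j cs ψ ⟧ᶠ r
quantify-push j [] fresh r p = p
quantify-push {φ} {ψ} j ((Eloise , c) ∷ cs) fresh r (a , p) =
  let q , q' = quantify-push {φ} {ψ} j cs fresh _ p in fresh-update φ r a (fresh c) q , a , q'
quantify-push {φ} {ψ} j ((Abelard , c) ∷ cs) fresh r p =
  fresh-update φ r 0 (fresh c) (proj₁ (quantify-push {φ} {ψ} j cs fresh _ (p 0))) ,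
  λ a → proj₂ (quantify-push {φ} {ψ} j cs fresh _ (p a))

quantify-pull : ∀ {φ ψ} j cs → (∀ c → ¬ FreeF ⟨ c , j ⟩ φ) → ∀ r →
  ⟦ φ ⟧ᶠ r → ⟦ quantify j cs ψ ⟧ᶠ r → ⟦ quantify j cs (φ ∧ᶠ ψ) ⟧ᶠ r
quantify-pull j [] fresh r p q = p , q
quantify-pull {φ} {ψ} j ((Eloise , c) ∷ cs) fresh r p (a , q) =
  a , quantify-pull {φ} {ψ} j cs fresh _ (update-fresh φ r a (fresh c) p) q
quantify-pull {φ} {ψ} j ((Abelard , c) ∷ cs) fresh r p q a =
  quantify-pull {φ} {ψ} j cs fresh _ (update-fresh φ r a (fresh c) p) (q a)

quantify-prenex : ∀ {φ} j cs → Prenex φ → Prenex (quantify j cs φ)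
quantify-prenex j [] p = p
quantify-prenex j ((Eloise , c) ∷ cs) p = pre∃ (quantify-prenex j cs p)
quantify-prenex j ((Abelard , c) ∷ cs) p = pre∀ (quantify-prenex j cs p)

quantify-free : ∀ {x φ} j cs → FreeF x (quantify j cs φ) →
  FreeF x φ × Allᴸ (λ (_ , c) → x ≢ ⟨ c , j ⟩) cs
quantify-free j [] f = f , []
quantify-free j ((Eloise , c) ∷ cs) (x≢ , f) = let f' , all = quantify-free j cs f in f' , x≢ ∷ all
quantify-free j ((Abelard , c) ∷ cs) (x≢ , f) = let f' , all = quantify-free j cs f in f' , x≢ ∷ all

values : ℕ → List (Chooser × ℕ)
values zero = []
values (suc y) = (Eloise , 3 + y) ∷ values y

-- At each node at most one of the two choices is consulted, so this fixed order suits the moves of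
-- both players.
components : ℕ → List (Chooser × ℕ)
components K = (Eloise , 1) ∷ (Abelard , 2) ∷ (Eloise , 0) ∷ values K

values-∈ : ∀ K {y} → y < K → (Eloise , 3 + y) ∈ values K
values-∈ (suc K) (s≤s le) with m≤n⇒m<n∨m≡n le
... | inj₁ lt = there (values-∈ K lt)
... | inj₂ refl = here refl

components-∈ : ∀ K {c} → c < 3 + K → Σ Chooser λ q → (q , c) ∈ components K
components-∈ K {0} lt = Eloise , there (there (here refl))
components-∈ K {1} lt = Eloise , here refl
components-∈ K {2} lt = Abelard , there (here refl)
components-∈ K {suc (suc (suc y))} (s≤s (s≤s (s≤s lt))) = Eloise , there (there (there (values-∈ K lt)))

setValues : ℕ → ℕ → Assign → Assign → Assign
setValues j zero ρ r = r
setValues j (suc y) ρ r = setValues j y ρ (r [ valueⱽ y j ≔ ρ y ])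

values-intro : ∀ {φ} j n ρ r → ⟦ φ ⟧ᶠ (setValues j n ρ r) → ⟦ quantify j (values n) φ ⟧ᶠ r
values-intro j zero ρ r p = p
values-intro j (suc y) ρ r p = ρ y , values-intro j y ρ _ p

setValues-other : ∀ j n ρ r z → (∀ y → z ≢ valueⱽ y j) → setValues j n ρ r z ≡ r z
setValues-other j zero ρ r z h = refl
setValues-other j (suc y) ρ r z h = trans (setValues-other j y ρ _ z h) (update-other r _ (h y))

setValues-above : ∀ j n ρ r y → n ≤ y → setValues j n ρ r (valueⱽ y j) ≡ r (valueⱽ y j)
setValues-above j zero ρ r y le = refl
setValues-above j (suc n) ρ r y le = trans (setValues-above j n ρ _ y (<⇒≤ le))
  (update-other r _ (pair-≢₁ (3 + y) j (3 + n) j λ p → >⇒≢ le (+-cancelˡ-≡ 3 y n p)))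

setValues-below : ∀ j n ρ r y → y < n → setValues j n ρ r (valueⱽ y j) ≡ ρ y
setValues-below j (suc n) ρ r y (s≤s le) with m≤n⇒m<n∨m≡n le
... | inj₁ lt = setValues-below j n ρ _ y lt
... | inj₂ refl = trans (setValues-above j n ρ _ y ≤-refl) (update-same r (valueⱽ y j) (ρ y))

values-elim : ∀ {φ} j n r → ⟦ quantify j (values n) φ ⟧ᶠ r →
  Σ Assign λ r' → ⟦ φ ⟧ᶠ r' × (∀ z → (∀ y → z ≢ valueⱽ y j) → r' z ≡ r z)
values-elim j zero r p = r , p , λ _ _ → refl
values-elim j (suc n) r (a , p) = let r' , p' , same = values-elim j n _ p in
  r' , p' , λ z h → trans (same z h) (update-other r a (h n))

by : ℕ → ℕ → Chooser → ℕ
by a b Eloise = a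
by a b Abelard = b

base : ℕ → Assign → ℕ → ℕ → ℕ → Assign
base j r a b q = ((r [ ⟨ 1 , j ⟩ ≔ a ]) [ ⟨ 2 , j ⟩ ≔ b ]) [ ⟨ 0 , j ⟩ ≔ q ]

base-choice : ∀ j r a b q c → base j r a b q (choiceⱽ c j) ≡ by a b c
base-choice j r a b q Eloise =
  trans (update-other ((r [ ⟨ 1 , j ⟩ ≔ a ]) [ ⟨ 2 , j ⟩ ≔ b ]) q (pair-≢₁ 1 j 0 j λ ()))
    (trans (update-other (r [ ⟨ 1 , j ⟩ ≔ a ]) b (pair-≢₁ 1 j 2 j λ ())) (update-same r ⟨ 1 , j ⟩ a))
base-choice j r a b q Abelard =
  trans (update-other ((r [ ⟨ 1 , j ⟩ ≔ a ]) [ ⟨ 2 , j ⟩ ≔ b ]) q (pair-≢₁ 2 j 0 j λ ()))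
    (update-same (r [ ⟨ 1 , j ⟩ ≔ a ]) ⟨ 2 , j ⟩ b)

base-frame : ∀ j r a b q → SameExcept j r (base j r a b q)
base-frame j r a b q c i i≢j =
  trans (update-other ((r [ ⟨ 1 , j ⟩ ≔ a ]) [ ⟨ 2 , j ⟩ ≔ b ]) q (pair-≢₂ c i 0 j i≢j))
    (trans (update-other (r [ ⟨ 1 , j ⟩ ≔ a ]) b (pair-≢₂ c i 2 j i≢j)) (update-other r a (pair-≢₂ c i 1 j i≢j)))

choice≢value : ∀ c j y → choiceⱽ c j ≢ valueⱽ y j
choice≢value Eloise j y = pair-≢₁ 1 j (3 + y) j λ ()
choice≢value Abelard j y = pair-≢₁ 2 j (3 + y) j λ ()

block : ℕ → ℕ → Assign → ℕ → ℕ → ℕ → Assign → Assign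
block K j r a b q ρ = setValues j K ρ (base j r a b q)

block-elim : ∀ {φ} K j r → ⟦ quantify j (components K) φ ⟧ᶠ r →
  Σ ℕ λ a → ∀ b → Σ Assign λ r' → ⟦ φ ⟧ᶠ r' × (∀ c → r' (choiceⱽ c j) ≡ by a b c) × SameExcept j r r'
block-elim {φ} K j r (a , p) = a , λ b →
  let q , p' = p b ; r' , p'' , same = values-elim {φ} j K (base j r a b q) p' in
  r' , p'' ,
  (λ c → trans (same (choiceⱽ c j) (choice≢value c j)) (base-choice j r a b q c)) ,
  λ c i i≢j → trans (same ⟨ c , i ⟩ λ y → pair-≢₂ c i (3 + y) j i≢j) (base-frame j r a b q c i i≢j)

block-intro : ∀ {φ} K j r a → (∀ b → Σ ℕ λ q → Σ Assign λ ρ → ⟦ φ ⟧ᶠ (block K j r a b q ρ)) →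
  ⟦ quantify j (components K) φ ⟧ᶠ r
block-intro {φ} K j r a h = a , λ b → let q , ρ , p = h b in q , values-intro {φ} j K ρ (base j r a b q) p

block-choice : ∀ K j r a b q ρ c → block K j r a b q ρ (choiceⱽ c j) ≡ by a b c
block-choice K j r a b q ρ c =
  trans (setValues-other j K ρ (base j r a b q) (choiceⱽ c j) (choice≢value c j)) (base-choice j r a b q c)

block-pos : ∀ K j r a b q ρ → block K j r a b q ρ (posⱽ j) ≡ q
block-pos K j r a b q ρ =
  trans (setValues-other j K ρ (base j r a b q) (posⱽ j) λ y → pair-≢₁ 0 j (3 + y) j λ ())
    (update-same ((r [ ⟨ 1 , j ⟩ ≔ a ]) [ ⟨ 2 , j ⟩ ≔ b ]) ⟨ 0 , j ⟩ q)

block-value : ∀ K j r a b q ρ y → y < K → block K j r a b q ρ (valueⱽ y j) ≡ ρ y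
block-value K j r a b q ρ y = setValues-below j K ρ (base j r a b q) y

block-frame : ∀ K j r a b q ρ → SameExcept j r (block K j r a b q ρ)
block-frame K j r a b q ρ c i i≢j =
  trans (setValues-other j K ρ (base j r a b q) ⟨ c , i ⟩ λ y → pair-≢₂ c i (3 + y) j i≢j)
    (base-frame j r a b q c i i≢j)

-- A step as a function of both choices.

Alive : Node → Set
Alive dead = ⊥
Alive _ = ⊤

select : {A : Set} → ℕ → A → A → A
select zero p q = p
select (suc _) p q = q

-- A leaf is its own successor, so a play that is decided early idles through the remaining blocks.
-- The value at a dead node is a default, excluded by `Alive`.
target : Pos → Node → (Chooser → ℕ) → Pos
target p (leaf s t u) ch = p
target p dead ch = p
target p (move q) ch = q
target p (choose c q q') ch = select (ch c) q q'
target p (pick c x q) ch = q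

revalue : Node → Assign → (Chooser → ℕ) → Assign
revalue (pick c x q) ρ ch = ρ [ x ≔ ch c ]
revalue _ ρ ch = ρ

target-cong : ∀ p N {ch ch'} → (∀ c → ch c ≡ ch' c) → target p N ch ≡ target p N ch'
target-cong p (leaf s t u) h = refl
target-cong p dead h = refl
target-cong p (move q) h = refl
target-cong p (choose c q q') h = cong (λ a → select a q q') (h c)
target-cong p (pick c x q) h = refl

revalue-cong : ∀ N ρ {ch ch'} → (∀ c → ch c ≡ ch' c) → revalue N ρ ch ≡ revalue N ρ ch'
revalue-cong (leaf s t u) ρ h = refl
revalue-cong dead ρ h = refl
revalue-cong (move q) ρ h = refl
revalue-cong (choose c q q') ρ h = refl
revalue-cong (pick c x q) ρ h = cong (ρ [ x ≔_]) (h c)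

target-∈ : ∀ {S : Pos → Set} {p} N ch → S p → Successors S N → S (target p N ch)
target-∈ (leaf s t u) ch s∈ succ = s∈
target-∈ dead ch s∈ succ = s∈
target-∈ (move q) ch s∈ succ = succ
target-∈ (choose c q q') ch s∈ (q∈ , q'∈) with ch c
... | zero = q∈
... | suc _ = q'∈
target-∈ (pick c x q) ch s∈ succ = succ

-- Eloise's number is fixed before Abelard's; where she has no choice it is 0. The equation for
-- `view p` lets a leaf return to its own position p.
Play-next : ∀ n p N ρ → view p ≡ N → Play (suc n) N ρ →
  Alive N × Σ ℕ λ a → ∀ b → Play n (view (target p N (by a b))) (revalue N ρ (by a b))
Play-next n p (leaf s t u) ρ eq h = tt , 0 , λ b → subst (λ N → Play n N ρ) (sym eq) h
Play-next n p (move q) ρ eq h = tt , 0 , λ b → h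
Play-next n p (choose Eloise q q') ρ eq (inj₁ h) = tt , 0 , λ b → h
Play-next n p (choose Eloise q q') ρ eq (inj₂ h) = tt , 1 , λ b → h
Play-next n p (choose Abelard q q') ρ eq (h , h') = tt , 0 , λ { zero → h ; (suc _) → h' }
Play-next n p (pick Eloise x q) ρ eq (a , h) = tt , a , λ b → h
Play-next n p (pick Abelard x q) ρ eq h = tt , 0 , h

next-Play : ∀ n p N ρ → view p ≡ N → Alive N →
  ∀ a → (∀ b → Play n (view (target p N (by a b))) (revalue N ρ (by a b))) → Play (suc n) N ρ
next-Play n p (leaf s t u) ρ eq alive a h = subst (λ N → Play n N ρ) eq (h 0)
next-Play n p (move q) ρ eq alive a h = h 0
next-Play n p (choose Eloise q q') ρ eq alive zero h = inj₁ (h 0)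
next-Play n p (choose Eloise q q') ρ eq alive (suc a) h = inj₂ (h 0)
next-Play n p (choose Abelard q q') ρ eq alive a h = h 0 , h 1
next-Play n p (pick Eloise x q) ρ eq alive a h = a , h 0
next-Play n p (pick Abelard x q) ρ eq alive a h = h

assignᶠ : ℕ → ℕ → (ℕ → Tm) → Form
assignᶠ j zero f = zeroᵗ ≐ zeroᵗ
assignᶠ j (suc n) f = (var (valueⱽ n j) ≐ f n) ∧ᶠ assignᶠ j n f

assign-elim : ∀ j n f r → ⟦ assignᶠ j n f ⟧ᶠ r → ∀ y → y < n → r (valueⱽ y j) ≡ ⟦ f y ⟧ᵗ r
assign-elim j (suc n) f r (p , ps) y (s≤s le) with m≤n⇒m<n∨m≡n le
... | inj₁ lt = assign-elim j n f r ps y lt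
... | inj₂ refl = p

assign-intro : ∀ j n f r → (∀ y → y < n → r (valueⱽ y j) ≡ ⟦ f y ⟧ᵗ r) → ⟦ assignᶠ j n f ⟧ᶠ r
assign-intro j zero f r h = refl
assign-intro j (suc n) f r h = h n (n<1+n n) , assign-intro j n f r (λ y lt → h y (m<n⇒m<1+n lt))

assign-qf : ∀ j n f → QuantFree (assignᶠ j n f)
assign-qf j zero f = qf≐
assign-qf j (suc n) f = qf∧ qf≐ (assign-qf j n f)

renameᵗ : Tm → Tm
renameᵗ (var x) = var (valueⱽ x 0)
renameᵗ zeroᵗ = zeroᵗ
renameᵗ (sucᵗ t) = sucᵗ (renameᵗ t)
renameᵗ (t +ᵗ u) = renameᵗ t +ᵗ renameᵗ u
renameᵗ (t *ᵗ u) = renameᵗ t *ᵗ renameᵗ u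

⟦rename⟧ : ∀ t {K} r ρ → boundᵗ t ≤ K → (∀ y → y < K → r (valueⱽ y 0) ≡ ρ y) → ⟦ renameᵗ t ⟧ᵗ r ≡ ⟦ t ⟧ᵗ ρ
⟦rename⟧ (var x) r ρ le h = h x le
⟦rename⟧ zeroᵗ r ρ le h = refl
⟦rename⟧ (sucᵗ t) r ρ le h = cong suc (⟦rename⟧ t r ρ le h)
⟦rename⟧ (t +ᵗ u) r ρ le h = cong₂ _+_
  (⟦rename⟧ t r ρ (≤-trans (m≤m⊔n _ _) le) h) (⟦rename⟧ u r ρ (≤-trans (m≤n⊔m (boundᵗ t) _) le) h)
⟦rename⟧ (t *ᵗ u) r ρ le h = cong₂ _*_
  (⟦rename⟧ t r ρ (≤-trans (m≤m⊔n _ _) le) h) (⟦rename⟧ u r ρ (≤-trans (m≤n⊔m (boundᵗ t) _) le) h)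

rename-free : ∀ t {K x} → boundᵗ t ≤ K → FreeTm x (renameᵗ t) → Σ ℕ λ y → y < K × x ≡ valueⱽ y 0
rename-free (var y) le refl = y , le , refl
rename-free (sucᵗ t) le f = rename-free t le f
rename-free (t +ᵗ u) le (inj₁ f) = rename-free t (≤-trans (m≤m⊔n _ _) le) f
rename-free (t +ᵗ u) le (inj₂ f) = rename-free u (≤-trans (m≤n⊔m (boundᵗ t) _) le) f
rename-free (t *ᵗ u) le (inj₁ f) = rename-free t (≤-trans (m≤m⊔n _ _) le) f
rename-free (t *ᵗ u) le (inj₂ f) = rename-free u (≤-trans (m≤n⊔m (boundᵗ t) _) le) f

-- Level suc j holds the state before a step and level j the state after it,
-- so that the innermost block is level 0.
module Unfolding (S : List Pos) (code : Pos → ℕ) (K : ℕ) where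

  current : ℕ → ℕ → Tm
  current j y = var (valueⱽ y (suc j))

  changed : ℕ → ℕ → Tm → ℕ → Tm
  changed j x t y with y ≟ x
  ... | yes _ = t
  ... | no _ = current j y

  gotoᶠ : ℕ → Pos → Form
  gotoᶠ j q = var (posⱽ j) ≐ num (code q)

  moveᶠ : ℕ → Node → Form
  moveᶠ j (leaf s t u) = (var (posⱽ j) ≐ var (posⱽ (suc j))) ∧ᶠ assignᶠ j K (current j)
  moveᶠ j dead = ⊥ᶠ
  moveᶠ j (move q) = gotoᶠ j q ∧ᶠ assignᶠ j K (current j)
  moveᶠ j (choose c q q') =
    (((var (choiceⱽ c j) ≐ zeroᵗ) ∧ᶠ gotoᶠ j q) ∨ᶠ ((¬ᶠ (var (choiceⱽ c j) ≐ zeroᵗ)) ∧ᶠ gotoᶠ j q')) ∧ᶠ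
    assignᶠ j K (current j)
  moveᶠ j (pick c x q) = gotoᶠ j q ∧ᶠ assignᶠ j K (changed j x (var (choiceⱽ c j)))

  finishᶠ : Node → Form
  finishᶠ (leaf s t u) = literal s (renameᵗ t) (renameᵗ u)
  finishᶠ _ = ⊥ᶠ

  at : ℕ → Pos → Form → Form
  at j p φ = (var (posⱽ j) ≐ num (code p)) ∧ᶠ φ

  anyᶠ : (Pos → Form) → List Pos → Form
  anyᶠ f [] = ⊥ᶠ
  anyᶠ f (p ∷ ps) = f p ∨ᶠ anyᶠ f ps

  stepᶠ : ℕ → Form
  stepᶠ j = anyᶠ (λ p → at (suc j) p (moveᶠ j (view p))) S

  finalᶠ : Form
  finalᶠ = anyᶠ (λ p → at 0 p (finishᶠ (view p))) S

  stepsᶠ : ℕ → Form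
  stepsᶠ zero = finalᶠ
  stepsᶠ (suc j) = stepᶠ j ∧ᶠ stepsᶠ j

  prefix : ℕ → Form → Form
  prefix zero φ = φ
  prefix (suc j) φ = quantify j (components K) (prefix j φ)

  initᶠ : ℕ → Pos → (ℕ → ℕ) → Form
  initᶠ n p ρ = at n p (assignᶠ n K (λ y → num (ρ y)))

  -- n steps have n + 1 states, hence n + 1 blocks; the choices in the outermost one are idle. The
  -- start values enter only as numerals in `initᶠ`, which keeps the sentence closed.
  sentence : ℕ → Pos → (ℕ → ℕ) → Form
  sentence n p ρ = prefix (suc n) (initᶠ n p ρ ∧ᶠ stepsᶠ n)

  State : ℕ → Assign → Pos → Assign → Set
  State j r p ρ = r (posⱽ j) ≡ code p × (∀ y → y < K → r (valueⱽ y j) ≡ ρ y)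

  any-elim : ∀ f ps r → ⟦ anyᶠ f ps ⟧ᶠ r → Σ Pos λ p → p ∈ ps × ⟦ f p ⟧ᶠ r
  any-elim f (p ∷ ps) r (inj₁ h) = p , here refl , h
  any-elim f (p ∷ ps) r (inj₂ h) = let q , q∈ , h' = any-elim f ps r h in q , there q∈ , h'

  any-intro : ∀ f {p ps} r → p ∈ ps → ⟦ f p ⟧ᶠ r → ⟦ anyᶠ f ps ⟧ᶠ r
  any-intro f r (here refl) h = inj₁ h
  any-intro f r (there p∈) h = inj₂ (any-intro f r p∈ h)

  ⟦changed⟧ : ∀ j x c r ρ → (∀ y → y < K → r (valueⱽ y (suc j)) ≡ ρ y) →
    ∀ y → y < K → ⟦ changed j x (var c) y ⟧ᵗ r ≡ (ρ [ x ≔ r c ]) y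
  ⟦changed⟧ j x c r ρ h y lt with y ≟ x
  ... | yes _ = refl
  ... | no _ = h y lt

  module _ j r p ρ (st : State (suc j) r p ρ) where

    private
      ch : Chooser → ℕ
      ch c = r (choiceⱽ c j)

      keep : ⟦ assignᶠ j K (current j) ⟧ᶠ r → ∀ y → y < K → r (valueⱽ y j) ≡ ρ y
      keep h y lt = trans (assign-elim j K (current j) r h y lt) (proj₂ st y lt)

      kept : (∀ y → y < K → r (valueⱽ y j) ≡ ρ y) → ⟦ assignᶠ j K (current j) ⟧ᶠ r
      kept h = assign-intro j K (current j) r (λ y lt → trans (h y lt) (sym (proj₂ st y lt)))

    move-elim : ∀ N → ⟦ moveᶠ j N ⟧ᶠ r → Alive N × State j r (target p N ch) (revalue N ρ ch)
    move-elim (leaf s t u) (h , h') = tt , trans h (proj₁ st) , keep h'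
    move-elim (move q) (h , h') = tt , trans h (⟦num⟧ (code q) r) , keep h'
    move-elim (choose c q q') (h , h') with r (choiceⱽ c j) | h
    ... | zero | inj₁ (_ , g) = tt , trans g (⟦num⟧ (code q) r) , keep h'
    ... | zero | inj₂ (¬p , g) = contradiction refl ¬p
    ... | suc _ | inj₂ (_ , g) = tt , trans g (⟦num⟧ (code q') r) , keep h'
    move-elim (pick c x q) (h , h') = tt , trans h (⟦num⟧ (code q) r) , λ y lt →
      trans (assign-elim j K (changed j x (var (choiceⱽ c j))) r h' y lt) (⟦changed⟧ j x (choiceⱽ c j) r ρ (proj₂ st) y lt)

    move-intro : ∀ N → Alive N → State j r (target p N ch) (revalue N ρ ch) → ⟦ moveᶠ j N ⟧ᶠ r
    move-intro (leaf s t u) alive (h , h') = trans h (sym (proj₁ st)) , kept h'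
    move-intro (move q) alive (h , h') = trans h (sym (⟦num⟧ (code q) r)) , kept h'
    move-intro (choose c q q') alive (h , h') = chosen h , kept h'
      where
      chosen : r (posⱽ j) ≡ code (select (ch c) q q') →
        (ch c ≡ 0 × r (posⱽ j) ≡ ⟦ num (code q) ⟧ᵗ r) ⊎ (¬ ch c ≡ 0 × r (posⱽ j) ≡ ⟦ num (code q') ⟧ᵗ r)
      chosen h with ch c
      ... | zero = inj₁ (refl , trans h (sym (⟦num⟧ (code q) r)))
      ... | suc _ = inj₂ ((λ ()) , trans h (sym (⟦num⟧ (code q') r)))
    move-intro (pick c x q) alive (h , h') = trans h (sym (⟦num⟧ (code q) r)) ,
      assign-intro j K (changed j x (var (choiceⱽ c j))) r λ y lt →
        trans (h' y lt) (sym (⟦changed⟧ j x (choiceⱽ c j) r ρ (proj₂ st) y lt))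

  -- The lower end gives freshness for the blocks further in; the upper end and the bound on c give
  -- closedness of the sentence.
  Level : ℕ → ℕ → ℕ → Set
  Level lo hi x = Σ ℕ λ c → Σ ℕ λ i → x ≡ ⟨ c , i ⟩ × c < 3 + K × lo ≤ i × i ≤ hi

  record OnLevels (lo hi : ℕ) (φ : Form) : Set where
    constructor on
    field level : ∀ x → FreeF x φ → Level lo hi x

  record OnLevelsᵗ (lo hi : ℕ) (t : Tm) : Set where
    constructor onᵗ
    field levelᵗ : ∀ x → FreeTm x t → Level lo hi x

  open OnLevels
  open OnLevelsᵗ

  levels-weaken : ∀ {lo lo' hi hi' φ} → lo' ≤ lo → hi ≤ hi' → OnLevels lo hi φ → OnLevels lo' hi' φ
  levels-weaken le le' h = on λ x f →
    let c , i , p , lt , l , l' = level h x f in c , i , p , lt , ≤-trans le l , ≤-trans l' le'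

  levels-≐ : ∀ {lo hi t u} → OnLevelsᵗ lo hi t → OnLevelsᵗ lo hi u → OnLevels lo hi (t ≐ u)
  levels-≐ h h' = on λ { x (inj₁ f) → levelᵗ h x f ; x (inj₂ f) → levelᵗ h' x f }

  levels-¬ : ∀ {lo hi φ} → OnLevels lo hi φ → OnLevels lo hi (¬ᶠ φ)
  levels-¬ h = on (level h)

  levels-∧ : ∀ {lo hi φ ψ} → OnLevels lo hi φ → OnLevels lo hi ψ → OnLevels lo hi (φ ∧ᶠ ψ)
  levels-∧ h h' = on λ { x (inj₁ f) → level h x f ; x (inj₂ f) → level h' x f }

  levels-∨ : ∀ {lo hi φ ψ} → OnLevels lo hi φ → OnLevels lo hi ψ → OnLevels lo hi (φ ∨ᶠ ψ)
  levels-∨ h h' = on λ { x (inj₁ f) → level h x f ; x (inj₂ f) → level h' x f }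

  levels-var : ∀ {lo hi} c i → c < 3 + K → lo ≤ i → i ≤ hi → OnLevelsᵗ lo hi (var ⟨ c , i ⟩)
  levels-var c i lt le le' = onᵗ λ x p → c , i , p , lt , le , le'

  levels-num : ∀ {lo hi} n → OnLevelsᵗ lo hi (num n)
  levels-num n = onᵗ λ x f → ⊥-elim (num-closed n f)

  levels-assign : ∀ {lo hi} j n f → n ≤ K → lo ≤ j → j ≤ hi → (∀ y → y < K → OnLevelsᵗ lo hi (f y)) →
    OnLevels lo hi (assignᶠ j n f)
  levels-assign j zero f le l l' h = levels-≐ (levels-num 0) (levels-num 0)
  levels-assign j (suc n) f le l l' h =
    levels-∧ (levels-≐ (levels-var (3 + n) j (s≤s (s≤s (s≤s le))) l l') (h n le))
      (levels-assign j n f (<⇒≤ le) l l' h)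

  levels-at : ∀ {lo hi} j p {φ} → lo ≤ j → j ≤ hi → OnLevels lo hi φ → OnLevels lo hi (at j p φ)
  levels-at j p l l' = levels-∧ (levels-≐ (levels-var 0 j (s≤s z≤n) l l') (levels-num (code p)))

  levels-any : ∀ {lo hi} f ps → (∀ {p} → p ∈ ps → OnLevels lo hi (f p)) → OnLevels lo hi (anyᶠ f ps)
  levels-any f [] h = on λ _ ()
  levels-any f (p ∷ ps) h = levels-∨ (h (here refl)) (levels-any f ps (h ∘ there))

  levels-choice : ∀ {lo hi} c j → lo ≤ j → j ≤ hi → OnLevelsᵗ lo hi (var (choiceⱽ c j))
  levels-choice Eloise j = levels-var 1 j (s≤s (s≤s z≤n))
  levels-choice Abelard j = levels-var 2 j (s≤s (s≤s (s≤s z≤n)))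

  levels-current : ∀ j y → y < K → OnLevelsᵗ j (suc j) (current j y)
  levels-current j y lt = levels-var (3 + y) (suc j) (s≤s (s≤s (s≤s lt))) (m≤n+m j 1) ≤-refl

  levels-changed : ∀ j x c y → y < K → OnLevelsᵗ j (suc j) (changed j x (var (choiceⱽ c j)) y)
  levels-changed j x c y lt with y ≟ x
  ... | yes _ = levels-choice c j ≤-refl (m≤n+m j 1)
  ... | no _ = levels-current j y lt

  levels-keep : ∀ j → OnLevels j (suc j) (assignᶠ j K (current j))
  levels-keep j = levels-assign j K (current j) ≤-refl ≤-refl (m≤n+m j 1) (levels-current j)

  levels-goto : ∀ j q → OnLevels j (suc j) (gotoᶠ j q)
  levels-goto j q = levels-≐ (levels-var 0 j (s≤s z≤n) ≤-refl (m≤n+m j 1)) (levels-num (code q))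

  levels-move : ∀ j N → OnLevels j (suc j) (moveᶠ j N)
  levels-move j (leaf s t u) = levels-∧
    (levels-≐ (levels-var 0 j (s≤s z≤n) ≤-refl (m≤n+m j 1)) (levels-var 0 (suc j) (s≤s z≤n) (m≤n+m j 1) ≤-refl))
    (levels-keep j)
  levels-move j dead = on λ _ ()
  levels-move j (move q) = levels-∧ (levels-goto j q) (levels-keep j)
  levels-move j (choose c q q') = levels-∧
    (levels-∨ (levels-∧ zero? (levels-goto j q)) (levels-∧ (levels-¬ zero?) (levels-goto j q')))
    (levels-keep j)
    where
    zero? : OnLevels j (suc j) (var (choiceⱽ c j) ≐ zeroᵗ)
    zero? = levels-≐ (levels-choice c j ≤-refl (m≤n+m j 1)) (levels-num 0)
  levels-move j (pick c x q) = levels-∧ (levels-goto j q)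
    (levels-assign j K (changed j x (var (choiceⱽ c j))) ≤-refl ≤-refl (m≤n+m j 1) (levels-changed j x c))

  levels-step : ∀ j → OnLevels j (suc j) (stepᶠ j)
  levels-step j = levels-any _ S λ {p} _ → levels-at (suc j) p (m≤n+m j 1) ≤-refl (levels-move j (view p))

  levels-init : ∀ n p ρ → OnLevels n n (initᶠ n p ρ)
  levels-init n p ρ = levels-at n p ≤-refl ≤-refl
    (levels-assign n K _ ≤-refl ≤-refl ≤-refl (λ y _ → levels-num (ρ y)))

  levels-rename : ∀ t → boundᵗ t ≤ K → OnLevelsᵗ 0 0 (renameᵗ t)
  levels-rename t le = onᵗ λ x f →
    let y , lt , p = rename-free t le f in 3 + y , 0 , p , s≤s (s≤s (s≤s lt)) , z≤n , z≤n

  levels-finish : ∀ N → LeafBound K N → OnLevels 0 0 (finishᶠ N)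
  levels-finish (leaf ⊕ t u) (le , le') = levels-≐ (levels-rename t le) (levels-rename u le')
  levels-finish (leaf ⊖ t u) (le , le') = levels-¬ (levels-≐ (levels-rename t le) (levels-rename u le'))
  levels-finish dead b = on λ _ ()
  levels-finish (move q) b = on λ _ ()
  levels-finish (choose c q q') b = on λ _ ()
  levels-finish (pick c x q) b = on λ _ ()

  any-qf : ∀ f ps → (∀ p → QuantFree (f p)) → QuantFree (anyᶠ f ps)
  any-qf f [] h = qf⊥
  any-qf f (p ∷ ps) h = qf∨ (h p) (any-qf f ps h)

  move-qf : ∀ j N → QuantFree (moveᶠ j N)
  move-qf j (leaf s t u) = qf∧ qf≐ (assign-qf j K _)
  move-qf j dead = qf⊥
  move-qf j (move q) = qf∧ qf≐ (assign-qf j K _)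
  move-qf j (choose c q q') = qf∧ (qf∨ (qf∧ qf≐ qf≐) (qf∧ (qf¬ qf≐) qf≐)) (assign-qf j K _)
  move-qf j (pick c x q) = qf∧ qf≐ (assign-qf j K _)

  finish-qf : ∀ N → QuantFree (finishᶠ N)
  finish-qf (leaf ⊕ t u) = qf≐
  finish-qf (leaf ⊖ t u) = qf¬ qf≐
  finish-qf dead = qf⊥
  finish-qf (move q) = qf⊥
  finish-qf (choose c q q') = qf⊥
  finish-qf (pick c x q) = qf⊥

  steps-qf : ∀ n → QuantFree (stepsᶠ n)
  steps-qf zero = any-qf _ S λ p → qf∧ qf≐ (finish-qf (view p))
  steps-qf (suc j) = qf∧ (any-qf _ S λ p → qf∧ qf≐ (move-qf j (view p))) (steps-qf j)

  prefix-prenex : ∀ {φ} n → Prenex φ → Prenex (prefix n φ)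
  prefix-prenex zero p = p
  prefix-prenex (suc n) p = quantify-prenex n (components K) (prefix-prenex n p)

  sentence-prenex : ∀ n p ρ → Prenex (sentence n p ρ)
  sentence-prenex n p ρ = prefix-prenex (suc n) (matrix (qf∧ (qf∧ qf≐ (assign-qf n K _)) (steps-qf n)))

  prefix-free : ∀ {x φ} n → FreeF x (prefix n φ) → FreeF x φ × (∀ c j → j < n → c < 3 + K → x ≢ ⟨ c , j ⟩)
  prefix-free zero f = f , λ _ _ ()
  prefix-free {x} {φ} (suc n) f with quantify-free n (components K) f
  ... | f' , all with prefix-free {x} {φ} n f'
  ...   | f'' , below = f'' , bound
    where
    bound : ∀ c j → j < suc n → c < 3 + K → x ≢ ⟨ c , j ⟩
    bound c j (s≤s le) lt with m≤n⇒m<n∨m≡n le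
    ... | inj₁ j<n = below c j j<n lt
    ... | inj₂ refl = lookupᴸ all (proj₂ (components-∈ K lt))

  Fresh : ℕ → Form → Set
  Fresh n φ = ∀ c j → j < n → ¬ FreeF ⟨ c , j ⟩ φ

  levels-fresh : ∀ {lo hi φ} → OnLevels lo hi φ → Fresh lo φ
  levels-fresh h c j lt f with level h ⟨ c , j ⟩ f
  ... | d , i , p , _ , le , _ with pair-injective c j d i p
  ... | _ , refl = <⇒≱ lt le

  -- Prenex form puts all blocks in front of the matrix. This recovers the nested reading, where a
  -- step is settled before the later blocks are played.
  prefix-push : ∀ {φ ψ} n → Fresh n φ → ∀ r → ⟦ prefix n (φ ∧ᶠ ψ) ⟧ᶠ r → ⟦ φ ⟧ᶠ r × ⟦ prefix n ψ ⟧ᶠ r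
  prefix-push zero fresh r h = h
  prefix-push {φ} {ψ} (suc n) fresh r h = quantify-push {φ} {prefix n ψ} n (components K) (λ c → fresh c n (n<1+n n)) r
    (quantify-map {prefix n (φ ∧ᶠ ψ)} {φ ∧ᶠ prefix n ψ} n (components K)
      (prefix-push {φ} {ψ} n (λ c j lt → fresh c j (m<n⇒m<1+n lt))) r h)

  prefix-pull : ∀ {φ ψ} n → Fresh n φ → ∀ r → ⟦ φ ⟧ᶠ r → ⟦ prefix n ψ ⟧ᶠ r → ⟦ prefix n (φ ∧ᶠ ψ) ⟧ᶠ r
  prefix-pull zero fresh r h h' = h , h'
  prefix-pull {φ} {ψ} (suc n) fresh r h h' =
    quantify-map {φ ∧ᶠ prefix n ψ} {prefix n (φ ∧ᶠ ψ)} n (components K)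
      (λ r (p , q) → prefix-pull {φ} {ψ} n (λ c j lt → fresh c j (m<n⇒m<1+n lt)) r p q) r
      (quantify-pull {φ} {prefix n ψ} n (components K) (λ c → fresh c n (n<1+n n)) r h h')

  state-frame : ∀ j i r r' p ρ → i ≢ j → SameExcept j r r' → State i r p ρ → State i r' p ρ
  state-frame j i r r' p ρ i≢j same (h , h') =
    trans (same 0 i i≢j) h , λ y lt → trans (same (3 + y) i i≢j) (h' y lt)

  block-state : ∀ j r a b p ρ → State j (block K j r a b (code p) ρ) p ρ
  block-state j r a b p ρ = block-pos K j r a b (code p) ρ , block-value K j r a b (code p) ρ

  module Correct
    (code-injective : ∀ {p q} → p ∈ S → code p ≡ code q → p ≡ q)
    (closed : ∀ {p} → p ∈ S → Successors (_∈ S) (view p))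
    (bounded : ∀ {p} → p ∈ S → LeafBound K (view p)) where

    levels-steps : ∀ n → OnLevels 0 n (stepsᶠ n)
    levels-steps zero = levels-any _ S λ {p} p∈ → levels-at 0 p z≤n z≤n (levels-finish (view p) (bounded p∈))
    levels-steps (suc n) = levels-∧
      (levels-weaken z≤n ≤-refl (levels-step n)) (levels-weaken z≤n (m≤n+m n 1) (levels-steps n))

    sentence-closed : ∀ n p ρ → Sentence (sentence n p ρ)
    sentence-closed n p ρ x f with prefix-free {x} {initᶠ n p ρ ∧ᶠ stepsᶠ n} (suc n) f
    ... | f' , outside
      with level (levels-∧ (levels-weaken z≤n ≤-refl (levels-init n p ρ)) (levels-steps n)) x f'
    ...   | c , i , eq , lt , _ , le = outside c i (s≤s le) lt eq

    -- The position variable holds the code of p, and codes are injective on `S`, so the disjunct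
    -- that holds must be that of p.
    at-elim : ∀ j {p} ρ r (f : Node → Form) → p ∈ S → State j r p ρ →
      ⟦ anyᶠ (λ p → at j p (f (view p))) S ⟧ᶠ r → ⟦ f (view p) ⟧ᶠ r
    at-elim j {p} ρ r f p∈ (eq , _) h with any-elim _ S r h
    ... | q , q∈ , eq' , h' with code-injective q∈ (trans (sym (⟦num⟧ (code q) r)) (trans (sym eq') eq))
    ...   | refl = h'

    at-intro : ∀ j {p} ρ r (f : Node → Form) → p ∈ S → State j r p ρ → ⟦ f (view p) ⟧ᶠ r →
      ⟦ anyᶠ (λ p → at j p (f (view p))) S ⟧ᶠ r
    at-intro j {p} ρ r f p∈ (eq , _) h = any-intro _ r p∈ (trans eq (sym (⟦num⟧ (code p) r)) , h)

    finish-elim : ∀ N {r ρ} → LeafBound K N → (∀ y → y < K → r (valueⱽ y 0) ≡ ρ y) → ⟦ finishᶠ N ⟧ᶠ r → Play 0 N ρ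
    finish-elim (leaf ⊕ t u) (le , le') h p = trans (sym (⟦rename⟧ t _ _ le h)) (trans p (⟦rename⟧ u _ _ le' h))
    finish-elim (leaf ⊖ t u) (le , le') h p q = p (trans (⟦rename⟧ t _ _ le h) (trans q (sym (⟦rename⟧ u _ _ le' h))))

    finish-intro : ∀ N {r ρ} → LeafBound K N → (∀ y → y < K → r (valueⱽ y 0) ≡ ρ y) → Play 0 N ρ → ⟦ finishᶠ N ⟧ᶠ r
    finish-intro (leaf ⊕ t u) (le , le') h p = trans (⟦rename⟧ t _ _ le h) (trans p (sym (⟦rename⟧ u _ _ le' h)))
    finish-intro (leaf ⊖ t u) (le , le') h p q = p (trans (sym (⟦rename⟧ t _ _ le h)) (trans q (⟦rename⟧ u _ _ le' h)))

    steps-elim : ∀ n {r p ρ} → p ∈ S → State n r p ρ → ⟦ prefix n (stepsᶠ n) ⟧ᶠ r → Play n (view p) ρ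
    steps-elim zero {r} {p} {ρ} p∈ st h = finish-elim (view p) (bounded p∈) (proj₂ st) (at-elim 0 ρ r finishᶠ p∈ st h)
    -- Any reply of Abelard shows that the node is not dead; 0 is used.
    steps-elim (suc n) {r} {p} {ρ} p∈ st h = next-Play n p (view p) ρ refl (proj₁ (after 0)) a (proj₂ ∘ after)
      where
      e = block-elim {prefix n (stepᶠ n ∧ᶠ stepsᶠ n)} K n r h
      a = proj₁ e
      after : ∀ b → Alive (view p) × Play n (view (target p (view p) (by a b))) (revalue (view p) ρ (by a b))
      after b with proj₂ e b
      ... | r' , h' , choices , same with prefix-push {stepᶠ n} {stepsᶠ n} n (levels-fresh (levels-step n)) r' h'
      ... | hstep , hrest with move-elim n r' p ρ (state-frame n (suc n) r r' p ρ 1+n≢n same st) (view p)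
                                 (at-elim (suc n) ρ r' (moveᶠ n) p∈ (state-frame n (suc n) r r' p ρ 1+n≢n same st) hstep)
      ... | alive , st' = alive , steps-elim n (target-∈ {_∈ S} (view p) (by a b) p∈ (closed p∈))
              (subst₂ (State n r') (target-cong p (view p) choices) (revalue-cong (view p) ρ choices) st') hrest

    steps-intro : ∀ n {r p ρ} → p ∈ S → State n r p ρ → Play n (view p) ρ → ⟦ prefix n (stepsᶠ n) ⟧ᶠ r
    steps-intro zero {r} {p} {ρ} p∈ st h = at-intro 0 ρ r finishᶠ p∈ st (finish-intro (view p) (bounded p∈) (proj₂ st) h)
    steps-intro (suc n) {r} {p} {ρ} p∈ st h with Play-next n p (view p) ρ refl h
    -- The existential state variables receive the actual successor state for each reply b.
    ... | alive , a , plays = block-intro {prefix n (stepᶠ n ∧ᶠ stepsᶠ n)} K n r a λ b → code (q b) , ρ' b , holds b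
      where
      q : ℕ → Pos
      q b = target p (view p) (by a b)
      ρ' : ℕ → Assign
      ρ' b = revalue (view p) ρ (by a b)
      holds : ∀ b → ⟦ prefix n (stepᶠ n ∧ᶠ stepsᶠ n) ⟧ᶠ (block K n r a b (code (q b)) (ρ' b))
      holds b = prefix-pull {stepᶠ n} {stepsᶠ n} n (levels-fresh (levels-step n)) r'
        (at-intro (suc n) ρ r' (moveᶠ n) p∈ st' (move-intro n r' p ρ st' (view p) alive
          (subst₂ (State n r') (sym (target-cong p (view p) choices)) (sym (revalue-cong (view p) ρ choices)) st'')))
        (steps-intro n (target-∈ {_∈ S} (view p) (by a b) p∈ (closed p∈)) st'' (plays b))
        where
        r' : Assign
        r' = block K n r a b (code (q b)) (ρ' b)
        choices = block-choice K n r a b (code (q b)) (ρ' b)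
        st' : State (suc n) r' p ρ
        st' = state-frame n (suc n) r r' p ρ 1+n≢n (block-frame K n r a b (code (q b)) (ρ' b)) st
        st'' : State n r' (q b) (ρ' b)
        st'' = block-state n r a b (q b) (ρ' b)

    -- The values written into the sentence and those of the game come from different functions, so
    -- only pointwise equality is asked; this avoids function extensionality.
    sentence-elim : ∀ n {p ρ' ρ} r → p ∈ S → (∀ y → ρ' y ≡ ρ y) → ⟦ sentence n p ρ' ⟧ᶠ r → Play n (view p) ρ
    sentence-elim n {p} {ρ'} r p∈ eq h with proj₂ (block-elim {prefix n (initᶠ n p ρ' ∧ᶠ stepsᶠ n)} K n r h) 0
    ... | r' , h' , _ with prefix-push {initᶠ n p ρ'} {stepsᶠ n} n (levels-fresh (levels-init n p ρ')) r' h'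
    ... | (h₁ , h₂) , hrest = steps-elim n p∈
      ( trans h₁ (⟦num⟧ (code p) r')
      , λ y lt → trans (assign-elim n K _ r' h₂ y lt) (trans (⟦num⟧ (ρ' y) r') (eq y))) hrest

    sentence-intro : ∀ n {p ρ' ρ} r → p ∈ S → (∀ y → ρ' y ≡ ρ y) → Play n (view p) ρ → ⟦ sentence n p ρ' ⟧ᶠ r
    sentence-intro n {p} {ρ'} {ρ} r p∈ eq h = block-intro {prefix n (initᶠ n p ρ' ∧ᶠ stepsᶠ n)} K n r 0 λ b →
      code p , ρ , prefix-pull {initᶠ n p ρ'} {stepsᶠ n} n (levels-fresh (levels-init n p ρ')) (r' b)
        ( trans (proj₁ (st b)) (sym (⟦num⟧ (code p) (r' b)))
        , assign-intro n K _ (r' b) λ y lt → trans (proj₂ (st b) y lt) (trans (sym (eq y)) (sym (⟦num⟧ (ρ' y) (r' b)))))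
        (steps-intro n p∈ (st b) h)
      where
      r' : ℕ → Assign
      r' b = block K n r 0 b (code p) ρ
      st : ∀ b → State n (r' b) p ρ
      st b = block-state n r 0 b p ρ

    Play⇒T : ∀ n {p ρ'} ρ → p ∈ S → (∀ y → ρ' y ≡ ρ y) → Play n (view p) ρ → T ⌜ sentence n p ρ' ⌝
    Play⇒T n {p} {ρ'} ρ p∈ eq h = sentence n p ρ' , sentence-prenex n p ρ' , sentence-closed n p ρ' , refl ,
      sentence-intro n (λ _ → 0) p∈ eq h

    T⇒Play : ∀ n {p ρ'} ρ → p ∈ S → (∀ y → ρ' y ≡ ρ y) → T ⌜ sentence n p ρ' ⌝ → Play n (view p) ρ
    -- Membership in `T` provides some true sentence with this code; injectivity identifies it with
    -- the intended one.
    T⇒Play n {p} {ρ'} ρ p∈ eq (φ , _ , _ , same-code , h) = sentence-elim n (λ _ → 0) p∈ eq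
      (subst (λ φ → ⟦ φ ⟧ᶠ (λ _ → 0)) (⌜⌝-injective φ (sentence n p ρ') same-code) h)

-- Computing the code of the sentence.

module Codes {O : ℕ → Set} (S : List Pos) (code : Pos → ℕ) (K : ℕ) where
  open Unfolding S code K

  record Codeᵗ {m} (t : Vec ℕ m → Tm) : Set where
    constructor codeᵗ
    field computableᵗ : Computable {O} (λ v → ⌜ t v ⌝ᵗ)

  record Codeᶠ {m} (φ : Vec ℕ m → Form) : Set where
    constructor codeᶠ
    field computableᶠ : Computable {O} (λ v → ⌜ φ v ⌝)

  open Codeᵗ
  open Codeᶠ

  private variable
    m : ℕ
    J : Vec ℕ m → ℕ

  code-var : ∀ c → Computable {O} J → Codeᵗ (λ v → var ⟨ c , J v ⟩)
  code-var c j = codeᵗ (c-tag 0 (c-tag c j))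

  code-const : ∀ t → Codeᵗ {m} (λ _ → t)
  code-const t = codeᵗ (c-const ⌜ t ⌝ᵗ)

  code-num : Computable {O} J → Codeᵗ (λ v → num (J v))
  code-num j = codeᵗ (c-app₁ (c-rec {H = λ v → ⟨ 2 , lookup v (suc zero) ⟩} (λ k _ → ⌜ num k ⌝ᵗ)
    (λ _ → refl) (λ _ _ → refl) (c-const ⟨ 1 , 0 ⟩) (c-tag 2 (c-proj (suc zero)))) j)

  code-≐ : ∀ {t u : Vec ℕ m → Tm} → Codeᵗ t → Codeᵗ u → Codeᶠ (λ v → t v ≐ u v)
  code-≐ c d = codeᶠ (c-tag₂ 0 (computableᵗ c) (computableᵗ d))

  code-⊥ : Codeᶠ {m} (λ _ → ⊥ᶠ)
  code-⊥ = codeᶠ (c-const ⌜ ⊥ᶠ ⌝)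

  code-¬ : ∀ {φ : Vec ℕ m → Form} → Codeᶠ φ → Codeᶠ (λ v → ¬ᶠ φ v)
  code-¬ c = codeᶠ (c-tag 2 (computableᶠ c))

  code-∧ : ∀ {φ ψ : Vec ℕ m → Form} → Codeᶠ φ → Codeᶠ ψ → Codeᶠ (λ v → φ v ∧ᶠ ψ v)
  code-∧ c d = codeᶠ (c-tag₂ 3 (computableᶠ c) (computableᶠ d))

  code-∨ : ∀ {φ ψ : Vec ℕ m → Form} → Codeᶠ φ → Codeᶠ ψ → Codeᶠ (λ v → φ v ∨ᶠ ψ v)
  code-∨ c d = codeᶠ (c-tag₂ 4 (computableᶠ c) (computableᶠ d))

  -- The number n of variables is fixed and only the level is an input, so this recursion builds the
  -- program and is not run by it.
  code-assign : ∀ {f : Vec ℕ m → ℕ → Tm} n → Computable {O} J → (∀ y → Codeᵗ (λ v → f v y)) →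
    Codeᶠ (λ v → assignᶠ (J v) n (f v))
  code-assign zero j h = code-≐ (code-const zeroᵗ) (code-const zeroᵗ)
  code-assign (suc n) j h = code-∧ (code-≐ (code-var (3 + n) j) (h n)) (code-assign n j h)

  code-keep : Computable {O} J → Codeᶠ (λ v → assignᶠ (J v) K (current (J v)))
  code-keep j = code-assign K j (λ y → code-var (3 + y) (c-suc j))

  code-choice : ∀ c → Computable {O} J → Codeᵗ (λ v → var (choiceⱽ c (J v)))
  code-choice Eloise j = code-var 1 j
  code-choice Abelard j = code-var 2 j

  code-changed : ∀ x c → Computable {O} J → ∀ y → Codeᵗ (λ v → changed (J v) x (var (choiceⱽ c (J v))) y)
  code-changed x c j y with y ≟ x
  ... | yes _ = code-choice c j
  ... | no _ = code-var (3 + y) (c-suc j)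

  code-goto : ∀ q → Computable {O} J → Codeᶠ (λ v → gotoᶠ (J v) q)
  code-goto q j = code-≐ (code-var 0 j) (code-const (num (code q)))

  code-move : ∀ N → Computable {O} J → Codeᶠ (λ v → moveᶠ (J v) N)
  code-move (leaf s t u) j = code-∧ (code-≐ (code-var 0 j) (code-var 0 (c-suc j))) (code-keep j)
  code-move dead j = code-⊥
  code-move (move q) j = code-∧ (code-goto q j) (code-keep j)
  code-move (choose c q q') j = code-∧
    (code-∨ (code-∧ (code-≐ (code-choice c j) (code-const zeroᵗ)) (code-goto q j))
            (code-∧ (code-¬ (code-≐ (code-choice c j) (code-const zeroᵗ))) (code-goto q' j)))
    (code-keep j)
  code-move (pick c x q) j = code-∧ (code-goto q j) (code-assign K j (code-changed x c j))

  code-at : ∀ p {φ : Vec ℕ m → Form} → Computable {O} J → Codeᶠ φ → Codeᶠ (λ v → at (J v) p (φ v))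
  code-at p j = code-∧ (code-goto p j)

  code-any : ∀ (f : Vec ℕ m → Pos → Form) ps → (∀ p → Codeᶠ (λ v → f v p)) → Codeᶠ (λ v → anyᶠ (f v) ps)
  code-any f [] h = code-⊥
  code-any f (p ∷ ps) h = code-∨ (h p) (code-any f ps h)

  code-step : Computable {O} J → Codeᶠ (λ v → stepᶠ (J v))
  code-step j = code-any _ S λ p → code-at p (c-suc j) (code-move (view p) j)

  code-steps : Computable {O} J → Codeᶠ (λ v → stepsᶠ (J v))
  code-steps j = codeᶠ (c-app₁ (c-rec {H = λ v → ⟨ 3 , ⟨ ⌜ stepᶠ (lookup v zero) ⌝ , lookup v (suc zero) ⟩ ⟩}
    (λ k _ → ⌜ stepsᶠ k ⌝) (λ _ → refl) (λ _ _ → refl) (c-const ⌜ finalᶠ ⌝)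
    (c-tag₂ 3 (computableᶠ (code-step (c-proj zero))) (c-proj (suc zero)))) j)

  -- A recursion on the number of blocks receives only the code of what has been prefixed so far, so
  -- quantification has to act on codes.
  quantifyᶜ : ℕ → List (Chooser × ℕ) → ℕ → ℕ
  quantifyᶜ j [] n = n
  quantifyᶜ j ((Eloise , c) ∷ cs) n = ⟨ 5 , ⟨ ⟨ c , j ⟩ , quantifyᶜ j cs n ⟩ ⟩
  quantifyᶜ j ((Abelard , c) ∷ cs) n = ⟨ 6 , ⟨ ⟨ c , j ⟩ , quantifyᶜ j cs n ⟩ ⟩

  ⌜quantify⌝ : ∀ j cs φ → ⌜ quantify j cs φ ⌝ ≡ quantifyᶜ j cs ⌜ φ ⌝
  ⌜quantify⌝ j [] φ = refl
  ⌜quantify⌝ j ((Eloise , c) ∷ cs) φ =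
    cong (λ n → ⟨ 5 , ⟨ ⟨ c , j ⟩ , n ⟩ ⟩) {⌜ quantify j cs φ ⌝} {quantifyᶜ j cs ⌜ φ ⌝} (⌜quantify⌝ j cs φ)
  ⌜quantify⌝ j ((Abelard , c) ∷ cs) φ =
    cong (λ n → ⟨ 6 , ⟨ ⟨ c , j ⟩ , n ⟩ ⟩) {⌜ quantify j cs φ ⌝} {quantifyᶜ j cs ⌜ φ ⌝} (⌜quantify⌝ j cs φ)

  c-quantify : ∀ {C : Vec ℕ m → ℕ} cs → Computable {O} J → Computable {O} C →
    Computable {O} (λ v → quantifyᶜ (J v) cs (C v))
  c-quantify [] j n = n
  c-quantify ((Eloise , c) ∷ cs) j n = c-tag₂ 5 (c-tag c j) (c-quantify cs j n)
  c-quantify ((Abelard , c) ∷ cs) j n = c-tag₂ 6 (c-tag c j) (c-quantify cs j n)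

  prefixᶜ : List (Chooser × ℕ) → ℕ → ℕ → ℕ
  prefixᶜ cs zero n = n
  prefixᶜ cs (suc j) n = quantifyᶜ j cs (prefixᶜ cs j n)

  ⌜prefix⌝ : ∀ j φ → ⌜ prefix j φ ⌝ ≡ prefixᶜ (components K) j ⌜ φ ⌝
  ⌜prefix⌝ zero φ = refl
  ⌜prefix⌝ (suc j) φ = trans (⌜quantify⌝ j (components K) (prefix j φ)) (cong (quantifyᶜ j (components K)) (⌜prefix⌝ j φ))

  c-prefix : ∀ cs → Computable {O} {2} (λ v → prefixᶜ cs (head v) (head (tail v)))
  c-prefix cs = c-rec {H = λ v → quantifyᶜ (lookup v zero) cs (lookup v (suc zero))}
    (λ k v → prefixᶜ cs k (head v)) (λ { (_ ∷ []) → refl }) (λ _ _ → refl) (c-proj zero)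
    (c-quantify cs (c-proj zero) (c-proj (suc zero)))

  Computable-≗ : ∀ {F G : Vec ℕ m → ℕ} → (∀ v → F v ≡ G v) → Computable {O} F → Computable {O} G
  Computable-≗ eq (f , p) = f , λ v → subst (Eval O f v) (eq v) (p v)

  code-prefix : ∀ {φ : Vec ℕ m → Form} → Computable {O} J → Codeᶠ φ → Codeᶠ (λ v → prefix (J v) (φ v))
  code-prefix {J = J} {φ} j c = codeᶠ (Computable-≗ (λ v → sym (⌜prefix⌝ (J v) (φ v)))
    (c-app₂ (c-prefix (components K)) j (computableᶠ c)))

  code-sentence : ∀ p {ρ : Vec ℕ m → ℕ → ℕ} → Computable {O} J → (∀ y → Computable {O} (λ v → ρ v y)) →
    Codeᶠ (λ v → sentence (J v) p (ρ v))
  code-sentence {J = J} p {ρ} j h = code-prefix {φ = λ v → initᶠ (J v) p (ρ v) ∧ᶠ stepsᶠ (J v)} (c-suc j)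
    (code-∧ (code-at p j (code-assign K j λ y → code-num (h y))) (code-steps j))

-- The fields hide the shape of the queries: comparing Gödel numbers up to
-- definitional equality would normalise the powers of 2 in the pairing.
record Queries (F : BFm) : Set where
  field
    query      : ℕ → Assign → ℕ
    Play⇒query : ∀ n {ρ ρ'} → (∀ y → ρ' y ≡ ρ y) → Play n (view (⊕ , F , [])) ρ → T (query n ρ')
    query⇒Play : ∀ n {ρ ρ'} → (∀ y → ρ' y ≡ ρ y) → T (query n ρ') → Play n (view (⊕ , F , [])) ρ
    c-query    : ∀ {m} {J : Vec ℕ m → ℕ} {ρ : Vec ℕ m → Assign} → Computable {T} J →
                 (∀ y → Computable {T} (λ v → ρ v y)) → Computable {T} (λ v → query (J v) (ρ v))

-- From defining formulas to oracle relations.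

module ToΣ (em : ExcludedMiddle 0ℓ) where
  open Indexing em

  queries : ∀ F → Queries F
  queries F = record
    { query      = λ n ρ → ⌜ sentence n (⊕ , F , []) ρ ⌝
    ; Play⇒query = λ n {ρ} {ρ'} → Play⇒T n {⊕ , F , []} {ρ'} ρ (here refl)
    ; query⇒Play = λ n {ρ} {ρ'} → T⇒Play n {⊕ , F , []} {ρ'} ρ (here refl)
    ; c-query    = λ {m} {J} {ρ} j h → Codeᶠ.computableᶠ (code-sentence {m} {J} (⊕ , F , []) {ρ} j h)
    }
    where
    S : List Pos
    S = positions F []

    open Unfolding S (index S) (boundᵇ F)
    open Correct (index-injective S)
      (lookupᴸ (positions-closed (_∈ S) F [] (tabulateᴸ id) tt))
      (lookupᴸ (positions-bounded (boundᵇ F) F [] ≤-refl))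
    open Codes {T} S (index S) (boundᵇ F)

  definable⇒Σ⁰ω+1 : ∀ k (X : Vec ℕ k → Set) → BndSCL-definable k X → Σ⁰ω+1 k X
  definable⇒Σ⁰ω+1 k X (F , _ , X⇔F) = from-queries (queries F)
    where
    steps : Vec ℕ (k + 1) → ℕ
    steps w = lookup w (k ↑ʳ zero)

    start : Vec ℕ (k + 1) → Assign
    start w y with y <? k
    ... | yes y<k = lookup w (fromℕ< y<k ↑ˡ 1)
    ... | no _ = 0

    c-start : ∀ y → Computable {T} (λ w → start w y)
    c-start y with y <? k
    ... | yes y<k = c-proj (fromℕ< y<k ↑ˡ 1)
    ... | no _ = c-const 0

    start-++ : ∀ (x : Vec ℕ k) z y → start (x ++ z) y ≡ vecAssign x y
    start-++ x z y with y <? k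
    ... | yes y<k = lookup-++ˡ x z (fromℕ< y<k)
    ... | no _ = refl

    from-queries : Queries F → Σ⁰ω+1 k X
    -- The single witness is the number of steps, the last entry of w.
    from-queries Q = 1 , R , (f , λ w → computes w) , λ x → mk⇔ (to x) (from x)
      where
      open Queries Q

      program : Computable {T} (λ w → query (steps w) (start w))
      program = c-query {ρ = start} (c-proj (k ↑ʳ zero)) c-start

      f : PR (k + 1)
      f = compᶠ oracleᶠ (proj₁ program ∷ [])

      R : Vec ℕ (k + 1) → Set
      R w = T (query (steps w) (start w))

      computes : ∀ w → (R w → Eval T f w 1) × (¬ R w → Eval T f w 0)
      computes w = (λ t → ev-comp (evV-∷ (proj₂ program w) evV-[]) (ev-yes t))
                 , (λ ¬t → ev-comp (evV-∷ (proj₂ program w) evV-[]) (ev-no ¬t))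

      to : ∀ x → X x → Σ (Vec ℕ 1) λ y → R (x ++ y)
      to x h with ⊨ω⇒Win {φ = F} (Equivalence.to (X⇔F x) h)
      ... | m , w = n ∷ [] , Play⇒query (steps (x ++ (n ∷ []))) (start-++ x (n ∷ []))
        (subst (λ l → Play l (view (⊕ , F , [])) (vecAssign x)) (sym (lookup-++ʳ x (n ∷ []) zero)) (Win⇒Play m ⊕ F [] _ w))
        where
        n : ℕ
        n = rounds m F []

      from : ∀ x → Σ (Vec ℕ 1) (λ y → R (x ++ y)) → X x
      from x (y , t) = Equivalence.from (X⇔F x) (Win⇒⊨ω {φ = F}
        (Play⇒Win (steps (x ++ y)) ⊕ F [] _ (query⇒Play (steps (x ++ y)) (start-++ x y) t)))

theorem7p6 : ExcludedMiddle 0ℓ →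
    (k : ℕ) (X : Vec ℕ k → Set) → BndSCL-definable k X ⇔ Σ⁰ω+1 k X
theorem7p6 em k X = mk⇔ (ToΣ.definable⇒Σ⁰ω+1 em k X) (FromΣ.Σ⁰ω+1⇒definable em k X)
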